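{- Let $p(x)\in\mathbb{Z}[x]$ be a monic polynomial with even degree, with simple or double roots belonging to the set $\left\{\ldots,-3,-2,-1,\tfrac12,\tfrac32,\tfrac52,\ldots\right\}$, and such that $p(x)=p\left(-\tfrac12-x\right)$. Then $$ \sum_{n\geq 0}\frac{4n+1}{p(n)}\left[\frac{1}{4^n}\binom{2n}{n}\right]^4 $$ is a rational multiple of $\frac{1}{\pi^2}$.
   Context: The set of admissible roots consists of all negative integers together with all positive half-integers $\tfrac12,\tfrac32,\tfrac52,\ldots$. A rational multiple of a real number $c$ means a number of the form $qc$ with $q\in\mathbb{Q}$.
   Formalization: p is taken monic with rational rather than integer coefficients (a monic integer polynomial has no half-integer roots, so symmetry would leave only p = 1), and p is assumed nonconstant, since for p = 1 the series diverges. -}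

module Defs where

open import Algebra.Definitions.RawSemiring using (_^_)
open import Data.Integer.Base as ℤ using (+_; -[1+_]; +[1+_])
import Data.Integer.Properties as ℤ
open import Data.List.Base using (List; []; _∷_; foldr; filter; length)
open import Data.Nat.Base as ℕ using (ℕ; zero; suc)
open import Data.Nat.Combinatorics using (_C_)
import Data.Nat.Properties as ℕ
open import Data.Product.Base using (∃; ∃-syntax; _×_; _,_; proj₁; proj₂)
open import Data.Rational.Base hiding (_≃_)
open import Data.Rational.Properties
open import Data.Rational.Solver using (module +-*-Solver)
import Data.Rational.Unnormalised.Base as ℚᵘ
import Data.Rational.Unnormalised.Properties as ℚᵘ
open import Data.Sum.Base using (_⊎_; inj₁; inj₂)
open import Relation.Binary.PropositionalEquality
open import Relation.Nullary using (yes; no; contradiction)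

infixr 8 _^ℚ_

_^ℚ_ : ℚ → ℕ → ℚ
_^ℚ_ = _^_ +-*-rawSemiring

fromℕ : ℕ → ℚ
fromℕ n = + n / 1

-- Total reciprocal; the value at 0 is junk.
inv : ℚ → ℚ
inv q with q ≟ 0ℚ
... | yes _   = 0ℚ
... | no q≢0 = (1/ q) {{≢-nonZero q≢0}}

inv-inverseʳ : ∀ {q} → q ≢ 0ℚ → q * inv q ≡ 1ℚ
inv-inverseʳ {q} q≢0 with q ≟ 0ℚ
... | yes q≡0  = contradiction q≡0 q≢0
... | no  q≢0′ = *-inverseʳ q {{≢-nonZero q≢0′}}

inv-pos : ∀ {q} → 0ℚ < q → 0ℚ < inv q
inv-pos {q} 0<q with q ≟ 0ℚ
... | yes q≡0 = contradiction 0<q (<-irrefl (sym q≡0))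
... | no  _   = positive⁻¹ _ {{1/pos⇒pos q {{positive 0<q}}}}

∑< : ℕ → (ℕ → ℚ) → ℚ
∑< zero    f = 0ℚ
∑< (suc n) f = ∑< n f + f n

module ℚ-Lemmas where
  *-mono-≤ : ∀ {a b c d} → 0ℚ ≤ c → 0ℚ ≤ b → a ≤ b → c ≤ d → a * c ≤ b * d
  *-mono-≤ {a} {b} {c} {d} 0≤c 0≤b a≤b c≤d = ≤-trans
    (*-monoʳ-≤-nonNeg c {{nonNegative 0≤c}} a≤b)
    (*-monoˡ-≤-nonNeg b {{nonNegative 0≤b}} c≤d)

  *-pos : ∀ {p q} → 0ℚ < p → 0ℚ < q → 0ℚ < p * q
  *-pos {p} {q} 0<p 0<q =
    positive⁻¹ _ {{pos*pos⇒pos p {{positive 0<p}} q {{positive 0<q}}}}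

  +-pos : ∀ {p q} → 0ℚ < p → 0ℚ < q → 0ℚ < p + q
  +-pos 0<p 0<q = +-mono-< 0<p 0<q

  ∣p-q∣-comm : ∀ p q → ∣ p - q ∣ ≡ ∣ q - p ∣
  ∣p-q∣-comm p q = trans (sym (∣-p∣≡∣p∣ (p - q))) (cong ∣_∣ lemma)
    where
    open +-*-Solver
    lemma : - (p - q) ≡ q - p
    lemma = solve 2 (λ p q → :- (p :- q) := q :- p) refl p q

  triangle : ∀ p q r → ∣ p - r ∣ ≤ ∣ p - q ∣ + ∣ q - r ∣
  triangle p q r = subst (λ t → ∣ t ∣ ≤ ∣ p - q ∣ + ∣ q - r ∣) lemma
    (∣p+q∣≤∣p∣+∣q∣ (p - q) (q - r))
    where
    open +-*-Solver
    lemma : (p - q) + (q - r) ≡ p - r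
    lemma = solve 3 (λ p q r → (p :- q) :+ (q :- r) := p :- r) refl p q r

  ∣inv∣≤ : ∀ {δ x} → 0ℚ < δ → δ ≤ ∣ x ∣ → x ≢ 0ℚ × ∣ inv x ∣ ≤ inv δ
  ∣inv∣≤ {δ} {x} 0<δ δ≤x = x≢0 , (begin
    ∣ inv x ∣                     ≡⟨ sym (*-identityʳ _) ⟩
    ∣ inv x ∣ * 1ℚ                ≡⟨ cong (∣ inv x ∣ *_) (sym (inv-inverseʳ δ≢0)) ⟩
    ∣ inv x ∣ * (δ * inv δ)       ≤⟨ *-monoˡ-≤-nonNeg ∣ inv x ∣ {{∣-∣-nonNeg (inv x)}}
                                      (*-monoʳ-≤-nonNeg (inv δ) {{nonNegative (<⇒≤ (inv-pos 0<δ))}} δ≤x) ⟩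
    ∣ inv x ∣ * (∣ x ∣ * inv δ)   ≡⟨ sym (*-assoc ∣ inv x ∣ ∣ x ∣ (inv δ)) ⟩
    ∣ inv x ∣ * ∣ x ∣ * inv δ     ≡⟨ cong (_* inv δ) (sym (∣p*q∣≡∣p∣*∣q∣ (inv x) x)) ⟩
    ∣ inv x * x ∣ * inv δ         ≡⟨ cong (λ t → ∣ t ∣ * inv δ) (trans (*-comm (inv x) x) (inv-inverseʳ x≢0)) ⟩
    1ℚ * inv δ                    ≡⟨ *-identityˡ _ ⟩
    inv δ                         ∎)
    where
    open ≤-Reasoning
    δ≢0 : δ ≢ 0ℚ
    δ≢0 δ≡0 = <-irrefl (sym δ≡0) 0<δ
    x≢0 : x ≢ 0ℚ
    x≢0 refl = <-irrefl refl (<-≤-trans 0<δ δ≤x)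

open ℚ-Lemmas

IsCauchy : (ℕ → ℚ) → Set
IsCauchy u = ∀ ε → 0ℚ < ε →
  ∃[ N ] ∀ m n → N ℕ.≤ m → N ℕ.≤ n → ∣ u m - u n ∣ ≤ ε

-- Equality of reals is _≃_, not _≡_.
record ℝ : Set where
  field
    seq    : ℕ → ℚ
    cauchy : IsCauchy seq

open ℝ public

infix  4 _≃_ _≤ℝ_ _#0
infixl 6 _-ℝ_
infixl 7 _*ℝ_

_≃_ : ℝ → ℝ → Set
x ≃ y = ∀ ε → 0ℚ < ε → ∃[ N ] ∀ n → N ℕ.≤ n → ∣ seq x n - seq y n ∣ ≤ ε

_≤ℝ_ : ℝ → ℝ → Set
x ≤ℝ y = ∀ ε → 0ℚ < ε → ∃[ N ] ∀ n → N ℕ.≤ n → seq x n ≤ seq y n + ε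

_#0 : ℝ → Set
x #0 = ∃[ δ ] 0ℚ < δ × ∃[ N ] ∀ n → N ℕ.≤ n → δ ≤ ∣ seq x n ∣

fromℚ : ℚ → ℝ
fromℚ q = record
  { seq    = λ _ → q
  ; cauchy = λ ε 0<ε → 0 , λ _ _ _ _ →
      subst (λ t → ∣ t ∣ ≤ ε) (sym (+-inverseʳ q)) (<⇒≤ 0<ε)
  }

∣_∣ℝ : ℝ → ℝ
∣ x ∣ℝ = record
  { seq    = λ n → ∣ seq x n ∣
  ; cauchy = λ ε 0<ε → let N , h = cauchy x ε 0<ε in
      N , λ m n N≤m N≤n → ≤-trans (reverse (seq x m) (seq x n)) (h m n N≤m N≤n)
  }
  where
  step : ∀ p q → ∣ p ∣ - ∣ q ∣ ≤ ∣ p - q ∣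
  step p q = begin
    ∣ p ∣ - ∣ q ∣                  ≡⟨ cong (λ t → ∣ t ∣ - ∣ q ∣) (solve 2 (λ p q → p := (p :- q) :+ q) refl p q) ⟩
    ∣ (p - q) + q ∣ - ∣ q ∣        ≤⟨ +-monoˡ-≤ (- ∣ q ∣) (∣p+q∣≤∣p∣+∣q∣ (p - q) q) ⟩
    ∣ p - q ∣ + ∣ q ∣ - ∣ q ∣      ≡⟨ solve 2 (λ a b → a :+ b :- b := a) refl ∣ p - q ∣ ∣ q ∣ ⟩
    ∣ p - q ∣                      ∎
    where
    open ≤-Reasoning
    open +-*-Solver
  reverse : ∀ p q → ∣ ∣ p ∣ - ∣ q ∣ ∣ ≤ ∣ p - q ∣
  reverse p q with ∣p∣≡p∨∣p∣≡-p (∣ p ∣ - ∣ q ∣)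
  ... | inj₁ eq = ≤-trans (≤-reflexive eq) (step p q)
  ... | inj₂ eq = ≤-trans
    (≤-reflexive (trans eq (solve 2 (λ a b → :- (a :- b) := b :- a) refl ∣ p ∣ ∣ q ∣)))
    (≤-trans (step q p) (≤-reflexive (∣p-q∣-comm q p)))
    where
    open +-*-Solver

_-ℝ_ : ℝ → ℝ → ℝ
x -ℝ y = record
  { seq    = λ n → seq x n - seq y n
  ; cauchy = λ ε 0<ε →
      let 0<½ε   = *-pos (positive⁻¹ ½) 0<ε
          M , hx = cauchy x (½ * ε) 0<½ε
          N , hy = cauchy y (½ * ε) 0<½ε
      in M ℕ.⊔ N , λ m n N≤m N≤n →
        bound (seq x m) (seq x n) (seq y m) (seq y n)
          (hx m n (ℕ.m⊔n≤o⇒m≤o M N N≤m) (ℕ.m⊔n≤o⇒m≤o M N N≤n))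
          (hy m n (ℕ.m⊔n≤o⇒n≤o M N N≤m) (ℕ.m⊔n≤o⇒n≤o M N N≤n))
  }
  where
  bound : ∀ a b c d {ε} → ∣ a - b ∣ ≤ ½ * ε → ∣ c - d ∣ ≤ ½ * ε →
          ∣ (a - c) - (b - d) ∣ ≤ ε
  bound a b c d {ε} h k = begin
    ∣ (a - c) - (b - d) ∣      ≡⟨ cong ∣_∣ (solve 4 (λ a b c d → (a :- c) :- (b :- d) := (a :- b) :- (c :- d)) refl a b c d) ⟩
    ∣ (a - b) - (c - d) ∣      ≤⟨ ∣p-q∣≤∣p∣+∣q∣ (a - b) (c - d) ⟩
    ∣ a - b ∣ + ∣ c - d ∣      ≤⟨ +-mono-≤ h k ⟩
    ½ * ε + ½ * ε              ≡⟨ sym (*-distribʳ-+ ε ½ ½) ⟩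
    1ℚ * ε                     ≡⟨ *-identityˡ ε ⟩
    ε                          ∎
    where
    open ≤-Reasoning
    open +-*-Solver

eventually-bounded : ∀ x → ∃[ B ] 0ℚ < B × ∃[ N ] ∀ n → N ℕ.≤ n → ∣ seq x n ∣ ≤ B
eventually-bounded x =
  let N , h = cauchy x 1ℚ (positive⁻¹ 1ℚ)
      u     = seq x
  in 1ℚ + ∣ u N ∣ , +-mono-<-≤ (positive⁻¹ 1ℚ) (0≤∣p∣ (u N)) , N , λ n N≤n → begin
    ∣ u n ∣                    ≡⟨ cong ∣_∣ (solve 2 (λ p q → p := (p :- q) :+ q) refl (u n) (u N)) ⟩
    ∣ (u n - u N) + u N ∣      ≤⟨ ∣p+q∣≤∣p∣+∣q∣ (u n - u N) (u N) ⟩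
    ∣ u n - u N ∣ + ∣ u N ∣    ≤⟨ +-monoˡ-≤ ∣ u N ∣ (h n N N≤n ℕ.≤-refl) ⟩
    1ℚ + ∣ u N ∣               ∎
  where
  open ≤-Reasoning
  open +-*-Solver

_*ℝ_ : ℝ → ℝ → ℝ
x *ℝ y = record { seq = λ n → seq x n * seq y n ; cauchy = prf }
  where
  bound : ∀ a b c d {A D δ} → 0ℚ ≤ A → 0ℚ ≤ D → ∣ a ∣ ≤ A → ∣ d ∣ ≤ D →
          ∣ a - b ∣ ≤ δ → ∣ c - d ∣ ≤ δ → ∣ a * c - b * d ∣ ≤ (A + D) * δ
  bound a b c d {A} {D} {δ} 0≤A 0≤D a≤A d≤D h k = begin
    ∣ a * c - b * d ∣                  ≡⟨ cong ∣_∣ (solve 4 (λ a b c d → a :* c :- b :* d := a :* (c :- d) :+ d :* (a :- b)) refl a b c d) ⟩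
    ∣ a * (c - d) + d * (a - b) ∣      ≤⟨ ∣p+q∣≤∣p∣+∣q∣ (a * (c - d)) (d * (a - b)) ⟩
    ∣ a * (c - d) ∣ + ∣ d * (a - b) ∣  ≡⟨ cong₂ _+_ (∣p*q∣≡∣p∣*∣q∣ a (c - d)) (∣p*q∣≡∣p∣*∣q∣ d (a - b)) ⟩
    ∣ a ∣ * ∣ c - d ∣ + ∣ d ∣ * ∣ a - b ∣
      ≤⟨ +-mono-≤ (*-mono-≤ (0≤∣p∣ (c - d)) 0≤A a≤A k) (*-mono-≤ (0≤∣p∣ (a - b)) 0≤D d≤D h) ⟩
    A * δ + D * δ                      ≡⟨ sym (*-distribʳ-+ δ A D) ⟩
    (A + D) * δ                        ∎
    where
    open ≤-Reasoning
    open +-*-Solver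
  prf : IsCauchy (λ n → seq x n * seq y n)
  prf ε 0<ε =
    let A , 0<A , K , hA = eventually-bounded x
        D , 0<D , L , hD = eventually-bounded y
        0<A+D  = +-pos 0<A 0<D
        δ      = inv (A + D) * ε
        0<δ    = *-pos (inv-pos 0<A+D) 0<ε
        M , hx = cauchy x δ 0<δ
        N , hy = cauchy y δ 0<δ
        P = (K ℕ.⊔ L) ℕ.⊔ (M ℕ.⊔ N)
        A+D*δ≡ε : (A + D) * δ ≡ ε
        A+D*δ≡ε = trans (sym (*-assoc (A + D) (inv (A + D)) ε))
          (trans (cong (_* ε) (inv-inverseʳ (λ eq → <-irrefl (sym eq) 0<A+D))) (*-identityˡ ε))
        KL : ∀ {m} → P ℕ.≤ m → K ℕ.⊔ L ℕ.≤ m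
        KL = ℕ.m⊔n≤o⇒m≤o (K ℕ.⊔ L) (M ℕ.⊔ N)
        MN : ∀ {m} → P ℕ.≤ m → M ℕ.⊔ N ℕ.≤ m
        MN = ℕ.m⊔n≤o⇒n≤o (K ℕ.⊔ L) (M ℕ.⊔ N)
    in P , λ m n P≤m P≤n → ≤-trans
      (bound (seq x m) (seq x n) (seq y m) (seq y n) (<⇒≤ 0<A) (<⇒≤ 0<D)
        (hA m (ℕ.m⊔n≤o⇒m≤o K L (KL P≤m))) (hD n (ℕ.m⊔n≤o⇒n≤o K L (KL P≤n)))
        (hx m n (ℕ.m⊔n≤o⇒m≤o M N (MN P≤m)) (ℕ.m⊔n≤o⇒m≤o M N (MN P≤n)))
        (hy m n (ℕ.m⊔n≤o⇒n≤o M N (MN P≤m)) (ℕ.m⊔n≤o⇒n≤o M N (MN P≤n))))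
      (≤-reflexive A+D*δ≡ε)

invℝ : (x : ℝ) → x #0 → ℝ
invℝ x (δ , 0<δ , K , away) = record { seq = λ n → inv (seq x n) ; cauchy = prf }
  where
  bound : ∀ a b → δ ≤ ∣ a ∣ → δ ≤ ∣ b ∣ → ∀ {ε} → 0ℚ ≤ ε → ∣ a - b ∣ ≤ δ * δ * ε →
          ∣ inv a - inv b ∣ ≤ ε
  bound a b δ≤a δ≤b {ε} 0≤ε h =
    let a≢0 , ia = ∣inv∣≤ {x = a} 0<δ δ≤a
        b≢0 , ib = ∣inv∣≤ {x = b} 0<δ δ≤b
        i = inv a ; j = inv b ; e = inv δ
        δe≡1 = inv-inverseʳ {δ} (λ eq → <-irrefl (sym eq) 0<δ)
        0≤e : 0ℚ ≤ e
        0≤e = <⇒≤ (inv-pos 0<δ)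
        diff : i - j ≡ i * j * (b - a)
        diff = begin-equality
          i - j                          ≡⟨ sym (cong₂ _-_ (*-identityʳ i) (*-identityʳ j)) ⟩
          i * 1ℚ - j * 1ℚ                ≡⟨ sym (cong₂ (λ s t → i * s - j * t) (inv-inverseʳ b≢0) (inv-inverseʳ a≢0)) ⟩
          i * (b * j) - j * (a * i)      ≡⟨ solve 4 (λ a b i j → i :* (b :* j) :- j :* (a :* i) := i :* j :* (b :- a)) refl a b i j ⟩
          i * j * (b - a)                ∎
    in begin
      ∣ i - j ∣                      ≡⟨ cong ∣_∣ diff ⟩
      ∣ i * j * (b - a) ∣            ≡⟨ ∣p*q∣≡∣p∣*∣q∣ (i * j) (b - a) ⟩
      ∣ i * j ∣ * ∣ b - a ∣          ≡⟨ cong₂ _*_ (∣p*q∣≡∣p∣*∣q∣ i j) (∣p-q∣-comm b a) ⟩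
      ∣ i ∣ * ∣ j ∣ * ∣ a - b ∣      ≤⟨ *-mono-≤ (0≤∣p∣ (a - b)) (subst (_≤ e * e) (*-zeroˡ 0ℚ) (*-mono-≤ ≤-refl 0≤e 0≤e 0≤e))
                                          (*-mono-≤ (0≤∣p∣ j) 0≤e ia ib) h ⟩
      e * e * (δ * δ * ε)            ≡⟨ solve 3 (λ d e ε → e :* e :* (d :* d :* ε) := (d :* e) :* (d :* e) :* ε) refl δ e ε ⟩
      (δ * e) * (δ * e) * ε          ≡⟨ cong (λ t → t * t * ε) δe≡1 ⟩
      1ℚ * 1ℚ * ε                    ≡⟨ *-identityˡ ε ⟩
      ε                              ∎
    where
    open ≤-Reasoning
    open +-*-Solver
  prf : IsCauchy (λ n → inv (seq x n))
  prf ε 0<ε =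
    let N , h = cauchy x (δ * δ * ε) (*-pos (*-pos 0<δ 0<δ) 0<ε)
    in K ℕ.⊔ N , λ m n P≤m P≤n → bound (seq x m) (seq x n)
         (away m (ℕ.m⊔n≤o⇒m≤o K N P≤m)) (away n (ℕ.m⊔n≤o⇒m≤o K N P≤n)) (<⇒≤ 0<ε)
         (h m n (ℕ.m⊔n≤o⇒n≤o K N P≤m) (ℕ.m⊔n≤o⇒n≤o K N P≤n))

*-#0 : ∀ x y → x #0 → y #0 → x *ℝ y #0
*-#0 x y (δ , 0<δ , M , h) (η , 0<η , N , k) =
  δ * η , *-pos 0<δ 0<η , M ℕ.⊔ N , λ n P≤n → ≤-trans
    (*-mono-≤ (<⇒≤ 0<η) (0≤∣p∣ (seq x n))
      (h n (ℕ.m⊔n≤o⇒m≤o M N P≤n)) (k n (ℕ.m⊔n≤o⇒n≤o M N P≤n)))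
    (≤-reflexive (sym (∣p*q∣≡∣p∣*∣q∣ (seq x n) (seq y n))))

_⟶_ : (ℕ → ℝ) → ℝ → Set
X ⟶ x = ∀ ε → 0ℚ < ε → ∃[ N ] ∀ n → N ℕ.≤ n → ∣ X n -ℝ x ∣ℝ ≤ℝ fromℚ ε

HasSum : (ℕ → ℚ) → ℝ → Set
HasSum f s = (λ N → fromℚ (∑< N f)) ⟶ s

IsRationalMultipleOf : ℝ → ℝ → Set
IsRationalMultipleOf x c = ∃[ q ] x ≃ fromℚ q *ℝ c

-- Terms of 4 - 4/3 + 4/5 - ⋯ (Gregory–Leibniz), whose sum defines π below.
leibniz : ℕ → ℚ
leibniz k = (- 1ℚ) ^ℚ k * (+ 4 / suc (2 ℕ.* k))

module Leibniz where
  a : ℕ → ℚ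
  a k = + 4 / suc (2 ℕ.* k)

  S : ℕ → ℚ
  S n = ∑< n leibniz

  fromℚᵘ-mono-≤ : ∀ {p q} → p ℚᵘ.≤ q → fromℚᵘ p ≤ fromℚᵘ q
  fromℚᵘ-mono-≤ {p} {q} p≤q = toℚᵘ-cancel-≤
    (ℚᵘ.≤-respˡ-≃ (ℚᵘ.≃-sym (toℚᵘ-fromℚᵘ p))
      (ℚᵘ.≤-respʳ-≃ (ℚᵘ.≃-sym (toℚᵘ-fromℚᵘ q)) p≤q))

  a-anti : ∀ k → a (suc k) ≤ a k
  a-anti k = fromℚᵘ-mono-≤ {ℚᵘ.mkℚᵘ (+ 4) (2 ℕ.* suc k)} {ℚᵘ.mkℚᵘ (+ 4) (2 ℕ.* k)}
    (ℚᵘ.*≤* (ℤ.*-monoˡ-≤-nonNeg (+ 4) (ℤ.+≤+ (ℕ.s≤s (ℕ.*-monoʳ-≤ 2 (ℕ.n≤1+n k))))))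

  0≤a : ∀ k → 0ℚ ≤ a k
  0≤a k = nonNegative⁻¹ _ {{normalize-nonNeg 4 (suc (2 ℕ.* k))}}

  2a≤ : ∀ ε → 0ℚ < ε → ∃[ N ] a N + a N ≤ ε
  2a≤ (mkℚ (+ 0) d _)      (*<* (ℤ.+<+ ()))
  2a≤ (mkℚ -[1+ _ ] d _)   (*<* ())
  2a≤ ε@(mkℚ +[1+ m ] d _) _ = N ,
    subst₂ _≤_ (sym double) (fromℚᵘ-toℚᵘ ε)
      (fromℚᵘ-mono-≤ {ℚᵘ.mkℚᵘ (+ 8) (2 ℕ.* N)} {toℚᵘ ε}
        (ℚᵘ.*≤* (subst₂ ℤ._≤_ (ℤ.pos-* 8 (suc d)) (ℤ.pos-* (suc m) (suc (2 ℕ.* N))) (ℤ.+≤+ bound))))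
    where
    N = 4 ℕ.* suc d
    bound : 8 ℕ.* suc d ℕ.≤ suc m ℕ.* suc (2 ℕ.* N)
    bound = begin
      8 ℕ.* suc d                 ≡⟨ ℕ.*-assoc 2 4 (suc d) ⟩
      2 ℕ.* N                     ≤⟨ ℕ.n≤1+n _ ⟩
      suc (2 ℕ.* N)               ≤⟨ ℕ.m≤m+n _ _ ⟩
      suc m ℕ.* suc (2 ℕ.* N)     ∎
      where
      open ℕ.≤-Reasoning
    double : a N + a N ≡ + 8 / suc (2 ℕ.* N)
    double = toℚᵘ-injective (begin
      toℚᵘ (a N + a N)             ≈⟨ toℚᵘ-homo-+ (a N) (a N) ⟩
      toℚᵘ (a N) ℚᵘ.+ toℚᵘ (a N)   ≈⟨ ℚᵘ.+-cong (toℚᵘ-fromℚᵘ f) (toℚᵘ-fromℚᵘ f) ⟩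
      f ℚᵘ.+ f                     ≈⟨ ℚᵘ.*≡* eq ⟩
      g                            ≈⟨ ℚᵘ.≃-sym (toℚᵘ-fromℚᵘ g) ⟩
      toℚᵘ (+ 8 / suc (2 ℕ.* N))   ∎)
      where
      open ℚᵘ.≃-Reasoning
      D = suc (2 ℕ.* N)
      f = ℚᵘ.mkℚᵘ (+ 4) (2 ℕ.* N)
      g = ℚᵘ.mkℚᵘ (+ 8) (2 ℕ.* N)
      eq : (+ 4 ℤ.* + D ℤ.+ + 4 ℤ.* + D) ℤ.* + D ≡ + 8 ℤ.* (+ D ℤ.* + D)
      eq = trans (cong (ℤ._* + D) (sym (ℤ.*-distribʳ-+ (+ D) (+ 4) (+ 4))))
                 (ℤ.*-assoc (+ 8) (+ D) (+ D))

  alt : ℕ → ℕ → ℚ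
  alt i zero    = 0ℚ
  alt i (suc m) = a i - alt (suc i) m

  alt-bounds : ∀ i m → 0ℚ ≤ alt i m × alt i m ≤ a i
  alt-bounds i zero    = ≤-refl , 0≤a i
  alt-bounds i (suc m) =
    let lo , hi = alt-bounds (suc i) m in
    subst (_≤ a i - alt (suc i) m) (+-inverseʳ (alt (suc i) m))
      (+-monoˡ-≤ (- alt (suc i) m) (≤-trans hi (a-anti i))) ,
    subst (a i - alt (suc i) m ≤_) (+-identityʳ (a i))
      (+-monoʳ-≤ (a i) (neg-antimono-≤ lo))

  S-split : ∀ i m → S (i ℕ.+ m) - S i ≡ (- 1ℚ) ^ℚ i * alt i m
  S-split i zero = trans (cong (λ t → S t - S i) (ℕ.+-identityʳ i))
    (trans (+-inverseʳ (S i)) (sym (*-zeroʳ ((- 1ℚ) ^ℚ i))))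
  S-split i (suc m) = begin
    S (i ℕ.+ suc m) - S i
      ≡⟨ cong (λ t → S t - S i) (ℕ.+-suc i m) ⟩
    S (suc i ℕ.+ m) - S i
      ≡⟨ solve 3 (λ x y z → x :- y := (x :- (y :+ z)) :+ z) refl (S (suc i ℕ.+ m)) (S i) (leibniz i) ⟩
    (S (suc i ℕ.+ m) - S (suc i)) + leibniz i
      ≡⟨ cong (_+ leibniz i) (S-split (suc i) m) ⟩
    (- 1ℚ) * s * alt (suc i) m + s * a i
      ≡⟨ solve 3 (λ s x y → (:- con 1ℚ) :* s :* x :+ s :* y := s :* (y :- x)) refl s (alt (suc i) m) (a i) ⟩
    s * (a i - alt (suc i) m)  ∎
    where
    s = (- 1ℚ) ^ℚ i
    open ≡-Reasoning
    open +-*-Solver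

  ∣sign∣≡1 : ∀ i → ∣ (- 1ℚ) ^ℚ i ∣ ≡ 1ℚ
  ∣sign∣≡1 zero    = refl
  ∣sign∣≡1 (suc i) = trans (∣p*q∣≡∣p∣*∣q∣ (- 1ℚ) ((- 1ℚ) ^ℚ i))
    (trans (*-identityˡ _) (∣sign∣≡1 i))

  S-close : ∀ i n → i ℕ.≤ n → ∣ S n - S i ∣ ≤ a i
  S-close i n i≤n = begin
    ∣ S n - S i ∣                      ≡⟨ cong (λ t → ∣ S t - S i ∣) (sym (ℕ.m+[n∸m]≡n i≤n)) ⟩
    ∣ S (i ℕ.+ (n ℕ.∸ i)) - S i ∣      ≡⟨ cong ∣_∣ (S-split i (n ℕ.∸ i)) ⟩
    ∣ (- 1ℚ) ^ℚ i * alt i (n ℕ.∸ i) ∣  ≡⟨ ∣p*q∣≡∣p∣*∣q∣ ((- 1ℚ) ^ℚ i) (alt i (n ℕ.∸ i)) ⟩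
    ∣ (- 1ℚ) ^ℚ i ∣ * ∣ alt i (n ℕ.∸ i) ∣
      ≡⟨ cong₂ _*_ (∣sign∣≡1 i) (0≤p⇒∣p∣≡p (proj₁ (alt-bounds i (n ℕ.∸ i)))) ⟩
    1ℚ * alt i (n ℕ.∸ i)               ≡⟨ *-identityˡ _ ⟩
    alt i (n ℕ.∸ i)                    ≤⟨ proj₂ (alt-bounds i (n ℕ.∸ i)) ⟩
    a i                                ∎
    where
    open ≤-Reasoning

open Leibniz

π : ℝ
π = record
  { seq    = λ n → ∑< n leibniz
  ; cauchy = λ ε 0<ε → let N , h = 2a≤ ε 0<ε in N , λ m n N≤m N≤n →
      ≤-trans (triangle (S m) (S N) (S n))
        (≤-trans (+-mono-≤ (S-close N m N≤m)
                   (≤-trans (≤-reflexive (∣p-q∣-comm (S N) (S n))) (S-close N n N≤n))) h)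
  }

π#0 : π #0
π#0 = + 8 / 3 - + 4 / 5 , positive⁻¹ (+ 8 / 3 - + 4 / 5) , 2 , λ n 2≤n → begin
  + 8 / 3 - + 4 / 5                    ≤⟨ +-monoʳ-≤ (+ 8 / 3) (neg-antimono-≤ (S-close 2 n 2≤n)) ⟩
  + 8 / 3 - ∣ S n - S 2 ∣              ≡⟨ cong (λ t → + 8 / 3 - t) (∣p-q∣-comm (S n) (S 2)) ⟩
  ∣ S 2 ∣ - ∣ S 2 - S n ∣              ≤⟨ +-monoˡ-≤ (- ∣ S 2 - S n ∣) (split n) ⟩
  ∣ S 2 - S n ∣ + ∣ S n ∣ - ∣ S 2 - S n ∣
    ≡⟨ solve 2 (λ x y → x :+ y :- x := y) refl ∣ S 2 - S n ∣ ∣ S n ∣ ⟩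
  ∣ S n ∣                              ∎
  where
  open ≤-Reasoning
  open +-*-Solver
  split : ∀ n → ∣ S 2 ∣ ≤ ∣ S 2 - S n ∣ + ∣ S n ∣
  split n = subst (λ t → ∣ t ∣ ≤ ∣ S 2 - S n ∣ + ∣ S n ∣)
    (solve 2 (λ x y → (x :- y) :+ y := x) refl (S 2) (S n))
    (∣p+q∣≤∣p∣+∣q∣ (S 2 - S n) (S n))

1/π² : ℝ
1/π² = invℝ (π *ℝ π) (*-#0 π π π#0 π#0)

-- Polynomials over ℚ, as coefficient lists (constant term first); trailing
-- zeros are allowed.
--
-- The coefficients cannot be restricted to ℤ without losing the subject: a
-- monic polynomial over ℤ has no half-integer root, and p(x) = p(-1/2 - x)
-- pairs each root -k with the half-integer k - 1/2, so 1 would be the only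
-- polynomial left.  A first example is (x + 1)(x - 1/2).
Poly : Set
Poly = List ℚ

coeff : Poly → ℕ → ℚ
coeff []       _       = 0ℚ
coeff (c ∷ cs) zero    = c
coeff (c ∷ cs) (suc k) = coeff cs k

eval : Poly → ℚ → ℚ
eval []       x = 0ℚ
eval (c ∷ cs) x = c + x * eval cs x

MonicOfDegree : ℕ → Poly → Set
MonicOfDegree d p = coeff p d ≡ 1ℚ × (∀ k → d ℕ.< k → coeff p k ≡ 0ℚ)

-- p = ∏ (x - r) over r in rs, i.e. rs lists all complex roots of the monic
-- polynomial p with multiplicity.  Polynomials over the infinite field ℚ are
-- equal when they agree at every point.
HasRoots : Poly → List ℚ → Set
HasRoots p rs = ∀ x → eval p x ≡ foldr (λ r y → (x - r) * y) 1ℚ rs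

multiplicity : ℚ → List ℚ → ℕ
multiplicity r rs = length (filter (r ≟_) rs)

Admissible : ℚ → Set
Admissible r = (∃[ k ] r ≡ -[1+ k ] / 1) ⊎ (∃[ k ] r ≡ + suc (2 ℕ.* k) / 2)

-- The reciprocal is genuine when all roots of p are admissible: no natural
-- number is admissible, so p(n) ≠ 0.
summand : Poly → ℕ → ℚ
summand p n =
  fromℕ (4 ℕ.* n ℕ.+ 1) * inv (eval p (fromℕ n))
    * (((+ 1 / 4) ^ℚ n) * fromℕ ((2 ℕ.* n) C n)) ^ℚ 4

-- With a_n = C(2n,n)/4ⁿ, w = a⁴, E(n) = 4n+1 and X_k(n) = 1/((n+k)(n+1/2-k)), the
-- sequence G(n) = n⁴ w(n) / ((n+k)(n-1/2-k)) has first difference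
-- E w (k⁴ X_k - (k+1/2)⁴ X_{k+1}) / (4k+1) and tends to 1/π². Hence the sum of E w X_k
-- is a rational multiple of 1/π² for every k ≥ 1, starting from k = 0 where the
-- term in X_k drops out. Dividing G(n) once more by (n+k)(n-1/2-k) treats E w X_k²
-- in the same way.
--
-- The partial fractions of 1/p(x) have the terms 1/(x-r) and 1/(x-r)². As p(x) = p(-1/2-x),
-- they may be averaged with their reflections under x ↦ -1/2-x, and then become
-- combinations of X_k and X_k², where {r, -1/2-r} = {-k, k-1/2}; no pairing of the
-- roots of p is needed.
--
-- The limit n² w(n) → 1/π² is Wallis' product, deduced from the Leibniz series by a WZ
-- pair: the sum over n of F(m,n) does not depend on m, is the Leibniz series (divided
-- by 4) for m = 0, and is asymptotic to its first term F(m,0) for m → ∞.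
module Submission where

open import Defs
open import Data.Empty using (⊥; ⊥-elim)
open import Data.Integer.Base as ℤ using (-[1+_])
import Data.Integer.Properties as ℤ
open import Data.List.Base using (List; []; _∷_; foldr; drop; length)
open import Data.List.Properties using (filter-accept; filter-reject)
open import Data.List.Relation.Unary.All as All using (All; []; _∷_)
open import Data.Nat.Base as ℕ using (ℕ; zero; suc; _!)
open import Data.Nat.Combinatorics using (_C_; nCk≡n!/k![n-k]!; k![n∸k]!∣n!)
open import Data.Nat.Divisibility using (_∣_)
open import Data.Nat.DivMod using (m/n*n≡m)
import Data.Nat.Properties as ℕ
import Data.Nat.Solver as ℕ
open import Data.Product.Base using (∃-syntax; _×_; _,_; proj₁; proj₂)
open import Data.Rational.Base hiding (_≃_)
open import Data.Rational.Properties
open import Data.Rational.Solver using (module +-*-Solver)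
import Data.Rational.Unnormalised.Base as ℚᵘ
import Data.Rational.Unnormalised.Properties as ℚᵘ
open import Data.Sum.Base using (inj₁; inj₂)
open import Relation.Binary.PropositionalEquality
open import Relation.Nullary using (Dec; yes; no; contradiction)

open ℚ-Lemmas
open +-*-Solver using (solve; _:=_; _:+_; _:*_; _:-_; :-_; con)

-- The reflection x ↦ -1/2-x fixes t = x² + x/2, and X_k is a function of t alone, namely 1/(t - k²
-- + k/2), while 4x+1 changes sign. Hence neighbouring X_k differ by a constant multiple of their
-- product, which keeps the recurrence for X_k² closed.
--
-- The case k = 0 cannot be taken literally: it divides by n, and the reciprocal of 0 is a default
-- value. It is replaced by explicit sequences in which n is cancelled, and the general recurrence
-- starts from k = 1.
--
-- Reals occur only at the two ends. Every limit in between says that two rational sequences differ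
-- by a null sequence, with the Cauchy sequence `z` of 1/π² as target, so that a multiple of 1/π² is
-- represented by its rational coefficient.
--
-- The partial fractions cannot include a constant: E(n) w(n) is of order 1/n and its sum diverges.
-- This is why an empty list of roots has to be refuted from the positive degree of p.

≢0 : ∀ {q} → 0ℚ < q → q ≢ 0ℚ
≢0 0<q q≡0 = <-irrefl (sym q≡0) 0<q

+-nonNeg : ∀ {p q} → 0ℚ ≤ p → 0ℚ ≤ q → 0ℚ ≤ p + q
+-nonNeg = +-mono-≤

*-nonNeg : ∀ {p q} → 0ℚ ≤ p → 0ℚ ≤ q → 0ℚ ≤ p * q
*-nonNeg {p} {q} 0≤p 0≤q = subst (_≤ p * q) (*-zeroˡ 0ℚ) (*-mono-≤ ≤-refl 0≤p 0≤p 0≤q)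

≤-from-difference : ∀ {p q} r → 0ℚ ≤ r → q ≡ p + r → p ≤ q
≤-from-difference {p} r 0≤r refl = subst (_≤ p + r) (+-identityʳ p) (+-monoʳ-≤ p 0≤r)

p≤∣p∣ : ∀ p → p ≤ ∣ p ∣
p≤∣p∣ p with ≤-total 0ℚ p
... | inj₁ 0≤p = ≤-reflexive (sym (0≤p⇒∣p∣≡p 0≤p))
... | inj₂ p≤0 = ≤-trans p≤0 (0≤∣p∣ p)

-- Reciprocals in ℚ

inv-unique : ∀ x y → x * y ≡ 1ℚ → inv x ≡ y
inv-unique x y xy≡1 = begin
  inv x            ≡⟨ sym (*-identityʳ (inv x)) ⟩
  inv x * 1ℚ       ≡⟨ cong (inv x *_) (sym xy≡1) ⟩
  inv x * (x * y)  ≡⟨ solve 3 (λ i x y → i :* (x :* y) := (x :* i) :* y) refl (inv x) x y ⟩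
  (x * inv x) * y  ≡⟨ cong (_* y) (inv-inverseʳ x≢0) ⟩
  1ℚ * y           ≡⟨ *-identityˡ y ⟩
  y                ∎
  where
  open ≡-Reasoning
  x≢0 : x ≢ 0ℚ
  x≢0 refl = 1≢0 (trans (sym xy≡1) (*-zeroˡ y))

inv-inv : ∀ {x} → x ≢ 0ℚ → inv (inv x) ≡ x
inv-inv {x} x≢0 = inv-unique (inv x) x (trans (*-comm (inv x) x) (inv-inverseʳ x≢0))

-- The default value `inv 0ℚ ≡ 0ℚ` makes both sides 0 when a factor is 0, so a product over the
-- roots can be inverted without excluding any point.
inv-* : ∀ x y → inv (x * y) ≡ inv x * inv y
inv-* x y = cases (x ≟ 0ℚ) (y ≟ 0ℚ)
  where
  cases : Dec (x ≡ 0ℚ) → Dec (y ≡ 0ℚ) → inv (x * y) ≡ inv x * inv y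
  cases (yes x≡0) _ = trans (cong inv (trans (cong (_* y) x≡0) (*-zeroˡ y)))
    (sym (trans (cong (λ t → inv t * inv y) x≡0) (*-zeroˡ (inv y))))
  cases _ (yes y≡0) = trans (cong inv (trans (cong (x *_) y≡0) (*-zeroʳ x)))
    (sym (trans (cong (λ t → inv x * inv t) y≡0) (*-zeroʳ (inv x))))
  cases (no x≢0) (no y≢0) = inv-unique (x * y) (inv x * inv y) (trans
    (solve 4 (λ x y i j → (x :* y) :* (i :* j) := (x :* i) :* (y :* j)) refl x y (inv x) (inv y))
    (cong₂ _*_ (inv-inverseʳ x≢0) (inv-inverseʳ y≢0)))

*-cancelˡ-≡ : ∀ c {x y} → c ≢ 0ℚ → c * x ≡ c * y → x ≡ y
*-cancelˡ-≡ c {x} {y} c≢0 eq = trans (sym (undo x)) (trans (cong (inv c *_) eq) (undo y))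
  where
  undo : ∀ z → inv c * (c * z) ≡ z
  undo z = trans (solve 3 (λ c i z → i :* (c :* z) := (c :* i) :* z) refl c (inv c) z)
    (trans (cong (_* z) (inv-inverseʳ c≢0)) (*-identityˡ z))

-- The embedding of ℕ in ℚ

fromℕ-+ : ∀ m n → fromℕ (m ℕ.+ n) ≡ fromℕ m + fromℕ n
fromℕ-+ m n = toℚᵘ-injective (begin
  toℚᵘ (fromℕ (m ℕ.+ n))              ≈⟨ toℚᵘ-fromℚᵘ (ℚᵘ.mkℚᵘ (ℤ.+ (m ℕ.+ n)) 0) ⟩
  ℚᵘ.mkℚᵘ (ℤ.+ (m ℕ.+ n)) 0             ≈⟨ ℚᵘ.*≡* (cong (ℤ._* (ℤ.+ 1))
                                          (trans (ℤ.pos-+ m n) (sym (cong₂ ℤ._+_ (ℤ.*-identityʳ (ℤ.+ m)) (ℤ.*-identityʳ (ℤ.+ n)))))) ⟩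
  ℚᵘ.mkℚᵘ (ℤ.+ m) 0 ℚᵘ.+ ℚᵘ.mkℚᵘ (ℤ.+ n) 0
    ≈⟨ ℚᵘ.+-cong (ℚᵘ.≃-sym (toℚᵘ-fromℚᵘ (ℚᵘ.mkℚᵘ (ℤ.+ m) 0))) (ℚᵘ.≃-sym (toℚᵘ-fromℚᵘ (ℚᵘ.mkℚᵘ (ℤ.+ n) 0))) ⟩
  toℚᵘ (fromℕ m) ℚᵘ.+ toℚᵘ (fromℕ n)  ≈⟨ ℚᵘ.≃-sym (toℚᵘ-homo-+ (fromℕ m) (fromℕ n)) ⟩
  toℚᵘ (fromℕ m + fromℕ n)            ∎)
  where open ℚᵘ.≃-Reasoning

fromℕ-suc : ∀ n → fromℕ (suc n) ≡ fromℕ n + 1ℚ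
fromℕ-suc n = trans (cong fromℕ (ℕ.+-comm 1 n)) (fromℕ-+ n 1)

fromℕ-* : ∀ m n → fromℕ (m ℕ.* n) ≡ fromℕ m * fromℕ n
fromℕ-* zero    n = sym (*-zeroˡ (fromℕ n))
fromℕ-* (suc m) n = begin
  fromℕ (n ℕ.+ m ℕ.* n)        ≡⟨ fromℕ-+ n (m ℕ.* n) ⟩
  fromℕ n + fromℕ (m ℕ.* n)    ≡⟨ cong (fromℕ n +_) (fromℕ-* m n) ⟩
  fromℕ n + fromℕ m * fromℕ n  ≡⟨ solve 2 (λ m n → n :+ m :* n := (m :+ con 1ℚ) :* n) refl (fromℕ m) (fromℕ n) ⟩
  (fromℕ m + 1ℚ) * fromℕ n     ≡⟨ cong (_* fromℕ n) (sym (fromℕ-suc m)) ⟩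
  fromℕ (suc m) * fromℕ n      ∎
  where open ≡-Reasoning

0≤fromℕ : ∀ n → 0ℚ ≤ fromℕ n
0≤fromℕ n = nonNegative⁻¹ _ {{normalize-nonNeg n 1}}

0<fromℕ-suc : ∀ n → 0ℚ < fromℕ (suc n)
0<fromℕ-suc n = positive⁻¹ _ {{normalize-pos (suc n) 1}}

fromℕ-mono-≤ : ∀ {m n} → m ℕ.≤ n → fromℕ m ≤ fromℕ n
fromℕ-mono-≤ {m} {n} m≤n = ≤-from-difference (fromℕ (n ℕ.∸ m)) (0≤fromℕ (n ℕ.∸ m))
  (trans (cong fromℕ (sym (ℕ.m+[n∸m]≡n m≤n))) (fromℕ-+ m (n ℕ.∸ m)))

-- A nonnegative fraction is at most its numerator, a negative one at most 0.
archimedean : ∀ q → ∃[ N ] q ≤ fromℕ N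
archimedean q@(mkℚ (ℤ.+ n) d _) = n , subst (_≤ fromℕ n) (fromℚᵘ-toℚᵘ q)
  (Leibniz.fromℚᵘ-mono-≤ {toℚᵘ q} {ℚᵘ.mkℚᵘ (ℤ.+ n) 0} (ℚᵘ.*≤*
    (subst₂ ℤ._≤_ (ℤ.pos-* n 1) (ℤ.pos-* n (suc d)) (ℤ.+≤+ (ℕ.*-monoʳ-≤ n (ℕ.s≤s ℕ.z≤n))))))
archimedean (mkℚ -[1+ n ] d _) = 0 , *≤* ℤ.-≤+

-- Asymptotic equality of rational sequences

Eventually : (ℕ → Set) → Set
Eventually P = ∃[ N ] ∀ n → N ℕ.≤ n → P n

zipE : ∀ {P Q R : ℕ → Set} → (∀ n → P n → Q n → R n) → Eventually P → Eventually Q → Eventually R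
zipE f (M , p) (N , q) = M ℕ.⊔ N , λ n MN≤n →
  f n (p n (ℕ.m⊔n≤o⇒m≤o M N MN≤n)) (q n (ℕ.m⊔n≤o⇒n≤o M N MN≤n))

mapE : ∀ {P Q : ℕ → Set} → (∀ n → P n → Q n) → Eventually P → Eventually Q
mapE f (N , p) = N , λ n N≤n → f n (p n N≤n)

record Null (u : ℕ → ℚ) : Set where
  constructor null
  field small : ∀ ε → 0ℚ < ε → Eventually λ n → ∣ u n ∣ ≤ ε

record Bounded (u : ℕ → ℚ) : Set where
  constructor bounded
  field
    bound   : ℚ
    0<bound : 0ℚ < bound
    below   : Eventually λ n → ∣ u n ∣ ≤ bound

infix 4 _∼_

-- The difference tends to 0; quotients are not considered. Compatibility with products therefore
-- asks for bounded limits, and compatibility with reciprocals for a limit that stays away from 0.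
record _∼_ (u v : ℕ → ℚ) : Set where
  constructor asymptotic
  field difference : Null λ n → u n - v n

open Null
open _∼_

Null-ext : ∀ {u v} → (∀ n → u n ≡ v n) → Null u → Null v
Null-ext eq h = null λ ε 0<ε → mapE (λ n → subst (λ t → ∣ t ∣ ≤ ε) (eq n)) (small h ε 0<ε)

Null-+ : ∀ {u v} → Null u → Null v → Null λ n → u n + v n
Null-+ {u} {v} hu hv = null λ ε 0<ε → let 0<½ε = *-pos (positive⁻¹ ½) 0<ε in
  zipE (step ε) (small hu (½ * ε) 0<½ε) (small hv (½ * ε) 0<½ε)
  where
  open ≤-Reasoning
  step : ∀ ε n → ∣ u n ∣ ≤ ½ * ε → ∣ v n ∣ ≤ ½ * ε → ∣ u n + v n ∣ ≤ ε
  step ε n h k = begin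
    ∣ u n + v n ∣      ≤⟨ ∣p+q∣≤∣p∣+∣q∣ (u n) (v n) ⟩
    ∣ u n ∣ + ∣ v n ∣  ≤⟨ +-mono-≤ h k ⟩
    ½ * ε + ½ * ε      ≡⟨ sym (*-distribʳ-+ ε ½ ½) ⟩
    1ℚ * ε             ≡⟨ *-identityˡ ε ⟩
    ε                  ∎

Bounded*Null : ∀ {u v} → Bounded u → Null v → Null λ n → u n * v n
Bounded*Null {u} {v} (bounded B 0<B hu) hv = null λ ε 0<ε →
  zipE (step ε) hu (small hv (inv B * ε) (*-pos (inv-pos 0<B) 0<ε))
  where
  open ≤-Reasoning
  step : ∀ ε n → ∣ u n ∣ ≤ B → ∣ v n ∣ ≤ inv B * ε → ∣ u n * v n ∣ ≤ ε
  step ε n h k = begin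
    ∣ u n * v n ∣      ≡⟨ ∣p*q∣≡∣p∣*∣q∣ (u n) (v n) ⟩
    ∣ u n ∣ * ∣ v n ∣  ≤⟨ *-mono-≤ (0≤∣p∣ (v n)) (<⇒≤ 0<B) h k ⟩
    B * (inv B * ε)    ≡⟨ sym (*-assoc B (inv B) ε) ⟩
    B * inv B * ε      ≡⟨ cong (_* ε) (inv-inverseʳ (≢0 0<B)) ⟩
    1ℚ * ε             ≡⟨ *-identityˡ ε ⟩
    ε                  ∎

Bounded-const : ∀ c → Bounded λ _ → c
Bounded-const c = bounded (∣ c ∣ + 1ℚ) (+-mono-≤-< (0≤∣p∣ c) (positive⁻¹ 1ℚ)) (0 , λ _ _ →
  ≤-from-difference {∣ c ∣} 1ℚ (<⇒≤ (positive⁻¹ 1ℚ)) refl)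

Null-Bounded : ∀ {u} → Null u → Bounded u
Null-Bounded h = bounded 1ℚ (positive⁻¹ 1ℚ) (small h 1ℚ (positive⁻¹ 1ℚ))

Bounded-* : ∀ {u v} → Bounded u → Bounded v → Bounded λ n → u n * v n
Bounded-* {u} {v} (bounded B 0<B hu) (bounded C 0<C hv) = bounded (B * C) (*-pos 0<B 0<C) (zipE
  (λ n h k → ≤-trans (≤-reflexive (∣p*q∣≡∣p∣*∣q∣ (u n) (v n))) (*-mono-≤ (0≤∣p∣ (v n)) (<⇒≤ 0<B) h k)) hu hv)

∼-refl : ∀ {u v} → (∀ n → u n ≡ v n) → u ∼ v
∼-refl {u} eq = asymptotic (null λ ε 0<ε → 0 , λ n _ → subst (λ t → ∣ t ∣ ≤ ε)
  (trans (sym (+-inverseʳ (u n))) (cong (λ t → u n - t) (eq n))) (<⇒≤ 0<ε))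

∼-trans : ∀ {u v w} → u ∼ v → v ∼ w → u ∼ w
∼-trans {u} {v} {w} (asymptotic h) (asymptotic k) = asymptotic (Null-ext
  (λ n → solve 3 (λ u v w → (u :- v) :+ (v :- w) := u :- w) refl (u n) (v n) (w n)) (Null-+ h k))

∼-+ : ∀ {u v u′ v′} → u ∼ u′ → v ∼ v′ → (λ n → u n + v n) ∼ (λ n → u′ n + v′ n)
∼-+ {u} {v} {u′} {v′} (asymptotic h) (asymptotic k) = asymptotic (Null-ext
  (λ n → solve 4 (λ u v u′ v′ → (u :- u′) :+ (v :- v′) := (u :+ v) :- (u′ :+ v′)) refl (u n) (v n) (u′ n) (v′ n))
  (Null-+ h k))

∼-Bounded : ∀ {u v} → u ∼ v → Bounded v → Bounded u
∼-Bounded {u} {v} (asymptotic h) (bounded B 0<B hv) = bounded (1ℚ + B) (+-pos (positive⁻¹ 1ℚ) 0<B)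
  (zipE step (small h 1ℚ (positive⁻¹ 1ℚ)) hv)
  where
  open ≤-Reasoning
  step : ∀ n → ∣ u n - v n ∣ ≤ 1ℚ → ∣ v n ∣ ≤ B → ∣ u n ∣ ≤ 1ℚ + B
  step n p q = begin
    ∣ u n ∣                ≡⟨ cong ∣_∣ (solve 2 (λ u v → u := (u :- v) :+ v) refl (u n) (v n)) ⟩
    ∣ (u n - v n) + v n ∣  ≤⟨ ∣p+q∣≤∣p∣+∣q∣ (u n - v n) (v n) ⟩
    ∣ u n - v n ∣ + ∣ v n ∣ ≤⟨ +-mono-≤ p q ⟩
    1ℚ + B                 ∎

∼-* : ∀ {u v u′ v′} → Bounded u′ → Bounded v′ → u ∼ u′ → v ∼ v′ → (λ n → u n * v n) ∼ (λ n → u′ n * v′ n)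
∼-* {u} {v} {u′} {v′} bu bv h k = asymptotic (Null-ext
  (λ n → solve 4 (λ u v u′ v′ → u :* (v :- v′) :+ v′ :* (u :- u′) := u :* v :- u′ :* v′) refl (u n) (v n) (u′ n) (v′ n))
  (Null-+ (Bounded*Null (∼-Bounded h bu) (difference k)) (Bounded*Null bv (difference h))))

-- The reciprocals differ by (v - u)/(uv), and `u`, being eventually within δ/2 of `v`, satisfies
-- |u| ≥ δ/2. The hypothesis on `v` is `#0` unfolded, so a proof of `#0` for a real can be passed
-- directly.
∼-inv : ∀ {u v} → (∃[ δ ] 0ℚ < δ × Eventually λ n → δ ≤ ∣ v n ∣) → u ∼ v → (λ n → inv (u n)) ∼ (λ n → inv (v n))
∼-inv {u} {v} (δ , 0<δ , away) (asymptotic h) = asymptotic (null λ ε 0<ε →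
  zipE (step ε) away (zipE (λ _ → _,_) (small h η 0<η) (small h (η * δ * ε) (*-pos (*-pos 0<η 0<δ) 0<ε))))
  where
  open ≤-Reasoning
  η = ½ * δ
  0<η = *-pos (positive⁻¹ ½) 0<δ
  step : ∀ ε n → δ ≤ ∣ v n ∣ → ∣ u n - v n ∣ ≤ η × ∣ u n - v n ∣ ≤ η * δ * ε → ∣ inv (u n) - inv (v n) ∣ ≤ ε
  step ε n δ≤v (p , q) = begin
    ∣ i - j ∣                        ≡⟨ cong ∣_∣ diff ⟩
    ∣ i * j * (v n - u n) ∣          ≡⟨ trans (∣p*q∣≡∣p∣*∣q∣ (i * j) (v n - u n)) (cong₂ _*_ (∣p*q∣≡∣p∣*∣q∣ i j) (∣p-q∣-comm (v n) (u n))) ⟩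
    ∣ i ∣ * ∣ j ∣ * ∣ u n - v n ∣    ≤⟨ *-mono-≤ (0≤∣p∣ (u n - v n)) (<⇒≤ (*-pos (inv-pos 0<η) (inv-pos 0<δ)))
                                         (*-mono-≤ (0≤∣p∣ j) (<⇒≤ (inv-pos 0<η)) (proj₂ iu) (proj₂ iv)) q ⟩
    inv η * inv δ * (η * δ * ε)      ≡⟨ solve 5 (λ i j η δ ε → i :* j :* (η :* δ :* ε) := (η :* i) :* (δ :* j) :* ε) refl (inv η) (inv δ) η δ ε ⟩
    (η * inv η) * (δ * inv δ) * ε    ≡⟨ cong₂ (λ a b → a * b * ε) (inv-inverseʳ (≢0 0<η)) (inv-inverseʳ (≢0 0<δ)) ⟩
    1ℚ * 1ℚ * ε                      ≡⟨ *-identityˡ ε ⟩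
    ε                                ∎
    where
    i = inv (u n)
    j = inv (v n)
    η≤u : η ≤ ∣ u n ∣
    η≤u = begin
      η                                ≡⟨ solve 1 (λ δ → con ½ :* δ := δ :- con ½ :* δ) refl δ ⟩
      δ - η                            ≤⟨ +-mono-≤ δ≤v (neg-antimono-≤ p) ⟩
      ∣ v n ∣ - ∣ u n - v n ∣          ≡⟨ cong₂ (λ a b → ∣ a ∣ - b) (solve 2 (λ u v → v := (v :- u) :+ u) refl (u n) (v n)) (∣p-q∣-comm (u n) (v n)) ⟩
      ∣ (v n - u n) + u n ∣ - ∣ v n - u n ∣
        ≤⟨ +-monoˡ-≤ (- ∣ v n - u n ∣) (∣p+q∣≤∣p∣+∣q∣ (v n - u n) (u n)) ⟩
      ∣ v n - u n ∣ + ∣ u n ∣ - ∣ v n - u n ∣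
        ≡⟨ solve 2 (λ a b → a :+ b :- a := b) refl ∣ v n - u n ∣ ∣ u n ∣ ⟩
      ∣ u n ∣                          ∎
    iu = ∣inv∣≤ {x = u n} 0<η η≤u
    iv = ∣inv∣≤ {x = v n} 0<δ δ≤v
    diff : i - j ≡ i * j * (v n - u n)
    diff = begin-equality
      i - j                          ≡⟨ sym (cong₂ _-_ (*-identityʳ i) (*-identityʳ j)) ⟩
      i * 1ℚ - j * 1ℚ                ≡⟨ sym (cong₂ (λ s t → i * s - j * t) (inv-inverseʳ (proj₁ iv)) (inv-inverseʳ (proj₁ iu))) ⟩
      i * (v n * j) - j * (u n * i)  ≡⟨ solve 4 (λ a b i j → i :* (b :* j) :- j :* (a :* i) := i :* j :* (b :- a)) refl (u n) (v n) i j ⟩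
      i * j * (v n - u n)            ∎

-- Once n ≥ 1/ε - b, the number n + b is at least 1/ε; any n with n + b ≤ 0 lies below this bound.
Null-inv-shift : ∀ b → Null λ n → inv (fromℕ n + b)
Null-inv-shift b = null λ ε 0<ε → N ε , λ n N≤n →
  subst (∣ inv (fromℕ n + b) ∣ ≤_) (inv-inv (≢0 0<ε)) (proj₂ (∣inv∣≤ {x = fromℕ n + b} (inv-pos 0<ε) (begin
    inv ε                        ≡⟨ solve 2 (λ x b → x := (x :+ :- b) :+ b) refl (inv ε) b ⟩
    (inv ε + - b) + b            ≤⟨ +-monoˡ-≤ b (≤-trans (large ε) (fromℕ-mono-≤ N≤n)) ⟩
    fromℕ n + b                  ≤⟨ p≤∣p∣ (fromℕ n + b) ⟩
    ∣ fromℕ n + b ∣              ∎)))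
  where
  open ≤-Reasoning
  N = λ ε → proj₁ (archimedean (inv ε + - b))
  large = λ ε → proj₂ (archimedean (inv ε + - b))

-- Finite sums

∑<-cong : ∀ {f g} n → (∀ i → f i ≡ g i) → ∑< n f ≡ ∑< n g
∑<-cong zero    eq = refl
∑<-cong (suc n) eq = cong₂ _+_ (∑<-cong n eq) (eq n)

∑<-+ : ∀ f g n → ∑< n (λ i → f i + g i) ≡ ∑< n f + ∑< n g
∑<-+ f g zero    = refl
∑<-+ f g (suc n) = trans (cong (_+ (f n + g n)) (∑<-+ f g n))
  (solve 4 (λ a b c d → (a :+ b) :+ (c :+ d) := (a :+ c) :+ (b :+ d)) refl (∑< n f) (∑< n g) (f n) (g n))

∑<-* : ∀ c f n → ∑< n (λ i → c * f i) ≡ c * ∑< n f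
∑<-* c f zero    = sym (*-zeroʳ c)
∑<-* c f (suc n) = trans (cong (_+ c * f n) (∑<-* c f n)) (sym (*-distribˡ-+ c (∑< n f) (f n)))

∑<-telescope : ∀ (f : ℕ → ℚ) n → ∑< n (λ i → f (suc i) - f i) ≡ f n - f 0
∑<-telescope f zero    = sym (+-inverseʳ (f 0))
∑<-telescope f (suc n) = trans (cong (_+ (f (suc n) - f n)) (∑<-telescope f n))
  (solve 3 (λ a b c → (a :- b) :+ (c :- a) := c :- b) refl (f n) (f 0) (f (suc n)))

infixl 6 _⊕_
infixl 7 _⊗_

-- With this notation the nonnegativity of a polynomial certificate is proved by copying its
-- expression, with a proof in place of each atom.
_⊕_ : ∀ {p q} → 0ℚ ≤ p → 0ℚ ≤ q → 0ℚ ≤ p + q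
_⊕_ = +-nonNeg

_⊗_ : ∀ {p q} → 0ℚ ≤ p → 0ℚ ≤ q → 0ℚ ≤ p * q
_⊗_ = *-nonNeg

0≤1 : 0ℚ ≤ 1ℚ
0≤1 = nonNegative⁻¹ 1ℚ

0≤½ : 0ℚ ≤ ½
0≤½ = nonNegative⁻¹ ½

2ℚ 3/2 ¼ : ℚ
2ℚ  = ℤ.+ 2 / 1
3/2 = ℤ.+ 3 / 2
¼   = ℤ.+ 1 / 4

0<fromℕ+ : ∀ n {b} → 0ℚ < b → 0ℚ < fromℕ n + b
0<fromℕ+ n {b} 0<b = +-mono-≤-< (0≤fromℕ n) 0<b

-- Wallis' product from the Leibniz series

r : ℕ → ℚ
r j = inv (fromℕ j + 3/2)

ι : ℕ → ℚ
ι n = inv (fromℕ n + 1ℚ)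

0≤r : ∀ j → 0ℚ ≤ r j
0≤r j = <⇒≤ (inv-pos (0<fromℕ+ j (positive⁻¹ 3/2)))

0≤ι : ∀ n → 0ℚ ≤ ι n
0≤ι n = <⇒≤ (inv-pos (0<fromℕ+ n (positive⁻¹ 1ℚ)))

r-inverse : ∀ j → (fromℕ j + 3/2) * r j ≡ 1ℚ
r-inverse j = inv-inverseʳ (≢0 (0<fromℕ+ j (positive⁻¹ 3/2)))

ι-inverse : ∀ n → (fromℕ n + 1ℚ) * ι n ≡ 1ℚ
ι-inverse n = inv-inverseʳ (≢0 (0<fromℕ+ n (positive⁻¹ 1ℚ)))

-- α j = j! / (3/2)ⱼ², β m = m! and γ n = (1/2)ₙ² / n!, with Pochhammer symbols.
α β γ : ℕ → ℚ
α zero    = 1ℚ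
α (suc j) = α j * (fromℕ j + 1ℚ) * (r j * r j)
β zero    = 1ℚ
β (suc m) = β m * (fromℕ m + 1ℚ)
γ zero    = 1ℚ
γ (suc n) = γ n * ((fromℕ n + ½) * (fromℕ n + ½)) * ι n

0≤α : ∀ j → 0ℚ ≤ α j
0≤α zero    = 0≤1
0≤α (suc j) = 0≤α j ⊗ (0≤fromℕ j ⊕ 0≤1) ⊗ (0≤r j ⊗ 0≤r j)

0≤β : ∀ m → 0ℚ ≤ β m
0≤β zero    = 0≤1
0≤β (suc m) = 0≤β m ⊗ (0≤fromℕ m ⊕ 0≤1)

0≤γ : ∀ n → 0ℚ ≤ γ n
0≤γ zero    = 0≤1
0≤γ (suc n) = 0≤γ n ⊗ ((0≤fromℕ n ⊕ 0≤½) ⊗ (0≤fromℕ n ⊕ 0≤½)) ⊗ 0≤ι n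

Q : ℕ → ℕ → ℚ
Q m n = α (m ℕ.+ n) * β m * γ n

0≤Q : ∀ m n → 0ℚ ≤ Q m n
0≤Q m n = 0≤α (m ℕ.+ n) ⊗ 0≤β m ⊗ 0≤γ n

sign : ℕ → ℚ
sign n = (- 1ℚ) ^ℚ n

∣F∣ : ℕ → ℕ → ℚ
∣F∣ m n = (1ℚ + fromℕ m + 2ℚ * fromℕ n) * Q m n

-- Up to the factor (m+1)(m!/(3/2)ₘ)², `F m n` is the general term of the well-poised ₄F₃(-1) series
-- with a = m+1 and b = c = 1/2; this factor makes the sum π/4 for every m. `G` is its WZ mate, with
-- certificate n/(1+m+2n).
F G : ℕ → ℕ → ℚ
F m n = sign n * ∣F∣ m n
G m n = sign n * (fromℕ n * Q m n)

-- The ring solver knows no reciprocals. Factors 1 are therefore introduced as placeholders and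
-- rewritten as (m+n+3/2) ρ or (n+1) ι, after which the equation is a polynomial identity in ρ and ι
-- as well. The same device serves in all later identities with reciprocals.
WZ : ∀ m n → F (suc m) n - F m n ≡ G m (suc n) - G m n
WZ m n = begin
  F (suc m) n - F m n
    ≡⟨ cong (λ t → s * ((1ℚ + t + 2ℚ * x) * (α j * (fromℕ j + 1ℚ) * (ρ * ρ) * (β m * (y + 1ℚ)) * γ n)) - F m n) (fromℕ-suc m) ⟩
  s * ((1ℚ + (y + 1ℚ) + 2ℚ * x) * (α j * (fromℕ j + 1ℚ) * (ρ * ρ) * (β m * (y + 1ℚ)) * γ n)) - F m n
    ≡⟨ cong (λ t → s * ((1ℚ + (y + 1ℚ) + 2ℚ * x) * (α j * (t + 1ℚ) * (ρ * ρ) * (β m * (y + 1ℚ)) * γ n)) - F m n) (fromℕ-+ m n) ⟩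
  s * ((1ℚ + (y + 1ℚ) + 2ℚ * x) * (α j * ((y + x) + 1ℚ) * (ρ * ρ) * (β m * (y + 1ℚ)) * γ n)) - F m n
    ≡⟨ solve 2 (λ u v → u :- v := u :- v :* (con 1ℚ :* con 1ℚ)) refl
         (s * ((1ℚ + (y + 1ℚ) + 2ℚ * x) * (α j * ((y + x) + 1ℚ) * (ρ * ρ) * (β m * (y + 1ℚ)) * γ n))) (F m n) ⟩
  lhs 1ℚ
    ≡⟨ cong lhs (sym e≡1) ⟩
  lhs ((y + x + 3/2) * ρ)
    ≡⟨ solve 7 (λ s x y ρ a b c →
         s :* ((con 1ℚ :+ (y :+ con 1ℚ) :+ con 2ℚ :* x) :* (a :* ((y :+ x) :+ con 1ℚ) :* (ρ :* ρ) :* (b :* (y :+ con 1ℚ)) :* c))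
           :- s :* ((con 1ℚ :+ y :+ con 2ℚ :* x) :* (a :* b :* c)) :* (((y :+ x :+ con 3/2) :* ρ) :* ((y :+ x :+ con 3/2) :* ρ))
         := (:- con 1ℚ) :* s :* (con 1ℚ :* ((a :* ((y :+ x) :+ con 1ℚ) :* (ρ :* ρ)) :* b :* (c :* ((x :+ con ½) :* (x :+ con ½)))))
           :- s :* (x :* (a :* b :* c)) :* (((y :+ x :+ con 3/2) :* ρ) :* ((y :+ x :+ con 3/2) :* ρ)))
         refl s x y ρ (α j) (β m) (γ n) ⟩
  rhs ((y + x + 3/2) * ρ) 1ℚ
    ≡⟨ cong₂ rhs e≡1 (sym (ι-inverse n)) ⟩
  rhs 1ℚ ((x + 1ℚ) * ι n)
    ≡⟨ solve 8 (λ s x y ρ a b c i →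
         (:- con 1ℚ) :* s :* (((x :+ con 1ℚ) :* i) :* ((a :* ((y :+ x) :+ con 1ℚ) :* (ρ :* ρ)) :* b :* (c :* ((x :+ con ½) :* (x :+ con ½)))))
           :- s :* (x :* (a :* b :* c)) :* (con 1ℚ :* con 1ℚ)
         := (:- con 1ℚ) :* s :* ((x :+ con 1ℚ) :* ((a :* ((y :+ x) :+ con 1ℚ) :* (ρ :* ρ)) :* b :* (c :* ((x :+ con ½) :* (x :+ con ½)) :* i)))
           :- s :* (x :* (a :* b :* c)))
         refl s x y ρ (α j) (β m) (γ n) (ι n) ⟩
  - 1ℚ * s * ((x + 1ℚ) * ((α j * ((y + x) + 1ℚ) * (ρ * ρ)) * β m * γ (suc n))) - G m n
    ≡⟨ cong₂ (λ t u → - 1ℚ * s * (t * ((α j * (u + 1ℚ) * (ρ * ρ)) * β m * γ (suc n))) - G m n) (sym (fromℕ-suc n)) (sym (fromℕ-+ m n)) ⟩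
  - 1ℚ * s * (fromℕ (suc n) * (α (suc j) * β m * γ (suc n))) - G m n
    ≡⟨ cong (λ t → - 1ℚ * s * (fromℕ (suc n) * (α t * β m * γ (suc n))) - G m n) (sym (ℕ.+-suc m n)) ⟩
  G m (suc n) - G m n ∎
  where
  open ≡-Reasoning
  s = sign n
  x = fromℕ n
  y = fromℕ m
  j = m ℕ.+ n
  ρ = r j
  e≡1 : (y + x + 3/2) * ρ ≡ 1ℚ
  e≡1 = trans (cong (λ t → (t + 3/2) * ρ) (sym (fromℕ-+ m n))) (r-inverse j)
  lhs : ℚ → ℚ
  lhs e = s * ((1ℚ + (y + 1ℚ) + 2ℚ * x) * (α j * ((y + x) + 1ℚ) * (ρ * ρ) * (β m * (y + 1ℚ)) * γ n))
    - s * ((1ℚ + y + 2ℚ * x) * (α j * β m * γ n)) * (e * e)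
  rhs : ℚ → ℚ → ℚ
  rhs e i = - 1ℚ * s * (i * ((α j * ((y + x) + 1ℚ) * (ρ * ρ)) * β m * (γ n * ((x + ½) * (x + ½)))))
    - s * (x * (α j * β m * γ n)) * (e * e)

-- Summed over n < N the WZ equation telescopes, and G(m,0) = 0. The terms G(m,N) are the price of
-- truncating the series at N.
∑F : ∀ N M → ∑< N (F M) ≡ ∑< N (F 0) + ∑< M (λ m → G m N)
∑F N zero    = sym (+-identityʳ (∑< N (F 0)))
∑F N (suc M) = begin
  ∑< N (F (suc M))
    ≡⟨ ∑<-cong N (λ n → solve 2 (λ a b → a := b :+ (a :- b)) refl (F (suc M) n) (F M n)) ⟩
  ∑< N (λ n → F M n + (F (suc M) n - F M n))
    ≡⟨ ∑<-+ (F M) (λ n → F (suc M) n - F M n) N ⟩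
  ∑< N (F M) + ∑< N (λ n → F (suc M) n - F M n)
    ≡⟨ cong₂ _+_ (∑F N M) (trans (∑<-cong N (WZ M)) (∑<-telescope (G M) N)) ⟩
  (∑< N (F 0) + ∑< M (λ m → G m N)) + (G M N - G M 0)
    ≡⟨ cong (λ t → (∑< N (F 0) + ∑< M (λ m → G m N)) + (G M N - 1ℚ * t)) (*-zeroˡ (Q M 0)) ⟩
  (∑< N (F 0) + ∑< M (λ m → G m N)) + (G M N - 1ℚ * 0ℚ)
    ≡⟨ solve 3 (λ a b c → (a :+ b) :+ (c :- con 1ℚ :* con 0ℚ) := a :+ (b :+ c)) refl (∑< N (F 0)) (∑< M (λ m → G m N)) (G M N) ⟩
  ∑< N (F 0) + ∑< (suc M) (λ m → G m N) ∎
  where open ≡-Reasoning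

-- Bounds for the WZ terms

Q-antitoneˡ : ∀ m n → Q (suc m) n ≤ Q m n
Q-antitoneˡ m n = ≤-from-difference
  -- The polynomial is (m+n+3/2)² - (m+n+1)(m+1), denominator minus numerator of Q(m+1,n)/Q(m,n).
  (Q m n * ((ℤ.+ 5 / 4 + y + y * x + 2ℚ * x + x * x) * (ρ * ρ)))
  (0≤Q m n ⊗ ((nonNegative⁻¹ (ℤ.+ 5 / 4) ⊕ 0≤fromℕ m ⊕ 0≤fromℕ m ⊗ 0≤fromℕ n ⊕ nonNegative⁻¹ 2ℚ ⊗ 0≤fromℕ n ⊕ 0≤fromℕ n ⊗ 0≤fromℕ n) ⊗ (0≤r j ⊗ 0≤r j)))
  (begin
  Q m n
    ≡⟨ solve 1 (λ q → q := q :* (con 1ℚ :* con 1ℚ)) refl (Q m n) ⟩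
  Q m n * (1ℚ * 1ℚ)
    ≡⟨ cong (λ e → Q m n * (e * e)) (sym (trans (cong (λ t → (t + 3/2) * ρ) (sym (fromℕ-+ m n))) (r-inverse j))) ⟩
  Q m n * (((y + x + 3/2) * ρ) * ((y + x + 3/2) * ρ))
    ≡⟨ solve 6 (λ x y ρ a b c →
         (a :* b :* c) :* (((y :+ x :+ con 3/2) :* ρ) :* ((y :+ x :+ con 3/2) :* ρ))
         := (a :* ((y :+ x) :+ con 1ℚ) :* (ρ :* ρ)) :* (b :* (y :+ con 1ℚ)) :* c
           :+ (a :* b :* c) :* ((con (ℤ.+ 5 / 4) :+ y :+ y :* x :+ con 2ℚ :* x :+ x :* x) :* (ρ :* ρ)))
         refl x y ρ (α j) (β m) (γ n) ⟩
  (α j * ((y + x) + 1ℚ) * (ρ * ρ)) * (β m * (y + 1ℚ)) * γ n + rest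
    ≡⟨ cong (λ t → (α j * (t + 1ℚ) * (ρ * ρ)) * (β m * (y + 1ℚ)) * γ n + rest) (sym (fromℕ-+ m n)) ⟩
  Q (suc m) n + rest ∎)
  where
  open ≡-Reasoning
  x = fromℕ n
  y = fromℕ m
  j = m ℕ.+ n
  ρ = r j
  rest = Q m n * ((ℤ.+ 5 / 4 + y + y * x + 2ℚ * x + x * x) * (ρ * ρ))

Q≤Q₀ : ∀ m n → Q m n ≤ Q 0 n
Q≤Q₀ zero    n = ≤-refl
Q≤Q₀ (suc m) n = ≤-trans (Q-antitoneˡ m n) (Q≤Q₀ m n)

-- At m = 0 the factorials cancel and (3/2)ₙ = (2n+1)(1/2)ₙ, so that F(0,n) is a quarter of the
-- Leibniz term.
Q₀ : ∀ n → (2ℚ * fromℕ n + 1ℚ) * ((2ℚ * fromℕ n + 1ℚ) * Q 0 n) ≡ 1ℚ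
Q₀ zero    = refl
Q₀ (suc n) = begin
  (2ℚ * fromℕ (suc n) + 1ℚ) * ((2ℚ * fromℕ (suc n) + 1ℚ) * Q 0 (suc n))
    ≡⟨ cong (λ t → (2ℚ * t + 1ℚ) * ((2ℚ * t + 1ℚ) * Q 0 (suc n))) (fromℕ-suc n) ⟩
  (2ℚ * (x + 1ℚ) + 1ℚ) * ((2ℚ * (x + 1ℚ) + 1ℚ) * Q 0 (suc n))
    ≡⟨ solve 5 (λ x ρ i a c →
         (con 2ℚ :* (x :+ con 1ℚ) :+ con 1ℚ) :* ((con 2ℚ :* (x :+ con 1ℚ) :+ con 1ℚ)
           :* ((a :* (x :+ con 1ℚ) :* (ρ :* ρ)) :* con 1ℚ :* (c :* ((x :+ con ½) :* (x :+ con ½)) :* i)))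
         := (((x :+ con 3/2) :* ρ) :* ((x :+ con 3/2) :* ρ)) :* ((x :+ con 1ℚ) :* i)
           :* ((con 2ℚ :* x :+ con 1ℚ) :* ((con 2ℚ :* x :+ con 1ℚ) :* (a :* con 1ℚ :* c))))
         refl x (r n) (ι n) (α n) (γ n) ⟩
  (((x + 3/2) * r n) * ((x + 3/2) * r n)) * ((x + 1ℚ) * ι n) * ((2ℚ * x + 1ℚ) * ((2ℚ * x + 1ℚ) * Q 0 n))
    ≡⟨ cong₂ (λ d e → (d * d) * e * ((2ℚ * x + 1ℚ) * ((2ℚ * x + 1ℚ) * Q 0 n))) (r-inverse n) (ι-inverse n) ⟩
  1ℚ * 1ℚ * 1ℚ * ((2ℚ * x + 1ℚ) * ((2ℚ * x + 1ℚ) * Q 0 n))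
    ≡⟨ cong (1ℚ * 1ℚ * 1ℚ *_) (Q₀ n) ⟩
  1ℚ ∎
  where
  open ≡-Reasoning
  x = fromℕ n

n²Q₀≤1 : ∀ n → fromℕ n * (fromℕ n * Q 0 n) ≤ 1ℚ
n²Q₀≤1 n = ≤-from-difference ((ℤ.+ 3 / 1 * x * x + ℤ.+ 4 / 1 * x + 1ℚ) * Q 0 n)
  ((nonNegative⁻¹ (ℤ.+ 3 / 1) ⊗ 0≤fromℕ n ⊗ 0≤fromℕ n ⊕ nonNegative⁻¹ (ℤ.+ 4 / 1) ⊗ 0≤fromℕ n ⊕ 0≤1) ⊗ 0≤Q 0 n)
  (trans (sym (Q₀ n)) (solve 2 (λ x q → (con 2ℚ :* x :+ con 1ℚ) :* ((con 2ℚ :* x :+ con 1ℚ) :* q)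
    := x :* (x :* q) :+ (con (ℤ.+ 3 / 1) :* x :* x :+ con (ℤ.+ 4 / 1) :* x :+ con 1ℚ) :* q) refl x (Q 0 n)))
  where x = fromℕ n

-- What must be nonnegative is (1+m+2n)(m+n+3/2)²(n+1) - (3+m+2n)(m+n+1)(n+1/2)². The two summands
-- of `rest` arise by first replacing (m+n+3/2)(n+1) by (m+n+1)(n+1/2), then (1+m+2n)(m+n+3/2) by
-- (3+m+2n)(n+1/2); each replacement loses a polynomial with nonnegative coefficients.
∣F∣-antitone : ∀ m n → ∣F∣ m (suc n) ≤ ∣F∣ m n
∣F∣-antitone m n = ≤-from-difference rest
  (0≤Q m n ⊗ (((0≤1 ⊕ y₀ ⊕ nonNegative⁻¹ 2ℚ ⊗ x₀) ⊗ (y₀ ⊕ x₀ ⊕ nonNegative⁻¹ 3/2) ⊗ (x₀ ⊕ 0≤½ ⊗ y₀ ⊕ 0≤1)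
    ⊕ ((0≤1 ⊕ y₀ ⊕ nonNegative⁻¹ 2ℚ ⊗ x₀) ⊗ y₀ ⊕ y₀) ⊗ (y₀ ⊕ x₀ ⊕ 0≤1) ⊗ (x₀ ⊕ 0≤½)) ⊗ (0≤r j ⊗ 0≤r j ⊗ 0≤ι n)))
  (begin
  ∣F∣ m n
    ≡⟨ solve 1 (λ q → q := q :* (con 1ℚ :* con 1ℚ) :* con 1ℚ) refl (∣F∣ m n) ⟩
  ∣F∣ m n * (1ℚ * 1ℚ) * 1ℚ
    ≡⟨ cong₂ (λ e i → ∣F∣ m n * (e * e) * i)
         (sym (trans (cong (λ t → (t + 3/2) * ρ) (sym (fromℕ-+ m n))) (r-inverse j))) (sym (ι-inverse n)) ⟩
  ∣F∣ m n * (((y + x + 3/2) * ρ) * ((y + x + 3/2) * ρ)) * ((x + 1ℚ) * ι n)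
    ≡⟨ solve 7 (λ x y ρ i a b c →
         (con 1ℚ :+ y :+ con 2ℚ :* x) :* (a :* b :* c) :* (((y :+ x :+ con 3/2) :* ρ) :* ((y :+ x :+ con 3/2) :* ρ)) :* ((x :+ con 1ℚ) :* i)
         := (con 1ℚ :+ y :+ con 2ℚ :* (x :+ con 1ℚ)) :* ((a :* ((y :+ x) :+ con 1ℚ) :* (ρ :* ρ)) :* b :* (c :* ((x :+ con ½) :* (x :+ con ½)) :* i))
           :+ (a :* b :* c) :* (((con 1ℚ :+ y :+ con 2ℚ :* x) :* (y :+ x :+ con 3/2) :* (x :+ con ½ :* y :+ con 1ℚ)
             :+ ((con 1ℚ :+ y :+ con 2ℚ :* x) :* y :+ y) :* (y :+ x :+ con 1ℚ) :* (x :+ con ½)) :* (ρ :* ρ :* i)))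
         refl x y ρ (ι n) (α j) (β m) (γ n) ⟩
  (1ℚ + y + 2ℚ * (x + 1ℚ)) * ((α j * ((y + x) + 1ℚ) * (ρ * ρ)) * β m * γ (suc n)) + rest
    ≡⟨ cong₂ (λ t u → (1ℚ + y + 2ℚ * t) * ((α j * (u + 1ℚ) * (ρ * ρ)) * β m * γ (suc n)) + rest)
         (sym (fromℕ-suc n)) (sym (fromℕ-+ m n)) ⟩
  (1ℚ + y + 2ℚ * fromℕ (suc n)) * (α (suc j) * β m * γ (suc n)) + rest
    ≡⟨ cong (λ t → (1ℚ + y + 2ℚ * fromℕ (suc n)) * (α t * β m * γ (suc n)) + rest) (sym (ℕ.+-suc m n)) ⟩
  ∣F∣ m (suc n) + rest ∎)
  where
  open ≡-Reasoning
  x = fromℕ n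
  y = fromℕ m
  x₀ = 0≤fromℕ n
  y₀ = 0≤fromℕ m
  j = m ℕ.+ n
  ρ = r j
  rest = Q m n * (((1ℚ + y + 2ℚ * x) * (y + x + 3/2) * (x + ½ * y + 1ℚ)
    + ((1ℚ + y + 2ℚ * x) * y + y) * (y + x + 1ℚ) * (x + ½)) * (ρ * ρ * ι n))

0≤∣F∣ : ∀ m n → 0ℚ ≤ ∣F∣ m n
0≤∣F∣ m n = (0≤1 ⊕ 0≤fromℕ m ⊕ nonNegative⁻¹ 2ℚ ⊗ 0≤fromℕ n) ⊗ 0≤Q m n

-- Alternating sums

∑<-head : ∀ f n → ∑< (suc n) f ≡ f 0 + ∑< n (λ i → f (suc i))
∑<-head f zero    = trans (+-identityˡ (f 0)) (sym (+-identityʳ (f 0)))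
∑<-head f (suc n) = trans (cong (_+ f (suc n)) (∑<-head f n)) (+-assoc (f 0) _ (f (suc n)))

alternating : ∀ (b : ℕ → ℚ) → (∀ i → 0ℚ ≤ b i) → (∀ i → b (suc i) ≤ b i) → ∀ n →
  0ℚ ≤ ∑< n (λ i → sign i * b i) × ∑< n (λ i → sign i * b i) ≤ b 0
alternating b 0≤b anti zero    = ≤-refl , 0≤b 0
alternating b 0≤b anti (suc n) =
  let lo , hi = alternating (λ i → b (suc i)) (λ i → 0≤b (suc i)) (λ i → anti (suc i)) n in
  subst (0ℚ ≤_) (sym split) (subst (_≤ b 0 - tail) (+-inverseʳ (b 0)) (+-monoʳ-≤ (b 0) (neg-antimono-≤ (≤-trans hi (anti 0))))) ,
  subst (_≤ b 0) (sym split) (subst (b 0 - tail ≤_) (+-identityʳ (b 0)) (+-monoʳ-≤ (b 0) (neg-antimono-≤ lo)))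
  where
  open ≡-Reasoning
  tail = ∑< n (λ i → sign i * b (suc i))
  split : ∑< (suc n) (λ i → sign i * b i) ≡ b 0 - tail
  split = begin
    ∑< (suc n) (λ i → sign i * b i)
      ≡⟨ ∑<-head (λ i → sign i * b i) n ⟩
    1ℚ * b 0 + ∑< n (λ i → - 1ℚ * sign i * b (suc i))
      ≡⟨ cong (1ℚ * b 0 +_) (trans (∑<-cong n (λ i → *-assoc (- 1ℚ) (sign i) (b (suc i)))) (∑<-* (- 1ℚ) (λ i → sign i * b (suc i)) n)) ⟩
    1ℚ * b 0 + - 1ℚ * tail
      ≡⟨ solve 2 (λ b t → con 1ℚ :* b :+ (:- con 1ℚ) :* t := b :- t) refl (b 0) tail ⟩
    b 0 - tail ∎

-- Without its first term the sum is minus an alternating sum that begins with `b 1`, hence lies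
-- between -`b 1` and 0.
alternating-tail : ∀ (b : ℕ → ℚ) → (∀ i → 0ℚ ≤ b i) → (∀ i → b (suc i) ≤ b i) → ∀ n →
  ∣ ∑< (suc n) (λ i → sign i * b i) - b 0 ∣ ≤ b 1
alternating-tail b 0≤b anti n =
  let lo , hi = alternating (λ i → b (suc i)) (λ i → 0≤b (suc i)) (λ i → anti (suc i)) n in
  subst (_≤ b 1) (sym (begin
    ∣ ∑< (suc n) (λ i → sign i * b i) - b 0 ∣
      ≡⟨ cong (λ t → ∣ t - b 0 ∣) (∑<-head (λ i → sign i * b i) n) ⟩
    ∣ (1ℚ * b 0 + ∑< n (λ i → - 1ℚ * sign i * b (suc i))) - b 0 ∣
      ≡⟨ cong (λ t → ∣ (1ℚ * b 0 + t) - b 0 ∣)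
           (trans (∑<-cong n (λ i → *-assoc (- 1ℚ) (sign i) (b (suc i)))) (∑<-* (- 1ℚ) (λ i → sign i * b (suc i)) n)) ⟩
    ∣ (1ℚ * b 0 + - 1ℚ * tail) - b 0 ∣
      ≡⟨ cong ∣_∣ (solve 2 (λ b t → (con 1ℚ :* b :+ (:- con 1ℚ) :* t) :- b := :- t) refl (b 0) tail) ⟩
    ∣ - tail ∣
      ≡⟨ trans (∣-p∣≡∣p∣ tail) (0≤p⇒∣p∣≡p lo) ⟩
    tail ∎)) hi
  where
  open ≡-Reasoning
  tail = ∑< n (λ i → sign i * b (suc i))

∣sign*∣ : ∀ i x → 0ℚ ≤ x → ∣ sign i * x ∣ ≡ x
∣sign*∣ i x 0≤x = trans (∣p*q∣≡∣p∣*∣q∣ (sign i) x)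
  (trans (cong₂ _*_ (Leibniz.∣sign∣≡1 i) (0≤p⇒∣p∣≡p 0≤x)) (*-identityˡ x))

∣∑∣≤ : ∀ f c n → (∀ i → ∣ f i ∣ ≤ c) → ∣ ∑< n f ∣ ≤ fromℕ n * c
∣∑∣≤ f c zero    h = ≤-reflexive (sym (*-zeroˡ c))
∣∑∣≤ f c (suc n) h = begin
  ∣ ∑< n f + f n ∣        ≤⟨ ∣p+q∣≤∣p∣+∣q∣ (∑< n f) (f n) ⟩
  ∣ ∑< n f ∣ + ∣ f n ∣    ≤⟨ +-mono-≤ (∣∑∣≤ f c n h) (h n) ⟩
  fromℕ n * c + c         ≡⟨ solve 2 (λ n c → n :* c :+ c := (n :+ con 1ℚ) :* c) refl (fromℕ n) c ⟩
  (fromℕ n + 1ℚ) * c      ≡⟨ cong (_* c) (sym (fromℕ-suc n)) ⟩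
  fromℕ (suc n) * c       ∎
  where open ≤-Reasoning

-- The first terms F(m,0) and their limit π/4

W : ℕ → ℚ
W m = ∣F∣ m 0

r-inverse₀ : ∀ m → (fromℕ m + 3/2) * r (m ℕ.+ 0) ≡ 1ℚ
r-inverse₀ m = trans (cong (λ t → (fromℕ t + 3/2) * r (m ℕ.+ 0)) (sym (ℕ.+-identityʳ m))) (r-inverse (m ℕ.+ 0))

Q-suc₀ : ∀ m → Q (suc m) 0 ≡ Q m 0 * ((fromℕ m + 1ℚ) * (fromℕ m + 1ℚ) * (r (m ℕ.+ 0) * r (m ℕ.+ 0)))
Q-suc₀ m = trans
  (cong (λ t → α j * (fromℕ t + 1ℚ) * (r j * r j) * (β m * (fromℕ m + 1ℚ)) * 1ℚ) (ℕ.+-identityʳ m))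
  (solve 4 (λ a b y ρ → a :* (y :+ con 1ℚ) :* (ρ :* ρ) :* (b :* (y :+ con 1ℚ)) :* con 1ℚ
    := (a :* b :* con 1ℚ) :* ((y :+ con 1ℚ) :* (y :+ con 1ℚ) :* (ρ :* ρ))) refl (α j) (β m) (fromℕ m) (r j))
  where j = m ℕ.+ 0

Q-one : ∀ m → Q m 1 ≡ Q m 0 * ((fromℕ m + 1ℚ) * (r (m ℕ.+ 0) * r (m ℕ.+ 0)) * ¼)
Q-one m = trans (cong (λ t → α t * β m * ¼) (ℕ.+-suc m 0)) (trans
  (cong (λ t → α j * (fromℕ t + 1ℚ) * (r j * r j) * β m * ¼) (ℕ.+-identityʳ m))
  (solve 4 (λ a b y ρ → a :* (y :+ con 1ℚ) :* (ρ :* ρ) :* b :* con ¼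
    := (a :* b :* con 1ℚ) :* ((y :+ con 1ℚ) :* (ρ :* ρ) :* con ¼)) refl (α j) (β m) (fromℕ m) (r j)))
  where j = m ℕ.+ 0

W-antitone : ∀ m → W (suc m) ≤ W m
-- (m+1)/4 is (m+1)(m+3/2)² - (m+2)(m+1)².
W-antitone m = ≤-from-difference ((y + 1ℚ) * Q m 0 * (ρ * ρ) * ¼)
  ((0≤fromℕ m ⊕ 0≤1) ⊗ 0≤Q m 0 ⊗ (0≤r (m ℕ.+ 0) ⊗ 0≤r (m ℕ.+ 0)) ⊗ nonNegative⁻¹ ¼) (begin
  W m
    ≡⟨ solve 1 (λ w → w := w :* (con 1ℚ :* con 1ℚ)) refl (W m) ⟩
  W m * (1ℚ * 1ℚ)
    ≡⟨ cong (λ e → W m * (e * e)) (sym (r-inverse₀ m)) ⟩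
  W m * (((y + 3/2) * ρ) * ((y + 3/2) * ρ))
    ≡⟨ solve 3 (λ q y ρ → (con 1ℚ :+ y :+ con 2ℚ :* con 0ℚ) :* q :* (((y :+ con 3/2) :* ρ) :* ((y :+ con 3/2) :* ρ))
         := (con 1ℚ :+ (y :+ con 1ℚ) :+ con 2ℚ :* con 0ℚ) :* (q :* ((y :+ con 1ℚ) :* (y :+ con 1ℚ) :* (ρ :* ρ)))
           :+ (y :+ con 1ℚ) :* q :* (ρ :* ρ) :* con ¼) refl (Q m 0) y ρ ⟩
  (1ℚ + (y + 1ℚ) + 2ℚ * 0ℚ) * (Q m 0 * ((y + 1ℚ) * (y + 1ℚ) * (ρ * ρ))) + rest
    ≡⟨ cong₂ (λ s t → (1ℚ + s + 2ℚ * 0ℚ) * t + rest) (sym (fromℕ-suc m)) (sym (Q-suc₀ m)) ⟩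
  W (suc m) + rest ∎)
  where
  open ≡-Reasoning
  y = fromℕ m
  ρ = r (m ℕ.+ 0)
  rest = (y + 1ℚ) * Q m 0 * (ρ * ρ) * ¼

W≤1 : ∀ m → W m ≤ 1ℚ
W≤1 zero    = ≤-refl
W≤1 (suc m) = ≤-trans (W-antitone m) (W≤1 m)

-- The quotient |F(m,1)|/F(m,0) equals (m+3)/(4(m+3/2)²), and F(m,0) decreases from 1. So the first
-- term dominates the alternating sum as m grows.
∣F∣₁≤ι : ∀ m → ∣F∣ m 1 ≤ ι m
∣F∣₁≤ι m = begin
  ∣F∣ m 1
    ≡⟨ cong ((1ℚ + y + 2ℚ * 1ℚ) *_) (Q-one m) ⟩
  (1ℚ + y + 2ℚ * 1ℚ) * (Q m 0 * ((y + 1ℚ) * (ρ * ρ) * ¼))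
    ≡⟨ solve 3 (λ q y ρ → (con 1ℚ :+ y :+ con 2ℚ :* con 1ℚ) :* (q :* ((y :+ con 1ℚ) :* (ρ :* ρ) :* con ¼))
         := (con 1ℚ :+ y :+ con 2ℚ :* con 0ℚ) :* q :* ((y :+ con (ℤ.+ 3 / 1)) :* (ρ :* ρ) :* con ¼)) refl (Q m 0) y ρ ⟩
  W m * ((y + ℤ.+ 3 / 1) * (ρ * ρ) * ¼)
    ≤⟨ *-monoʳ-≤-nonNeg _ {{nonNegative 0≤factor}} (W≤1 m) ⟩
  1ℚ * ((y + ℤ.+ 3 / 1) * (ρ * ρ) * ¼)
    ≤⟨ ≤-from-difference rest 0≤rest (Eq.begin
      ι m
        Eq.≡⟨ solve 1 (λ i → i := i :* (con 1ℚ :* con 1ℚ)) refl (ι m) ⟩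
      ι m * (1ℚ * 1ℚ)
        Eq.≡⟨ cong (λ e → ι m * (e * e)) (sym (r-inverse₀ m)) ⟩
      ι m * (((y + 3/2) * ρ) * ((y + 3/2) * ρ))
        Eq.≡⟨ solve 3 (λ i y ρ → i :* (((y :+ con 3/2) :* ρ) :* ((y :+ con 3/2) :* ρ))
             := ((y :+ con 1ℚ) :* i) :* ((y :+ con (ℤ.+ 3 / 1)) :* (ρ :* ρ) :* con ¼)
               :+ (con (ℤ.+ 3 / 4) :* y :* y :+ con 2ℚ :* y :+ con 3/2) :* (ρ :* ρ) :* i) refl (ι m) y ρ ⟩
      ((y + 1ℚ) * ι m) * ((y + ℤ.+ 3 / 1) * (ρ * ρ) * ¼) + rest
        Eq.≡⟨ cong (λ t → t * ((y + ℤ.+ 3 / 1) * (ρ * ρ) * ¼) + rest) (ι-inverse m) ⟩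
      1ℚ * ((y + ℤ.+ 3 / 1) * (ρ * ρ) * ¼) + rest Eq.∎) ⟩
  ι m ∎
  where
  open ≤-Reasoning
  module Eq = ≡-Reasoning
  y = fromℕ m
  ρ = r (m ℕ.+ 0)
  0≤ρ = 0≤r (m ℕ.+ 0)
  0≤factor : 0ℚ ≤ (y + ℤ.+ 3 / 1) * (ρ * ρ) * ¼
  0≤factor = (0≤fromℕ m ⊕ nonNegative⁻¹ (ℤ.+ 3 / 1)) ⊗ (0≤ρ ⊗ 0≤ρ) ⊗ nonNegative⁻¹ ¼
  rest = (ℤ.+ 3 / 4 * y * y + 2ℚ * y + 3/2) * (ρ * ρ) * ι m
  0≤rest : 0ℚ ≤ rest
  0≤rest = (nonNegative⁻¹ (ℤ.+ 3 / 4) ⊗ 0≤fromℕ m ⊗ 0≤fromℕ m ⊕ nonNegative⁻¹ 2ℚ ⊗ 0≤fromℕ m ⊕ nonNegative⁻¹ 3/2) ⊗ (0≤ρ ⊗ 0≤ρ) ⊗ 0≤ι m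

/-inv : ∀ m k → ℤ.+ m / suc k ≡ fromℕ m * inv (fromℕ (suc k))
/-inv m k = *-cancelˡ-≡ K (≢0 (0<fromℕ-suc k)) (trans cross
  (sym (trans (solve 3 (λ K m i → K :* (m :* i) := m :* (K :* i)) refl K (fromℕ m) (inv K))
    (trans (cong (fromℕ m *_) (inv-inverseʳ (≢0 (0<fromℕ-suc k)))) (*-identityʳ (fromℕ m))))))
  where
  K = fromℕ (suc k)
  cross : K * (ℤ.+ m / suc k) ≡ fromℕ m
  cross = toℚᵘ-injective (begin
    toℚᵘ (K * (ℤ.+ m / suc k))                        ≈⟨ toℚᵘ-homo-* K (ℤ.+ m / suc k) ⟩
    toℚᵘ K ℚᵘ.* toℚᵘ (ℤ.+ m / suc k)                  ≈⟨ ℚᵘ.*-cong (toℚᵘ-fromℚᵘ (ℚᵘ.mkℚᵘ (ℤ.+ suc k) 0)) (toℚᵘ-fromℚᵘ (ℚᵘ.mkℚᵘ (ℤ.+ m) k)) ⟩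
    ℚᵘ.mkℚᵘ (ℤ.+ suc k) 0 ℚᵘ.* ℚᵘ.mkℚᵘ (ℤ.+ m) k      ≈⟨ ℚᵘ.*≡* eq ⟩
    ℚᵘ.mkℚᵘ (ℤ.+ m) 0                                 ≈⟨ ℚᵘ.≃-sym (toℚᵘ-fromℚᵘ (ℚᵘ.mkℚᵘ (ℤ.+ m) 0)) ⟩
    toℚᵘ (fromℕ m)                                    ∎)
    where
    open ℚᵘ.≃-Reasoning
    eq : ℤ.+ suc k ℤ.* ℤ.+ m ℤ.* ℤ.+ 1 ≡ ℤ.+ m ℤ.* (ℤ.+ (1 ℕ.* suc k))
    eq = trans (ℤ.*-identityʳ (ℤ.+ suc k ℤ.* ℤ.+ m))
      (trans (ℤ.*-comm (ℤ.+ suc k) (ℤ.+ m)) (cong (λ t → ℤ.+ m ℤ.* ℤ.+ t) (sym (ℕ.*-identityˡ (suc k)))))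

fromℕ-odd : ∀ n → fromℕ (suc (2 ℕ.* n)) ≡ 2ℚ * fromℕ n + 1ℚ
fromℕ-odd n = trans (fromℕ-suc (2 ℕ.* n)) (cong (_+ 1ℚ) (fromℕ-* 2 n))

4ℚ : ℚ
4ℚ = ℤ.+ 4 / 1

leibniz≡4F₀ : ∀ n → leibniz n ≡ 4ℚ * F 0 n
leibniz≡4F₀ n = trans (cong (sign n *_) (trans (/-inv 4 (2 ℕ.* n)) (cong (4ℚ *_)
    (trans (cong inv (fromℕ-odd n)) (inv-unique (2ℚ * fromℕ n + 1ℚ) _ (Q₀ n))))))
  (solve 3 (λ s x q → s :* (con 4ℚ :* ((con 2ℚ :* x :+ con 1ℚ) :* q))
    := con 4ℚ :* (s :* ((con 1ℚ :+ con 0ℚ :+ con 2ℚ :* x) :* q))) refl (sign n) (fromℕ n) (Q 0 n))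

V : ℕ → ℚ
V m = 4ℚ * W m

-- There are two errors: the alternating tail after F(m,0), and m boundary terms of size at most N
-- Q(0,N) ≤ 1/N. The length N must grow faster than m; with N = (m+1)² both errors are at most
-- 1/(m+1).
∣V-S∣≤ : ∀ m → ∣ V m - ∑< (suc m ℕ.* suc m) leibniz ∣ ≤ (4ℚ + 4ℚ) * ι m
∣V-S∣≤ m = begin
  ∣ V m - ∑< N leibniz ∣
    ≡⟨ cong (λ t → ∣ V m - t ∣) (trans (∑<-cong N leibniz≡4F₀) (∑<-* 4ℚ (F 0) N)) ⟩
  ∣ V m - 4ℚ * ∑< N (F 0) ∣
    ≡⟨ cong (λ t → ∣ V m - 4ℚ * t ∣) (trans (solve 2 (λ a g → a := (a :+ g) :- g) refl (∑< N (F 0)) g) (cong (_- g) (sym (∑F N m)))) ⟩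
  ∣ V m - 4ℚ * (∑< N (F m) - g) ∣
    ≡⟨ cong ∣_∣ (solve 3 (λ w a g → con 4ℚ :* w :- con 4ℚ :* (a :- g) := con 4ℚ :* (g :- (a :- w))) refl (W m) (∑< N (F m)) g) ⟩
  ∣ 4ℚ * (g - (∑< N (F m) - W m)) ∣
    ≡⟨ ∣p*q∣≡∣p∣*∣q∣ 4ℚ (g - (∑< N (F m) - W m)) ⟩
  4ℚ * ∣ g - (∑< N (F m) - W m) ∣
    ≤⟨ *-monoˡ-≤-nonNeg 4ℚ (≤-trans (∣p-q∣≤∣p∣+∣q∣ g (∑< N (F m) - W m))
         -- `m + m * suc m` is N - 1: the argument of `alternating-tail` counts the terms after the
         -- first.
         (+-mono-≤ g≤ (≤-trans (alternating-tail (∣F∣ m) (0≤∣F∣ m) (∣F∣-antitone m) (m ℕ.+ m ℕ.* suc m)) (∣F∣₁≤ι m)))) ⟩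
  4ℚ * (ι m + ι m)
    ≡⟨ solve 1 (λ i → con 4ℚ :* (i :+ i) := (con 4ℚ :+ con 4ℚ) :* i) refl (ι m) ⟩
  (4ℚ + 4ℚ) * ι m ∎
  where
  open ≤-Reasoning
  N = suc m ℕ.* suc m
  x = fromℕ N
  y = fromℕ m
  g = ∑< m (λ i → G i N)
  ∣G∣≤ : ∀ i → ∣ G i N ∣ ≤ x * Q 0 N
  ∣G∣≤ i = ≤-trans (≤-reflexive (∣sign*∣ N (x * Q i N) (0≤fromℕ N ⊗ 0≤Q i N)))
    (*-monoˡ-≤-nonNeg x {{nonNegative (0≤fromℕ N)}} (Q≤Q₀ i N))
  g≤ : ∣ g ∣ ≤ ι m
  g≤ = begin
    ∣ g ∣                                        ≤⟨ ∣∑∣≤ (λ i → G i N) (x * Q 0 N) m ∣G∣≤ ⟩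
    y * (x * Q 0 N)                              ≤⟨ ≤-from-difference (x * Q 0 N) (0≤fromℕ N ⊗ 0≤Q 0 N)
                                                     (solve 2 (λ y z → (y :+ con 1ℚ) :* z := y :* z :+ z) refl y (x * Q 0 N)) ⟩
    (y + 1ℚ) * (x * Q 0 N)                       ≡⟨ solve 2 (λ a z → a :* z := con 1ℚ :* (a :* z)) refl (y + 1ℚ) (x * Q 0 N) ⟩
    1ℚ * ((y + 1ℚ) * (x * Q 0 N))                ≡⟨ cong (_* ((y + 1ℚ) * (x * Q 0 N))) (sym (ι-inverse m)) ⟩
    (y + 1ℚ) * ι m * ((y + 1ℚ) * (x * Q 0 N))    ≡⟨ solve 3 (λ a i z → a :* i :* (a :* z) := i :* ((a :* a) :* z)) refl (y + 1ℚ) (ι m) (x * Q 0 N) ⟩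
    ι m * ((y + 1ℚ) * (y + 1ℚ) * (x * Q 0 N))
      ≡⟨ cong (λ t → ι m * (t * (x * Q 0 N))) (sym (trans (fromℕ-* (suc m) (suc m)) (cong₂ _*_ (fromℕ-suc m) (fromℕ-suc m)))) ⟩
    ι m * (x * (x * Q 0 N))                      ≤⟨ *-monoˡ-≤-nonNeg (ι m) {{nonNegative (0≤ι m)}} (n²Q₀≤1 N) ⟩
    ι m * 1ℚ                                     ≡⟨ *-identityʳ (ι m) ⟩
    ι m                                          ∎

V∼π : V ∼ seq π
V∼π = ∼-trans (asymptotic near) (asymptotic far)
  where
  S′ : ℕ → ℚ
  S′ m = ∑< (suc m ℕ.* suc m) leibniz
  near : Null λ m → V m - S′ m
  near = null λ ε 0<ε → mapE
    (λ m h → ≤-trans (∣V-S∣≤ m) (≤-trans (p≤∣p∣ ((4ℚ + 4ℚ) * ι m)) h))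
    (small (Bounded*Null (Bounded-const (4ℚ + 4ℚ)) (Null-inv-shift 1ℚ)) ε 0<ε)
  far : Null λ m → S′ m - seq π m
  far = null λ ε 0<ε → let N , h = cauchy π ε 0<ε in
    N , λ m N≤m → h (suc m ℕ.* suc m) m (ℕ.≤-trans N≤m (ℕ.≤-trans (ℕ.n≤1+n m) (ℕ.m≤m*n (suc m) (suc m)))) N≤m

-- Central binomial coefficients and the limit of n² w(n)

central-factorial : ∀ n → ((2 ℕ.* n) C n) ℕ.* (n ! ℕ.* n !) ≡ (2 ℕ.* n) !
central-factorial n = begin
  ((2 ℕ.* n) C n) ℕ.* (n ! ℕ.* n !)
    ≡⟨ cong (λ t → ((2 ℕ.* n) C n) ℕ.* (n ! ℕ.* t !)) (sym 2n∸n≡n) ⟩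
  ((2 ℕ.* n) C n) ℕ.* (n ! ℕ.* (2 ℕ.* n ℕ.∸ n) !)
    ≡⟨ cong (ℕ._* (n ! ℕ.* (2 ℕ.* n ℕ.∸ n) !)) (nCk≡n!/k![n-k]! n≤2n) ⟩
  _ ≡⟨ m/n*n≡m {{n ℕ.!* (2 ℕ.* n ℕ.∸ n) !≢0}} (k![n∸k]!∣n! n≤2n) ⟩
  (2 ℕ.* n) ! ∎
  where
  open ≡-Reasoning
  n≤2n : n ℕ.≤ 2 ℕ.* n
  n≤2n = ℕ.m≤m+n n (n ℕ.+ 0)
  2n∸n≡n : 2 ℕ.* n ℕ.∸ n ≡ n
  2n∸n≡n = trans (ℕ.m+n∸m≡n n (n ℕ.+ 0)) (ℕ.+-identityʳ n)

central-suc : ∀ n → ((2 ℕ.* suc n) C suc n) ℕ.* (suc n ℕ.* suc n) ≡ (suc (suc (2 ℕ.* n)) ℕ.* suc (2 ℕ.* n)) ℕ.* ((2 ℕ.* n) C n)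
central-suc n = ℕ.*-cancelʳ-≡ _ _ (n ! ℕ.* n !) {{n ℕ.!* n !≢0}} (begin
  c′ ℕ.* (suc n ℕ.* suc n) ℕ.* (n ! ℕ.* n !)
    ≡⟨ ℕS.solve 3 (λ c s f → c ℕS.:* (s ℕS.:* s) ℕS.:* (f ℕS.:* f) ℕS.:= c ℕS.:* ((s ℕS.:* f) ℕS.:* (s ℕS.:* f))) refl c′ (suc n) (n !) ⟩
  c′ ℕ.* ((suc n) ! ℕ.* (suc n) !)
    ≡⟨ central-factorial (suc n) ⟩
  (2 ℕ.* suc n) !
    ≡⟨ cong _! (ℕ.*-suc 2 n) ⟩
  suc (suc (2 ℕ.* n)) ℕ.* (suc (2 ℕ.* n) ℕ.* (2 ℕ.* n) !)
    ≡⟨ cong (λ t → suc (suc (2 ℕ.* n)) ℕ.* (suc (2 ℕ.* n) ℕ.* t)) (sym (central-factorial n)) ⟩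
  suc (suc (2 ℕ.* n)) ℕ.* (suc (2 ℕ.* n) ℕ.* (c ℕ.* (n ! ℕ.* n !)))
    ≡⟨ ℕS.solve 4 (λ a b c f → a ℕS.:* (b ℕS.:* (c ℕS.:* f)) ℕS.:= a ℕS.:* b ℕS.:* c ℕS.:* f) refl (suc (suc (2 ℕ.* n))) (suc (2 ℕ.* n)) c (n ! ℕ.* n !) ⟩
  suc (suc (2 ℕ.* n)) ℕ.* suc (2 ℕ.* n) ℕ.* c ℕ.* (n ! ℕ.* n !) ∎)
  where
  open ≡-Reasoning
  module ℕS = ℕ.+-*-Solver
  c = (2 ℕ.* n) C n
  c′ = (2 ℕ.* suc n) C suc n

a : ℕ → ℚ
a n = (¼ ^ℚ n) * fromℕ ((2 ℕ.* n) C n)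

a-suc : ∀ n → a (suc n) ≡ a n * (fromℕ n + ½) * ι n
a-suc n = begin
  (¼ * q) * C′
    ≡⟨ solve 2 (λ q c → (con ¼ :* q) :* c := con ¼ :* q :* (c :* (con 1ℚ :* con 1ℚ))) refl q C′ ⟩
  ¼ * q * (C′ * (1ℚ * 1ℚ))
    ≡⟨ cong (λ e → ¼ * q * (C′ * (e * e))) (sym (ι-inverse n)) ⟩
  ¼ * q * (C′ * (((x + 1ℚ) * ι n) * ((x + 1ℚ) * ι n)))
    ≡⟨ solve 4 (λ q c x i → con ¼ :* q :* (c :* (((x :+ con 1ℚ) :* i) :* ((x :+ con 1ℚ) :* i)))
         := con ¼ :* q :* (c :* ((x :+ con 1ℚ) :* (x :+ con 1ℚ))) :* i :* i) refl q C′ x (ι n) ⟩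
  ¼ * q * (C′ * ((x + 1ℚ) * (x + 1ℚ))) * ι n * ι n
    ≡⟨ cong (λ t → ¼ * q * t * ι n * ι n) step ⟩
  ¼ * q * ((2ℚ * x + 1ℚ + 1ℚ) * (2ℚ * x + 1ℚ) * C₀) * ι n * ι n
    ≡⟨ solve 4 (λ q c x i → con ¼ :* q :* ((con 2ℚ :* x :+ con 1ℚ :+ con 1ℚ) :* (con 2ℚ :* x :+ con 1ℚ) :* c) :* i :* i
         := q :* c :* (x :+ con ½) :* i :* ((x :+ con 1ℚ) :* i)) refl q C₀ x (ι n) ⟩
  a n * (x + ½) * ι n * ((x + 1ℚ) * ι n)
    ≡⟨ trans (cong (a n * (x + ½) * ι n *_) (ι-inverse n)) (*-identityʳ (a n * (x + ½) * ι n)) ⟩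
  a n * (x + ½) * ι n ∎
  where
  open ≡-Reasoning
  x = fromℕ n
  q = ¼ ^ℚ n
  C₀ = fromℕ ((2 ℕ.* n) C n)
  C′ = fromℕ ((2 ℕ.* suc n) C suc n)
  step : C′ * ((x + 1ℚ) * (x + 1ℚ)) ≡ (2ℚ * x + 1ℚ + 1ℚ) * (2ℚ * x + 1ℚ) * C₀
  step = begin
    C′ * ((x + 1ℚ) * (x + 1ℚ))
      ≡⟨ cong (λ t → C′ * (t * t)) (sym (fromℕ-suc n)) ⟩
    C′ * (fromℕ (suc n) * fromℕ (suc n))
      ≡⟨ cong (C′ *_) (sym (fromℕ-* (suc n) (suc n))) ⟩
    C′ * fromℕ (suc n ℕ.* suc n)
      ≡⟨ sym (fromℕ-* ((2 ℕ.* suc n) C suc n) (suc n ℕ.* suc n)) ⟩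
    fromℕ (((2 ℕ.* suc n) C suc n) ℕ.* (suc n ℕ.* suc n))
      ≡⟨ cong fromℕ (central-suc n) ⟩
    fromℕ ((suc (suc (2 ℕ.* n)) ℕ.* suc (2 ℕ.* n)) ℕ.* ((2 ℕ.* n) C n))
      ≡⟨ fromℕ-* (suc (suc (2 ℕ.* n)) ℕ.* suc (2 ℕ.* n)) ((2 ℕ.* n) C n) ⟩
    fromℕ (suc (suc (2 ℕ.* n)) ℕ.* suc (2 ℕ.* n)) * C₀
      ≡⟨ cong (_* C₀) (trans (fromℕ-* (suc (suc (2 ℕ.* n))) (suc (2 ℕ.* n)))
           (cong₂ _*_ (trans (fromℕ-suc (suc (2 ℕ.* n))) (cong (_+ 1ℚ) (fromℕ-odd n))) (fromℕ-odd n))) ⟩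
    (2ℚ * x + 1ℚ + 1ℚ) * (2ℚ * x + 1ℚ) * C₀ ∎

-- Here Q(n,0) = (n!/(3/2)ₙ)², while a(n) = (1/2)ₙ/n! and (3/2)ₙ = (2n+1)(1/2)ₙ.
Qa²≡1 : ∀ n → Q n 0 * (((2ℚ * fromℕ n + 1ℚ) * a n) * ((2ℚ * fromℕ n + 1ℚ) * a n)) ≡ 1ℚ
Qa²≡1 zero    = refl
Qa²≡1 (suc n) = begin
  Q (suc n) 0 * (((2ℚ * fromℕ (suc n) + 1ℚ) * a (suc n)) * ((2ℚ * fromℕ (suc n) + 1ℚ) * a (suc n)))
    ≡⟨ cong₂ _*_ (Q-suc₀ n) (cong₂ (λ s t → ((2ℚ * s + 1ℚ) * t) * ((2ℚ * s + 1ℚ) * t)) (fromℕ-suc n) (a-suc n)) ⟩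
  Q n 0 * ((x + 1ℚ) * (x + 1ℚ) * (ρ * ρ))
    * (((2ℚ * (x + 1ℚ) + 1ℚ) * (a n * (x + ½) * ι n)) * ((2ℚ * (x + 1ℚ) + 1ℚ) * (a n * (x + ½) * ι n)))
    ≡⟨ solve 5 (λ q x ρ a i →
         q :* ((x :+ con 1ℚ) :* (x :+ con 1ℚ) :* (ρ :* ρ))
           :* (((con 2ℚ :* (x :+ con 1ℚ) :+ con 1ℚ) :* (a :* (x :+ con ½) :* i)) :* ((con 2ℚ :* (x :+ con 1ℚ) :+ con 1ℚ) :* (a :* (x :+ con ½) :* i)))
         := q :* (((con 2ℚ :* x :+ con 1ℚ) :* a) :* ((con 2ℚ :* x :+ con 1ℚ) :* a))
           :* (((x :+ con 3/2) :* ρ) :* ((x :+ con 3/2) :* ρ)) :* (((x :+ con 1ℚ) :* i) :* ((x :+ con 1ℚ) :* i)))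
         refl (Q n 0) x ρ (a n) (ι n) ⟩
  Q n 0 * (((2ℚ * x + 1ℚ) * a n) * ((2ℚ * x + 1ℚ) * a n))
    * (((x + 3/2) * ρ) * ((x + 3/2) * ρ)) * (((x + 1ℚ) * ι n) * ((x + 1ℚ) * ι n))
    ≡⟨ cong₂ (λ d e → Q n 0 * (((2ℚ * x + 1ℚ) * a n) * ((2ℚ * x + 1ℚ) * a n)) * (d * d) * (e * e)) (r-inverse₀ n) (ι-inverse n) ⟩
  Q n 0 * (((2ℚ * x + 1ℚ) * a n) * ((2ℚ * x + 1ℚ) * a n)) * (1ℚ * 1ℚ) * (1ℚ * 1ℚ)
    ≡⟨ cong (λ t → t * (1ℚ * 1ℚ) * (1ℚ * 1ℚ)) (Qa²≡1 n) ⟩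
  1ℚ ∎
  where
  open ≡-Reasoning
  x = fromℕ n
  ρ = r (n ℕ.+ 0)

-- The reciprocal of `V` in terms of binomial coefficients, hence asymptotic to 1/π.
U : ℕ → ℚ
U n = (fromℕ n + ½) * (fromℕ n + ½) * (a n * a n) * ι n

V*U≡1 : ∀ n → V n * U n ≡ 1ℚ
V*U≡1 n = trans
  (solve 4 (λ x q a i → con 4ℚ :* ((con 1ℚ :+ x :+ con 2ℚ :* con 0ℚ) :* q) :* ((x :+ con ½) :* (x :+ con ½) :* (a :* a) :* i)
    := q :* (((con 2ℚ :* x :+ con 1ℚ) :* a) :* ((con 2ℚ :* x :+ con 1ℚ) :* a)) :* ((x :+ con 1ℚ) :* i))
    refl (fromℕ n) (Q n 0) (a n) (ι n))
  (cong₂ _*_ (Qa²≡1 n) (ι-inverse n))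

z : ℕ → ℚ
z = seq 1/π²

z-Bounded : Bounded z
z-Bounded = let B , 0<B , below = eventually-bounded 1/π² in bounded B 0<B below

π-Bounded : Bounded (seq π)
π-Bounded = let B , 0<B , below = eventually-bounded π in bounded B 0<B below

U²∼z : (λ n → U n * U n) ∼ z
U²∼z = ∼-trans (∼-refl (λ n → sym (inv-unique (V n * V n) (U n * U n) (square n))))
  (∼-inv {λ n → V n * V n} {seq (π *ℝ π)} (*-#0 π π π#0 π#0) (∼-* π-Bounded π-Bounded V∼π V∼π))
  where
  square : ∀ n → V n * V n * (U n * U n) ≡ 1ℚ
  square n = trans (solve 2 (λ v u → v :* v :* (u :* u) := (v :* u) :* (v :* u)) refl (V n) (U n))
    (cong (λ t → t * t) (V*U≡1 n))

-- The difference from 1 is (a-b)/(n+b), provided that n + b ≠ 0; this holds from n ≥ 1 - b on.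
shift-ratio∼1 : ∀ a b → (λ n → (fromℕ n + a) * inv (fromℕ n + b)) ∼ (λ _ → 1ℚ)
shift-ratio∼1 a b = asymptotic (null λ ε 0<ε → zipE (step ε) positive-shift
  (small (Bounded*Null (Bounded-const (a - b)) (Null-inv-shift b)) ε 0<ε))
  where
  N = archimedean (1ℚ - b)
  positive-shift : Eventually λ n → fromℕ n + b ≢ 0ℚ
  positive-shift = proj₁ N , λ n N≤n → ≢0 (<-≤-trans (positive⁻¹ 1ℚ) (subst (_≤ fromℕ n + b)
    (solve 1 (λ b → (con 1ℚ :- b) :+ b := con 1ℚ) refl b) (+-monoˡ-≤ b (≤-trans (proj₂ N) (fromℕ-mono-≤ N≤n)))))
  step : ∀ ε n → fromℕ n + b ≢ 0ℚ → ∣ (a - b) * inv (fromℕ n + b) ∣ ≤ ε → ∣ (fromℕ n + a) * inv (fromℕ n + b) - 1ℚ ∣ ≤ ε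
  step ε n ≢0 h = subst (λ t → ∣ t ∣ ≤ ε) (trans
    (solve 4 (λ a b x i → (a :- b) :* i := (x :+ a) :* i :- (x :+ b) :* i) refl a b (fromℕ n) (inv (fromℕ n + b)))
    (cong (λ t → (fromℕ n + a) * inv (fromℕ n + b) - t) (inv-inverseʳ ≢0))) h

∼-*1 : ∀ {u v c} → Bounded c → u ∼ c → v ∼ (λ _ → 1ℚ) → (λ n → u n * v n) ∼ c
∼-*1 {c = c} bc h k = ∼-trans (∼-* bc (Bounded-const 1ℚ) h k) (∼-refl (λ n → *-identityʳ (c n)))

ratio∼1 : ∀ b → (λ n → fromℕ n * inv (fromℕ n + b)) ∼ (λ _ → 1ℚ)
ratio∼1 b = ∼-trans (∼-refl (λ n → cong (_* inv (fromℕ n + b)) (sym (+-identityʳ (fromℕ n))))) (shift-ratio∼1 0ℚ b)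

w : ℕ → ℚ
w n = a n ^ℚ 4

-- n² w(n) is U(n)² times n²(n+1)²/(n+1/2)⁴, a product of four ratios that tend to 1.
n²w∼z : (λ n → w n * (fromℕ n * fromℕ n)) ∼ z
n²w∼z = ∼-trans (∼-refl eq)
  (∼-*1 z-Bounded (∼-*1 z-Bounded (∼-*1 z-Bounded (∼-*1 z-Bounded U²∼z (ratio∼1 ½)) (ratio∼1 ½)) (shift-ratio∼1 1ℚ ½)) (shift-ratio∼1 1ℚ ½))
  where
  open ≡-Reasoning
  eq : ∀ n → w n * (fromℕ n * fromℕ n)
    ≡ U n * U n * (fromℕ n * inv (fromℕ n + ½)) * (fromℕ n * inv (fromℕ n + ½))
      * ((fromℕ n + 1ℚ) * inv (fromℕ n + ½)) * ((fromℕ n + 1ℚ) * inv (fromℕ n + ½))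
  eq n = begin
    w n * (x * x)
      ≡⟨ solve 2 (λ w x → w :* (x :* x) := w :* (x :* x) :* (con 1ℚ :* con 1ℚ :* con 1ℚ :* con 1ℚ) :* (con 1ℚ :* con 1ℚ)) refl (w n) x ⟩
    w n * (x * x) * (1ℚ * 1ℚ * 1ℚ * 1ℚ) * (1ℚ * 1ℚ)
      ≡⟨ cong₂ (λ d e → w n * (x * x) * (d * d * d * d) * (e * e)) (sym (inv-inverseʳ (≢0 (0<fromℕ+ n (positive⁻¹ ½))))) (sym (ι-inverse n)) ⟩
    w n * (x * x) * (((x + ½) * h) * ((x + ½) * h) * ((x + ½) * h) * ((x + ½) * h)) * (((x + 1ℚ) * ι n) * ((x + 1ℚ) * ι n))
      ≡⟨ solve 4 (λ a x h i →
           a :* (a :* (a :* (a :* con 1ℚ))) :* (x :* x) :* (((x :+ con ½) :* h) :* ((x :+ con ½) :* h) :* ((x :+ con ½) :* h) :* ((x :+ con ½) :* h))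
             :* (((x :+ con 1ℚ) :* i) :* ((x :+ con 1ℚ) :* i))
           := ((x :+ con ½) :* (x :+ con ½) :* (a :* a) :* i) :* ((x :+ con ½) :* (x :+ con ½) :* (a :* a) :* i)
             :* (x :* h) :* (x :* h) :* ((x :+ con 1ℚ) :* h) :* ((x :+ con 1ℚ) :* h)) refl (a n) x h (ι n) ⟩
    U n * U n * (x * h) * (x * h) * ((x + 1ℚ) * h) * ((x + 1ℚ) * h) ∎
    where
    x = fromℕ n
    h = inv (x + ½)

-- Sums that are rational multiples of 1/π²

record SumsToMultiple (f : ℕ → ℚ) : Set where
  constructor sumsTo
  field
    multiple : ℚ
    partial  : (λ n → ∑< n f) ∼ (λ n → multiple * z n)

Multiple-ext : ∀ {f g} → (∀ n → f n ≡ g n) → SumsToMultiple f → SumsToMultiple g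
Multiple-ext eq (sumsTo q h) = sumsTo q (∼-trans (∼-refl (λ n → sym (∑<-cong n eq))) h)

Multiple-+ : ∀ {f g} → SumsToMultiple f → SumsToMultiple g → SumsToMultiple λ n → f n + g n
Multiple-+ {f} {g} (sumsTo p h) (sumsTo q k) = sumsTo (p + q)
  (∼-trans (∼-refl (∑<-+ f g)) (∼-trans (∼-+ h k) (∼-refl (λ n → sym (*-distribʳ-+ (z n) p q)))))

Multiple-* : ∀ {f} c → SumsToMultiple f → SumsToMultiple λ n → c * f n
Multiple-* {f} c (sumsTo q (asymptotic h)) = sumsTo (c * q) (asymptotic (Null-ext
  (λ n → trans (solve 4 (λ c s q z → c :* (s :- q :* z) := c :* s :- (c :* q) :* z) refl c (∑< n f) q (z n))
    (cong (_- c * q * z n) (sym (∑<-* c f n))))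
  (Bounded*Null (Bounded-const c) h)))

Multiple-÷ : ∀ {f g} c → c ≢ 0ℚ → (∀ n → f n ≡ c * g n) → SumsToMultiple f → SumsToMultiple g
Multiple-÷ {f} {g} c c≢0 eq h = Multiple-ext
  (λ n → trans (cong (inv c *_) (eq n)) (trans (solve 3 (λ i c g → i :* (c :* g) := (c :* i) :* g) refl (inv c) c (g n))
    (trans (cong (_* g n) (inv-inverseʳ c≢0)) (*-identityˡ (g n)))))
  (Multiple-* (inv c) h)

-- Used with c = 1 for the sums over X_k, and with c = 0 for those over X_k², whose telescoping
-- sequence tends to 0.
Multiple-telescope : ∀ (f : ℕ → ℚ) c → f 0 ≡ 0ℚ → f ∼ (λ n → c * z n) → SumsToMultiple λ n → f (suc n) - f n
Multiple-telescope f c f₀ h = sumsTo c (∼-trans (∼-refl (λ n → trans (∑<-telescope f n)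
  (trans (cong (λ t → f n - t) f₀) (solve 1 (λ f → f :- con 0ℚ := f) refl (f n))))) h)

∼1z : ∀ {u} → u ∼ z → u ∼ (λ n → 1ℚ * z n)
∼1z h = ∼-trans h (∼-refl (λ n → sym (*-identityˡ (z n))))

Null∼0z : ∀ {u} → Null u → u ∼ (λ n → 0ℚ * z n)
Null∼0z {u} h = asymptotic (Null-ext
  (λ n → trans (solve 1 (λ u → u := u :- con 0ℚ) refl (u n)) (cong (λ t → u n - t) (sym (*-zeroˡ (z n))))) h)

-- Recurrences in k for the sums over X_k and X_k²

infix 9 _²

_² : ℚ → ℚ
x ² = x * x

E : ℕ → ℚ
E n = ℤ.+ 4 / 1 * fromℕ n + 1ℚ

X : ℕ → ℕ → ℚ
X k n = inv (fromℕ n + fromℕ k) * inv (fromℕ n + ½ - fromℕ k)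

w-suc : ∀ n → w (suc n) ≡ w n * ((fromℕ n + ½) ² * ι n ²) ²
w-suc n = trans (cong (_^ℚ 4) (a-suc n))
  (solve 3 (λ a x i →
    let b = a :* (x :+ con ½) :* i ; y = x :+ con ½ in
    b :* (b :* (b :* (b :* con 1ℚ)))
    := a :* (a :* (a :* (a :* con 1ℚ))) :* (((y :* y) :* (i :* i)) :* ((y :* y) :* (i :* i))))
    refl (a n) (fromℕ n) (ι n))

-- Since n - k is an integer, n + 1/2 - k is at least 1/2 if k ≤ n and at most -1/2 otherwise.
half-integer≢0 : ∀ n k → fromℕ n + ½ - fromℕ k ≢ 0ℚ
half-integer≢0 n k eq with ℕ.≤-<-connex k n
... | inj₁ k≤n = ≢0 {fromℕ n + ½ - fromℕ k} (<-≤-trans (positive⁻¹ ½)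
  (≤-from-difference (fromℕ n - fromℕ k)
    (subst (_≤ fromℕ n - fromℕ k) (+-inverseʳ (fromℕ k)) (+-monoˡ-≤ (- fromℕ k) (fromℕ-mono-≤ k≤n)))
    (solve 2 (λ n k → n :+ con ½ :- k := con ½ :+ (n :- k)) refl (fromℕ n) (fromℕ k)))) eq
... | inj₂ n<k = ≢0 {fromℕ k - fromℕ n - ½} (<-≤-trans (positive⁻¹ ½)
  (≤-from-difference (fromℕ k - (fromℕ n + 1ℚ))
    (subst (_≤ fromℕ k - (fromℕ n + 1ℚ)) (+-inverseʳ (fromℕ n + 1ℚ))
      (+-monoˡ-≤ (- (fromℕ n + 1ℚ)) (subst (_≤ fromℕ k) (fromℕ-suc n) (fromℕ-mono-≤ n<k))))
    (solve 2 (λ n k → k :- n :- con ½ := con ½ :+ (k :- (n :+ con 1ℚ))) refl (fromℕ n) (fromℕ k))))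
  (trans (solve 2 (λ n k → k :- n :- con ½ := :- (n :+ con ½ :- k)) refl (fromℕ n) (fromℕ k)) (cong (λ t → - t) eq))

-- At x = n, P is 1/((n+k)(n-1/2-k)) and P′ is its value at n + 1, while Y is X_k(n)
-- and Y′ is X_{k+1}(n); note that P P′ = Y Y′.
module Recurrence
  (x k iA iA′ iB iB′ : ℚ)
  (A*iA   : (x + k) * iA ≡ 1ℚ)
  (A′*iA′ : (x + k + 1ℚ) * iA′ ≡ 1ℚ)
  (B*iB   : (x - ½ - k) * iB ≡ 1ℚ)
  (B′*iB′ : (x + ½ - k) * iB′ ≡ 1ℚ)
  where

  open ≡-Reasoning

  A A′ B B′ M N K K′ ε κ P P′ Y Y′ : ℚ
  A  = x + k
  A′ = x + k + 1ℚ
  B  = x - ½ - k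
  B′ = x + ½ - k
  M  = ((x + ½) ²) ²
  N  = (x ²) ²
  K  = (k ²) ²
  K′ = ((k + ½) ²) ²
  ε  = ℤ.+ 4 / 1 * x + 1ℚ
  κ  = 2ℚ * k + ½
  P  = iA * iB
  P′ = iA′ * iB′
  Y  = iA * iB′
  Y′ = iA′ * iB

  -- Inserting two factors equal to 1 brings every term to the common factor `iA * iA′ * iB * iB′`.
  clear₂ : ∀ f p q → p ≡ 1ℚ → q ≡ 1ℚ → f * (p * q) ≡ f
  clear₂ f p q p≡1 q≡1 = trans (cong₂ (λ s t → f * (s * t)) p≡1 q≡1) (*-identityʳ f)

  -- `K` and `K′` are the values of x⁴ at the two poles -k and k+1/2 of `P`. The factor `ε` splits
  -- off because x ↦ -1/2-x exchanges `M` with `N` and `A * B` with `A′ * B′`.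
  first : 2ℚ * κ * (M * P′ - N * P) ≡ ε * (K * Y - K′ * Y′)
  first = begin
    2ℚ * κ * (M * P′ - N * P)
      ≡⟨ cong₂ (λ s t → 2ℚ * κ * (M * s - N * t))
           (sym (clear₂ P′ (A * iA) (B * iB) A*iA B*iB)) (sym (clear₂ P (A′ * iA′) (B′ * iB′) A′*iA′ B′*iB′)) ⟩
    2ℚ * κ * (M * (iA′ * iB′ * (A * iA * (B * iB))) - N * (iA * iB * (A′ * iA′ * (B′ * iB′))))
      ≡⟨ solve 11 (λ κ M N A A′ B B′ iA iA′ iB iB′ →
           con 2ℚ :* κ :* (M :* (iA′ :* iB′ :* (A :* iA :* (B :* iB))) :- N :* (iA :* iB :* (A′ :* iA′ :* (B′ :* iB′))))
           := con 2ℚ :* κ :* (M :* (A :* B) :- N :* (A′ :* B′)) :* (iA :* iA′ :* iB :* iB′)) refl κ M N A A′ B B′ iA iA′ iB iB′ ⟩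
    2ℚ * κ * (M * (A * B) - N * (A′ * B′)) * (iA * iA′ * iB * iB′)
      ≡⟨ cong (_* (iA * iA′ * iB * iB′)) polynomial ⟩
    ε * (K * (A′ * B) - K′ * (A * B′)) * (iA * iA′ * iB * iB′)
      ≡⟨ solve 11 (λ ε K K′ A A′ B B′ iA iA′ iB iB′ →
           ε :* (K :* (A′ :* B) :- K′ :* (A :* B′)) :* (iA :* iA′ :* iB :* iB′)
           := ε :* (K :* (iA :* iB′ :* (A′ :* iA′ :* (B :* iB))) :- K′ :* (iA′ :* iB :* (A :* iA :* (B′ :* iB′))))) refl ε K K′ A A′ B B′ iA iA′ iB iB′ ⟩
    ε * (K * (iA * iB′ * (A′ * iA′ * (B * iB))) - K′ * (iA′ * iB * (A * iA * (B′ * iB′))))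
      ≡⟨ cong₂ (λ s t → ε * (K * s - K′ * t)) (clear₂ Y (A′ * iA′) (B * iB) A′*iA′ B*iB) (clear₂ Y′ (A * iA) (B′ * iB′) A*iA B′*iB′) ⟩
    ε * (K * Y - K′ * Y′) ∎
    where
    polynomial : 2ℚ * κ * (M * (A * B) - N * (A′ * B′)) ≡ ε * (K * (A′ * B) - K′ * (A * B′))
    polynomial = solve 2 (λ x k →
      let sq = λ p → p :* p ; A = x :+ k ; B = x :- con ½ :- k ; A′ = x :+ k :+ con 1ℚ ; B′ = x :+ con ½ :- k in
      con 2ℚ :* (con 2ℚ :* k :+ con ½) :* (sq (sq (x :+ con ½)) :* (A :* B) :- sq (sq x) :* (A′ :* B′))
      := (con (ℤ.+ 4 / 1) :* x :+ con 1ℚ) :* (sq (sq k) :* (A′ :* B) :- sq (sq (k :+ con ½)) :* (A :* B′))) refl x k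

  -- With t = x² + x/2 and c = k² - k/2, the denominators of `Y` and `Y′` are t - c and t - c - κ.
  YY′ : κ * (Y * Y′) ≡ Y′ - Y
  YY′ = begin
    κ * (Y * Y′)
      ≡⟨ solve 6 (λ x k iA iA′ iB iB′ →
           (con 2ℚ :* k :+ con ½) :* ((iA :* iB′) :* (iA′ :* iB))
           := iA′ :* iB :* ((x :+ k) :* iA :* ((x :+ con ½ :- k) :* iB′)) :- iA :* iB′ :* ((x :+ k :+ con 1ℚ) :* iA′ :* ((x :- con ½ :- k) :* iB)))
           refl x k iA iA′ iB iB′ ⟩
    Y′ * (A * iA * (B′ * iB′)) - Y * (A′ * iA′ * (B * iB))
      ≡⟨ cong₂ _-_ (clear₂ Y′ (A * iA) (B′ * iB′) A*iA B′*iB′) (clear₂ Y (A′ * iA′) (B * iB) A′*iA′ B*iB) ⟩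
    Y′ - Y ∎

  -- Over the common denominator, A B + A′ B′ exceeds A′ B + A B′ by (A′ - A)(B′ - B) = 1.
  P+P′ : P + P′ ≡ Y + Y′ + Y * Y′
  P+P′ = begin
    P + P′
      ≡⟨ cong₂ _+_ (sym (clear₂ P (A′ * iA′) (B′ * iB′) A′*iA′ B′*iB′)) (sym (clear₂ P′ (A * iA) (B * iB) A*iA B*iB)) ⟩
    P * (A′ * iA′ * (B′ * iB′)) + P′ * (A * iA * (B * iB))
      ≡⟨ solve 6 (λ x k iA iA′ iB iB′ →
           let A = x :+ k ; B = x :- con ½ :- k ; A′ = x :+ k :+ con 1ℚ ; B′ = x :+ con ½ :- k in
           iA :* iB :* (A′ :* iA′ :* (B′ :* iB′)) :+ iA′ :* iB′ :* (A :* iA :* (B :* iB))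
           := iA :* iB′ :* (A′ :* iA′ :* (B :* iB)) :+ iA′ :* iB :* (A :* iA :* (B′ :* iB′)) :+ (iA :* iB′) :* (iA′ :* iB))
           refl x k iA iA′ iB iB′ ⟩
    Y * (A′ * iA′ * (B * iB)) + Y′ * (A * iA * (B′ * iB′)) + Y * Y′
      ≡⟨ cong₂ (λ s t → s + t + Y * Y′) (clear₂ Y (A′ * iA′) (B * iB) A′*iA′ B*iB) (clear₂ Y′ (A * iA) (B′ * iB′) A*iA B′*iB′) ⟩
    Y + Y′ + Y * Y′ ∎

  -- x² + x/2 is the denominator of `Y` plus k² - k/2. This removes the last dependence on x besides
  -- `ε`, `Y` and `Y′`.
  tYY′ : (x * x + ½ * x) * (Y * Y′) ≡ Y′ + (k * k - ½ * k) * (Y * Y′)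
  tYY′ = begin
    (x * x + ½ * x) * (Y * Y′)
      ≡⟨ solve 6 (λ x k iA iA′ iB iB′ →
           (x :* x :+ con ½ :* x) :* ((iA :* iB′) :* (iA′ :* iB))
           := iA′ :* iB :* ((x :+ k) :* iA :* ((x :+ con ½ :- k) :* iB′)) :+ (k :* k :- con ½ :* k) :* ((iA :* iB′) :* (iA′ :* iB)))
           refl x k iA iA′ iB iB′ ⟩
    Y′ * (A * iA * (B′ * iB′)) + (k * k - ½ * k) * (Y * Y′)
      ≡⟨ cong (_+ (k * k - ½ * k) * (Y * Y′)) (clear₂ Y′ (A * iA) (B′ * iB′) A*iA B′*iB′) ⟩
    Y′ + (k * k - ½ * k) * (Y * Y′) ∎

  c : ℚ
  c = k * k - ½ * k

  -- From M P′² - N P² = (M P′ - N P)(P + P′) - (M - N) P P′, where κ Y Y′ = Y′ - Y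
  -- linearises the mixed products.
  second : κ * κ * (2ℚ * κ) * (M * P′ ² - N * P ²)
    ≡ ε * (κ * (κ - 1ℚ) * K * Y ² - κ * (κ + 1ℚ) * K′ * Y′ ² + ((κ + 1ℚ) * K - (κ - 1ℚ) * K′) * (Y′ - Y)
      - ½ * κ * κ * (2ℚ * κ * Y′ + (2ℚ * c + ¼) * (Y′ - Y)))
  second = begin
    κ * κ * (2ℚ * κ) * (M * P′ ² - N * P ²)
      ≡⟨ solve 5 (λ κ M N P P′ →
           κ :* κ :* (con 2ℚ :* κ) :* (M :* (P′ :* P′) :- N :* (P :* P))
           := κ :* κ :* ((con 2ℚ :* κ :* (M :* P′ :- N :* P)) :* (P :+ P′) :- con 2ℚ :* κ :* (M :- N) :* (P :* P′)))
           refl κ M N P P′ ⟩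
    κ * κ * ((2ℚ * κ * (M * P′ - N * P)) * (P + P′) - 2ℚ * κ * (M - N) * (P * P′))
      ≡⟨ cong₂ (λ s t → κ * κ * (s * t - 2ℚ * κ * (M - N) * (P * P′))) first P+P′ ⟩
    κ * κ * (ε * (K * Y - K′ * Y′) * (Y + Y′ + Y * Y′) - 2ℚ * κ * (M - N) * (P * P′))
      ≡⟨ cong₂ (λ s t → κ * κ * (ε * (K * Y - K′ * Y′) * (Y + Y′ + Y * Y′) - 2ℚ * κ * s * t)) M-N
           (solve 4 (λ iA iA′ iB iB′ → iA :* iB :* (iA′ :* iB′) := iA :* iB′ :* (iA′ :* iB)) refl iA iA′ iB iB′) ⟩
    κ * κ * (ε * (K * Y - K′ * Y′) * (Y + Y′ + Y * Y′) - 2ℚ * κ * (ε * (½ * t + ℤ.+ 1 / 16)) * (Y * Y′))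
      ≡⟨ solve 7 (λ κ ε K K′ Y Y′ t →
           κ :* κ :* (ε :* (K :* Y :- K′ :* Y′) :* (Y :+ Y′ :+ Y :* Y′) :- con 2ℚ :* κ :* (ε :* (con ½ :* t :+ con (ℤ.+ 1 / 16))) :* (Y :* Y′))
           := ε :* (κ :* (K :* Y :- K′ :* Y′) :* (κ :* (Y :+ Y′) :+ κ :* (Y :* Y′))
             :- con ½ :* κ :* κ :* (con 2ℚ :* κ :* (t :* (Y :* Y′)) :+ con ¼ :* (κ :* (Y :* Y′)))))
           refl κ ε K K′ Y Y′ t ⟩
    ε * (κ * (K * Y - K′ * Y′) * (κ * (Y + Y′) + κ * (Y * Y′)) - ½ * κ * κ * (2ℚ * κ * (t * (Y * Y′)) + ¼ * (κ * (Y * Y′))))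
      ≡⟨ cong₂ (λ u v → ε * (κ * (K * Y - K′ * Y′) * (κ * (Y + Y′) + u) - ½ * κ * κ * (2ℚ * κ * v + ¼ * u))) YY′ tYY′ ⟩
    ε * (κ * (K * Y - K′ * Y′) * (κ * (Y + Y′) + (Y′ - Y)) - ½ * κ * κ * (2ℚ * κ * (Y′ + c * (Y * Y′)) + ¼ * (Y′ - Y)))
      ≡⟨ solve 7 (λ κ ε K K′ Y Y′ c →
           ε :* (κ :* (K :* Y :- K′ :* Y′) :* (κ :* (Y :+ Y′) :+ (Y′ :- Y)) :- con ½ :* κ :* κ :* (con 2ℚ :* κ :* (Y′ :+ c :* (Y :* Y′)) :+ con ¼ :* (Y′ :- Y)))
           := ε :* (κ :* (κ :- con 1ℚ) :* K :* (Y :* Y) :- κ :* (κ :+ con 1ℚ) :* K′ :* (Y′ :* Y′) :+ ((κ :+ con 1ℚ) :* K :- (κ :- con 1ℚ) :* K′) :* (κ :* (Y :* Y′))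
             :- con ½ :* κ :* κ :* (con 2ℚ :* κ :* Y′ :+ con 2ℚ :* c :* (κ :* (Y :* Y′)) :+ con ¼ :* (Y′ :- Y))))
           refl κ ε K K′ Y Y′ c ⟩
    ε * (κ * (κ - 1ℚ) * K * Y ² - κ * (κ + 1ℚ) * K′ * Y′ ² + ((κ + 1ℚ) * K - (κ - 1ℚ) * K′) * (κ * (Y * Y′))
      - ½ * κ * κ * (2ℚ * κ * Y′ + 2ℚ * c * (κ * (Y * Y′)) + ¼ * (Y′ - Y)))
      ≡⟨ cong (λ u → ε * (κ * (κ - 1ℚ) * K * Y ² - κ * (κ + 1ℚ) * K′ * Y′ ² + ((κ + 1ℚ) * K - (κ - 1ℚ) * K′) * u
           - ½ * κ * κ * (2ℚ * κ * Y′ + 2ℚ * c * u + ¼ * (Y′ - Y)))) YY′ ⟩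
    ε * (κ * (κ - 1ℚ) * K * Y ² - κ * (κ + 1ℚ) * K′ * Y′ ² + ((κ + 1ℚ) * K - (κ - 1ℚ) * K′) * (Y′ - Y)
      - ½ * κ * κ * (2ℚ * κ * Y′ + 2ℚ * c * (Y′ - Y) + ¼ * (Y′ - Y)))
      ≡⟨ cong (λ u → ε * (κ * (κ - 1ℚ) * K * Y ² - κ * (κ + 1ℚ) * K′ * Y′ ² + ((κ + 1ℚ) * K - (κ - 1ℚ) * K′) * (Y′ - Y) - ½ * κ * κ * u))
           (solve 4 (λ κ Y Y′ c → con 2ℚ :* κ :* Y′ :+ con 2ℚ :* c :* (Y′ :- Y) :+ con ¼ :* (Y′ :- Y)
             := con 2ℚ :* κ :* Y′ :+ (con 2ℚ :* c :+ con ¼) :* (Y′ :- Y)) refl κ Y Y′ c) ⟩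
    ε * (κ * (κ - 1ℚ) * K * Y ² - κ * (κ + 1ℚ) * K′ * Y′ ² + ((κ + 1ℚ) * K - (κ - 1ℚ) * K′) * (Y′ - Y)
      - ½ * κ * κ * (2ℚ * κ * Y′ + (2ℚ * c + ¼) * (Y′ - Y))) ∎
    where
    t = x * x + ½ * x
    -- (x+1/2)⁴ - x⁴ changes sign under x ↦ -1/2-x, so it is 4x+1 times a polynomial in t.
    M-N : M - N ≡ ε * (½ * t + ℤ.+ 1 / 16)
    M-N = solve 1 (λ x → let sq = λ p → p :* p in
      sq (sq (x :+ con ½)) :- sq (sq x) := (con (ℤ.+ 4 / 1) :* x :+ con 1ℚ) :* (con ½ :* (x :* x :+ con ½ :* x) :+ con (ℤ.+ 1 / 16))) refl x

-- This is why the telescoping sequences carry the weight n⁴: it absorbs the denominator of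
-- w(n+1)/w(n).
n⁴w-suc : ∀ n → w (suc n) * ((fromℕ n + 1ℚ) ²) ² ≡ w n * ((fromℕ n + ½) ²) ²
n⁴w-suc n = begin
  w (suc n) * ((x + 1ℚ) ²) ²
    ≡⟨ cong (_* ((x + 1ℚ) ²) ²) (w-suc n) ⟩
  w n * ((x + ½) ² * ι n ²) ² * ((x + 1ℚ) ²) ²
    ≡⟨ solve 4 (λ w h s i → let sq = λ p → p :* p in
         w :* sq (sq h :* sq i) :* sq (sq s) := w :* sq (sq h) :* sq (sq (s :* i))) refl (w n) (x + ½) (x + 1ℚ) (ι n) ⟩
  w n * ((x + ½) ²) ² * (((x + 1ℚ) * ι n) ²) ²
    ≡⟨ cong (λ e → w n * ((x + ½) ²) ² * (e ²) ²) (ι-inverse n) ⟩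
  w n * ((x + ½) ²) ² * 1ℚ
    ≡⟨ *-identityʳ (w n * ((x + ½) ²) ²) ⟩
  w n * ((x + ½) ²) ² ∎
  where
  open ≡-Reasoning
  x = fromℕ n

S₁ S₂ : ℕ → ℕ → ℚ
S₁ k n = E n * w n * X k n
S₂ k n = E n * w n * X k n ²

n²w-Bounded : Bounded λ n → w n * (fromℕ n * fromℕ n)
n²w-Bounded = ∼-Bounded n²w∼z z-Bounded

-- The sums for k = 1

module Base where
  b h : ℕ → ℚ
  b n = inv (fromℕ n + -½)
  h n = inv (fromℕ n + ½)

  b-inverse : ∀ n → (fromℕ n + -½) * b n ≡ 1ℚ
  b-inverse n = inv-inverseʳ λ eq → half-integer≢0 n 1
    (trans (solve 1 (λ x → x :+ con ½ :- con 1ℚ := x :+ con -½) refl (fromℕ n)) eq)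

  h-inverse : ∀ n → (fromℕ n + ½) * h n ≡ 1ℚ
  h-inverse n = inv-inverseʳ (≢0 (0<fromℕ+ n (positive⁻¹ ½)))

  b-suc : ∀ n → b (suc n) ≡ h n
  b-suc n = cong inv (trans (cong (_+ -½) (fromℕ-suc n)) (solve 1 (λ x → x :+ con 1ℚ :+ con -½ := x :+ con ½) refl (fromℕ n)))

  X₁ : ∀ n → X 1 n ≡ ι n * b n
  X₁ n = cong (λ t → ι n * inv t) (solve 1 (λ x → x :+ con ½ :- con 1ℚ := x :+ con -½) refl (fromℕ n))

  w-suc′ : ∀ n c → w (suc n) * (fromℕ (suc n) * fromℕ (suc n) * c) ≡ w n * (((fromℕ n + ½) ²) ² * ι n ² * c)
  w-suc′ n c = begin
    w (suc n) * (fromℕ (suc n) * fromℕ (suc n) * c)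
      ≡⟨ cong₂ (λ s t → s * (t * t * c)) (w-suc n) (fromℕ-suc n) ⟩
    w n * (y ² * ι n ²) ² * (s * s * c)
      ≡⟨ solve 5 (λ w y s i c → let sq = λ p → p :* p in
           w :* sq (sq y :* sq i) :* (s :* s :* c) := w :* (sq (sq y) :* sq i :* c) :* ((s :* i) :* (s :* i))) refl (w n) y s (ι n) c ⟩
    w n * ((y ²) ² * ι n ² * c) * ((s * ι n) * (s * ι n))
      ≡⟨ cong (λ e → w n * ((y ²) ² * ι n ² * c) * (e * e)) (ι-inverse n) ⟩
    w n * ((y ²) ² * ι n ² * c) * 1ℚ
      ≡⟨ *-identityʳ (w n * ((y ²) ² * ι n ² * c)) ⟩
    w n * ((y ²) ² * ι n ² * c) ∎
    where
    open ≡-Reasoning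
    y = fromℕ n + ½
    s = fromℕ n + 1ℚ

  -- n⁴ w(n)/(n(n-1/2)) and n⁴ w(n)/(n(n-1/2))², the telescoping sequences at k = 0, with the powers
  -- of n cancelled.
  f g : ℕ → ℚ
  f n = w n * (fromℕ n * fromℕ n * (fromℕ n * b n))
  g n = w n * (fromℕ n * fromℕ n * (b n * b n))

  -- The analogue of `first` at k = 0: there K = 0, 2κ = 1 and K′ = (1/2)⁴.
  f-step : ∀ n → f (suc n) - f n ≡ - (ℤ.+ 1 / 16) * S₁ 1 n
  f-step n = begin
    f (suc n) - f n
      ≡⟨ cong (_- f n) (w-suc′ n (fromℕ (suc n) * b (suc n))) ⟩
    w n * ((y ²) ² * ι n ² * (fromℕ (suc n) * b (suc n))) - f n
      ≡⟨ cong₂ (λ s t → w n * ((y ²) ² * ι n ² * (s * t)) - f n) (fromℕ-suc n) (b-suc n) ⟩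
    w n * ((y ²) ² * ι n ² * ((x + 1ℚ) * h n)) - f n
      ≡⟨ solve 5 (λ w x i h b → let sq = λ p → p :* p ; y = x :+ con ½ in
           w :* (sq (sq y) :* sq i :* ((x :+ con 1ℚ) :* h)) :- w :* (x :* x :* (x :* b))
           := w :* (y :* y :* y :* i :* (((x :+ con 1ℚ) :* i) :* (y :* h)) :- x :* x :* x :* b)) refl (w n) x (ι n) (h n) (b n) ⟩
    w n * (y * y * y * ι n * (((x + 1ℚ) * ι n) * (y * h n)) - x * x * x * b n)
      ≡⟨ cong (λ e → w n * (y * y * y * ι n * e - x * x * x * b n)) (trans (cong₂ _*_ (ι-inverse n) (h-inverse n)) (sym (b-inverse n))) ⟩
    w n * (y * y * y * ι n * ((x + -½) * b n) - x * x * x * b n)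
      ≡⟨ solve 3 (λ w v u → w :* (u :- v) := w :* (u :- v :* con 1ℚ)) refl (w n) (x * x * x * b n) (y * y * y * ι n * ((x + -½) * b n)) ⟩
    w n * (y * y * y * ι n * ((x + -½) * b n) - x * x * x * b n * 1ℚ)
      ≡⟨ cong (λ e → w n * (y * y * y * ι n * ((x + -½) * b n) - x * x * x * b n * e)) (sym (ι-inverse n)) ⟩
    w n * (y * y * y * ι n * ((x + -½) * b n) - x * x * x * b n * ((x + 1ℚ) * ι n))
      ≡⟨ solve 4 (λ w x i b → let y = x :+ con ½ in
           w :* (y :* y :* y :* i :* ((x :+ con -½) :* b) :- x :* x :* x :* b :* ((x :+ con 1ℚ) :* i))
           := con (- (ℤ.+ 1 / 16)) :* ((con (ℤ.+ 4 / 1) :* x :+ con 1ℚ) :* w :* (i :* b))) refl (w n) x (ι n) (b n) ⟩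
    - (ℤ.+ 1 / 16) * (E n * w n * (ι n * b n))
      ≡⟨ cong (λ t → - (ℤ.+ 1 / 16) * (E n * w n * t)) (sym (X₁ n)) ⟩
    - (ℤ.+ 1 / 16) * S₁ 1 n ∎
    where
    open ≡-Reasoning
    x = fromℕ n
    y = x + ½

  -- The analogue of `second` at k = 0, κ = 1/2: the two contributions to the coefficient of X_0 are
  -- 1/32 and -1/32, and division by 2κ³ = 1/4 gives the constants 1/2 and 3/16.
  g-step : ∀ n → (g (suc n) - g n) + ½ * S₁ 1 n ≡ - (ℤ.+ 3 / 16) * S₂ 1 n
  g-step n = begin
    (g (suc n) - g n) + ½ * S₁ 1 n
      ≡⟨ cong (λ t → (t - g n) + ½ * S₁ 1 n) (w-suc′ n (b (suc n) * b (suc n))) ⟩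
    (w n * ((y ²) ² * ι n ² * (b (suc n) * b (suc n))) - g n) + ½ * S₁ 1 n
      ≡⟨ cong₂ (λ s t → (w n * ((y ²) ² * ι n ² * (s * s)) - g n) + ½ * (E n * w n * t)) (b-suc n) (X₁ n) ⟩
    (w n * ((y ²) ² * ι n ² * (h n * h n)) - g n) + ½ * (E n * w n * (ι n * b n))
      ≡⟨ solve 5 (λ w x i h b → let sq = λ p → p :* p ; y = x :+ con ½ ; E = con (ℤ.+ 4 / 1) :* x :+ con 1ℚ in
           (w :* (sq (sq y) :* sq i :* (h :* h)) :- w :* (x :* x :* (b :* b))) :+ con ½ :* (E :* w :* (i :* b))
           := w :* (y :* y :* i :* i :* ((y :* h) :* (y :* h)) :- x :* x :* b :* b :* (con 1ℚ :* con 1ℚ)) :+ con ½ :* (E :* w :* (i :* b) :* (con 1ℚ :* con 1ℚ)))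
           refl (w n) x (ι n) (h n) (b n) ⟩
    w n * (y * y * ι n * ι n * ((y * h n) * (y * h n)) - x * x * b n * b n * (1ℚ * 1ℚ)) + ½ * (E n * w n * (ι n * b n) * (1ℚ * 1ℚ))
      ≡⟨ cong₂ (λ d e → w n * (y * y * ι n * ι n * (d * d) - x * x * b n * b n * (e * e)) + ½ * (E n * w n * (ι n * b n) * (e * 1ℚ)))
           (trans (h-inverse n) (sym (b-inverse n))) (sym (ι-inverse n)) ⟩
    w n * (y * y * ι n * ι n * (((x + -½) * b n) * ((x + -½) * b n)) - x * x * b n * b n * (((x + 1ℚ) * ι n) * ((x + 1ℚ) * ι n)))
      + ½ * (E n * w n * (ι n * b n) * (((x + 1ℚ) * ι n) * 1ℚ))
      ≡⟨ cong (λ e → w n * (y * y * ι n * ι n * (((x + -½) * b n) * ((x + -½) * b n)) - x * x * b n * b n * (((x + 1ℚ) * ι n) * ((x + 1ℚ) * ι n)))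
           + ½ * (E n * w n * (ι n * b n) * (((x + 1ℚ) * ι n) * e))) (sym (b-inverse n)) ⟩
    w n * (y * y * ι n * ι n * (((x + -½) * b n) * ((x + -½) * b n)) - x * x * b n * b n * (((x + 1ℚ) * ι n) * ((x + 1ℚ) * ι n)))
      + ½ * (E n * w n * (ι n * b n) * (((x + 1ℚ) * ι n) * ((x + -½) * b n)))
      ≡⟨ solve 4 (λ w x i b → let y = x :+ con ½ ; E = con (ℤ.+ 4 / 1) :* x :+ con 1ℚ in
           w :* (y :* y :* i :* i :* (((x :+ con -½) :* b) :* ((x :+ con -½) :* b)) :- x :* x :* b :* b :* (((x :+ con 1ℚ) :* i) :* ((x :+ con 1ℚ) :* i)))
             :+ con ½ :* (E :* w :* (i :* b) :* (((x :+ con 1ℚ) :* i) :* ((x :+ con -½) :* b)))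
           := con (- (ℤ.+ 3 / 16)) :* (E :* w :* ((i :* b) :* (i :* b)))) refl (w n) x (ι n) (b n) ⟩
    - (ℤ.+ 3 / 16) * (E n * w n * (ι n * b n) ²)
      ≡⟨ cong (λ t → - (ℤ.+ 3 / 16) * (E n * w n * t ²)) (sym (X₁ n)) ⟩
    - (ℤ.+ 3 / 16) * S₂ 1 n ∎
    where
    open ≡-Reasoning
    x = fromℕ n
    y = x + ½

  S₁-multiple : SumsToMultiple (S₁ 1)
  S₁-multiple = Multiple-÷ (- (ℤ.+ 1 / 16)) (λ ()) f-step (Multiple-telescope f 1ℚ refl (∼1z
    (∼-trans (∼-refl (λ n → sym (*-assoc (w n) (fromℕ n * fromℕ n) (fromℕ n * b n)))) (∼-*1 z-Bounded n²w∼z (ratio∼1 -½)))))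

  S₂-multiple : SumsToMultiple (S₂ 1)
  S₂-multiple = Multiple-÷ (- (ℤ.+ 3 / 16)) (λ ()) g-step (Multiple-+ (Multiple-telescope g 0ℚ refl (Null∼0z
    (Null-ext (λ n → *-assoc (w n) (fromℕ n * fromℕ n) (b n * b n))
      (Bounded*Null n²w-Bounded (Bounded*Null (Null-Bounded (Null-inv-shift -½)) (Null-inv-shift -½))))))
    (Multiple-* ½ S₁-multiple))

-- From one index to the next

module Step (k : ℕ) where
  -- With `suc k` in place of `k`, the denominator n + kq is positive at n = 0 too.
  kq = fromℕ (suc k)

  iA iA′ iB iB′ : ℕ → ℚ
  iA  n = inv (fromℕ n + kq)
  iA′ n = inv (fromℕ n + kq + 1ℚ)
  iB  n = inv (fromℕ n - ½ - kq)
  iB′ n = inv (fromℕ n + ½ - kq)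

  0<kq : 0ℚ < kq
  0<kq = 0<fromℕ-suc k

  shift-B : ∀ n → fromℕ n + ½ - fromℕ (suc (suc k)) ≡ fromℕ n - ½ - kq
  shift-B n = trans (cong (λ t → fromℕ n + ½ - t) (fromℕ-suc (suc k)))
    (solve 2 (λ x k → x :+ con ½ :- (k :+ con 1ℚ) := x :- con ½ :- k) refl (fromℕ n) kq)

  module R n = Recurrence (fromℕ n) kq (iA n) (iA′ n) (iB n) (iB′ n)
    (inv-inverseʳ (≢0 (0<fromℕ+ n 0<kq)))
    (inv-inverseʳ (≢0 (+-pos (0<fromℕ+ n 0<kq) (positive⁻¹ 1ℚ))))
    (inv-inverseʳ (λ eq → half-integer≢0 n (suc (suc k)) (trans (shift-B n) eq)))
    (inv-inverseʳ (half-integer≢0 n (suc k)))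

  X′ : ∀ n → X (suc (suc k)) n ≡ R.Y′ n
  X′ n = cong₂ (λ s t → inv s * inv t)
    (trans (cong (fromℕ n +_) (fromℕ-suc (suc k))) (sym (+-assoc (fromℕ n) kq 1ℚ))) (shift-B n)

  P-suc : ∀ n → R.P (suc n) ≡ R.P′ n
  P-suc n = cong₂ (λ s t → inv s * inv t)
    (trans (cong (_+ kq) (fromℕ-suc n)) (solve 2 (λ x k → x :+ con 1ℚ :+ k := x :+ k :+ con 1ℚ) refl (fromℕ n) kq))
    (trans (cong (λ t → t - ½ - kq) (fromℕ-suc n)) (solve 2 (λ x k → x :+ con 1ℚ :- con ½ :- k := x :+ con ½ :- k) refl (fromℕ n) kq))

  f g : ℕ → ℚ
  f n = w n * R.N n * R.P n
  g n = w n * R.N n * R.P n ²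

  wN-suc : ∀ n → w (suc n) * R.N (suc n) ≡ w n * R.M n
  wN-suc n = trans (cong (λ t → w (suc n) * (t ²) ²) (fromℕ-suc n)) (n⁴w-suc n)

  κ K K′ : ℚ
  κ  = 2ℚ * kq + ½
  K  = (kq ²) ²
  K′ = ((kq + ½) ²) ²

  0<κ : 0ℚ < κ
  0<κ = +-pos (*-pos (positive⁻¹ 2ℚ) 0<kq) (positive⁻¹ ½)

  0<K′ : 0ℚ < K′
  0<K′ = *-pos (*-pos p p) (*-pos p p)
    where p = +-pos 0<kq (positive⁻¹ ½)

  f∼z : f ∼ z
  f∼z = ∼-trans (∼-refl eq) (∼-*1 z-Bounded (∼-*1 z-Bounded n²w∼z (ratio∼1 kq)) (ratio∼1 (- ½ - kq)))
    where
    eq : ∀ n → f n ≡ w n * (fromℕ n * fromℕ n) * (fromℕ n * inv (fromℕ n + kq)) * (fromℕ n * inv (fromℕ n + (- ½ - kq)))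
    eq n = trans (solve 4 (λ w x i j → w :* ((x :* x) :* (x :* x)) :* (i :* j) := w :* (x :* x) :* (x :* i) :* (x :* j)) refl (w n) (fromℕ n) (iA n) (iB n))
      (cong (λ t → w n * (fromℕ n * fromℕ n) * (fromℕ n * iA n) * (fromℕ n * inv t)) (+-assoc (fromℕ n) (- ½) (- kq)))

  -- `g` is the convergent `f` divided once more by (n+kq)(n-1/2-kq). Its telescoping sum
  -- contributes nothing to the multiple of 1/π².
  g-null : Null g
  g-null = Null-ext eq (Bounded*Null (Bounded-* (∼-Bounded f∼z z-Bounded) (Null-Bounded (Null-inv-shift kq))) (Null-inv-shift (- ½ - kq)))
    where
    eq : ∀ n → f n * inv (fromℕ n + kq) * inv (fromℕ n + (- ½ - kq)) ≡ g n
    eq n = trans (cong (λ t → f n * iA n * inv t) (sym (+-assoc (fromℕ n) (- ½) (- kq))))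
      (solve 3 (λ u i j → u :* (i :* j) :* i :* j := u :* ((i :* j) :* (i :* j))) refl (w n * R.N n) (iA n) (iB n))

  f-step : ∀ n → K * S₁ (suc k) n + - (2ℚ * κ) * (f (suc n) - f n) ≡ K′ * S₁ (suc (suc k)) n
  f-step n = begin
    K * S₁ (suc k) n + - (2ℚ * κ) * (f (suc n) - f n)
      ≡⟨ cong₂ (λ s t → K * S₁ (suc k) n + - (2ℚ * κ) * (s * t - f n)) (wN-suc n) (P-suc n) ⟩
    K * S₁ (suc k) n + - (2ℚ * κ) * (w n * R.M n * R.P′ n - w n * R.N n * R.P n)
      ≡⟨ solve 9 (λ K ε w Y κ M N P P′ → K :* (ε :* w :* Y) :+ (:- (con 2ℚ :* κ)) :* (w :* M :* P′ :- w :* N :* P)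
           := w :* (K :* ε :* Y :- con 2ℚ :* κ :* (M :* P′ :- N :* P))) refl K (E n) (w n) (R.Y n) κ (R.M n) (R.N n) (R.P n) (R.P′ n) ⟩
    w n * (K * E n * R.Y n - 2ℚ * κ * (R.M n * R.P′ n - R.N n * R.P n))
      ≡⟨ cong (λ t → w n * (K * E n * R.Y n - t)) (R.first n) ⟩
    w n * (K * E n * R.Y n - E n * (K * R.Y n - K′ * R.Y′ n))
      ≡⟨ solve 6 (λ K K′ ε w Y Y′ → w :* (K :* ε :* Y :- ε :* (K :* Y :- K′ :* Y′)) := K′ :* (ε :* w :* Y′)) refl K K′ (E n) (w n) (R.Y n) (R.Y′ n) ⟩
    K′ * (E n * w n * R.Y′ n)
      ≡⟨ cong (λ t → K′ * (E n * w n * t)) (sym (X′ n)) ⟩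
    K′ * S₁ (suc (suc k)) n ∎
    where open ≡-Reasoning

  S₁-multiple : SumsToMultiple (S₁ (suc k)) → SumsToMultiple (S₁ (suc (suc k)))
  S₁-multiple h = Multiple-÷ K′ (≢0 0<K′) f-step
    (Multiple-+ (Multiple-* K h) (Multiple-* (- (2ℚ * κ)) (Multiple-telescope f 1ℚ f₀ (∼1z f∼z))))
    where
    f₀ : f 0 ≡ 0ℚ
    f₀ = *-zeroˡ (R.P 0)

  -- The coefficients of Y, Y′ and Y² on the right of `second`, divided by `ε`, once the terms in Y′
  -- - Y are collected.
  c₁ c₁′ c₂ : ℚ
  c₂  = κ * (κ - 1ℚ) * K
  c₁  = ½ * κ * κ * (2ℚ * (kq * kq - ½ * kq) + ¼) - ((κ + 1ℚ) * K - (κ - 1ℚ) * K′)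
  c₁′ = - (½ * κ * κ * (2ℚ * κ)) - c₁

  g-step : ∀ n → c₂ * S₂ (suc k) n + (c₁ * S₁ (suc k) n + c₁′ * S₁ (suc (suc k)) n) + - (κ * κ * (2ℚ * κ)) * (g (suc n) - g n)
    ≡ κ * (κ + 1ℚ) * K′ * S₂ (suc (suc k)) n
  g-step n = begin
    c₂ * S₂ (suc k) n + (c₁ * S₁ (suc k) n + c₁′ * S₁ (suc (suc k)) n) + - (κ * κ * (2ℚ * κ)) * (g (suc n) - g n)
      ≡⟨ cong₂ (λ s t → c₂ * S₂ (suc k) n + (c₁ * S₁ (suc k) n + c₁′ * (E n * w n * t)) + - (κ * κ * (2ℚ * κ)) * (s - g n))
           (cong₂ (λ s t → s * t ²) (wN-suc n) (P-suc n)) (X′ n) ⟩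
    c₂ * (ε * w n * Y ²) + (c₁ * (ε * w n * Y) + c₁′ * (ε * w n * Y′)) + - (κ * κ * (2ℚ * κ)) * (w n * R.M n * R.P′ n ² - w n * R.N n * R.P n ²)
      ≡⟨ solve 9 (λ a b c l w M N P P′ → a :+ (b :+ c) :+ (:- l) :* (w :* M :* P′ :- w :* N :* P) := a :+ b :+ c :- w :* (l :* (M :* P′ :- N :* P)))
           refl (c₂ * (ε * w n * Y ²)) (c₁ * (ε * w n * Y)) (c₁′ * (ε * w n * Y′)) (κ * κ * (2ℚ * κ)) (w n) (R.M n) (R.N n) (R.P n ²) (R.P′ n ²) ⟩
    c₂ * (ε * w n * Y ²) + c₁ * (ε * w n * Y) + c₁′ * (ε * w n * Y′) - w n * (κ * κ * (2ℚ * κ) * (R.M n * R.P′ n ² - R.N n * R.P n ²))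
      ≡⟨ cong (λ t → c₂ * (ε * w n * Y ²) + c₁ * (ε * w n * Y) + c₁′ * (ε * w n * Y′) - w n * t) (R.second n) ⟩
    c₂ * (ε * w n * Y ²) + c₁ * (ε * w n * Y) + c₁′ * (ε * w n * Y′)
      - w n * (ε * (κ * (κ - 1ℚ) * K * Y ² - κ * (κ + 1ℚ) * K′ * Y′ ² + ((κ + 1ℚ) * K - (κ - 1ℚ) * K′) * (Y′ - Y)
        - ½ * κ * κ * (2ℚ * κ * Y′ + (2ℚ * c + ¼) * (Y′ - Y))))
      ≡⟨ solve 8 (λ κ K K′ ε w Y Y′ d →
           let c₂ = κ :* (κ :- con 1ℚ) :* K
               c₁ = con ½ :* κ :* κ :* d :- ((κ :+ con 1ℚ) :* K :- (κ :- con 1ℚ) :* K′)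
               c₁′ = :- (con ½ :* κ :* κ :* (con 2ℚ :* κ)) :- c₁ in
           c₂ :* (ε :* w :* (Y :* Y)) :+ c₁ :* (ε :* w :* Y) :+ c₁′ :* (ε :* w :* Y′)
             :- w :* (ε :* (κ :* (κ :- con 1ℚ) :* K :* (Y :* Y) :- κ :* (κ :+ con 1ℚ) :* K′ :* (Y′ :* Y′) :+ ((κ :+ con 1ℚ) :* K :- (κ :- con 1ℚ) :* K′) :* (Y′ :- Y)
               :- con ½ :* κ :* κ :* (con 2ℚ :* κ :* Y′ :+ d :* (Y′ :- Y))))
           := κ :* (κ :+ con 1ℚ) :* K′ :* (ε :* w :* (Y′ :* Y′)))
           refl κ K K′ ε (w n) Y Y′ (2ℚ * c + ¼) ⟩
    κ * (κ + 1ℚ) * K′ * (ε * w n * Y′ ²)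
      ≡⟨ cong (λ t → κ * (κ + 1ℚ) * K′ * (ε * w n * t ²)) (sym (X′ n)) ⟩
    κ * (κ + 1ℚ) * K′ * S₂ (suc (suc k)) n ∎
    where
    open ≡-Reasoning
    ε = E n
    Y = R.Y n
    Y′ = R.Y′ n
    c = kq * kq - ½ * kq

  S₂-multiple : SumsToMultiple (S₁ (suc k)) → SumsToMultiple (S₂ (suc k)) → SumsToMultiple (S₂ (suc (suc k)))
  S₂-multiple h₁ h₂ = Multiple-÷ (κ * (κ + 1ℚ) * K′)
    (≢0 (*-pos (*-pos 0<κ (+-pos 0<κ (positive⁻¹ 1ℚ))) 0<K′)) g-step
    (Multiple-+ (Multiple-+ (Multiple-* c₂ h₂) (Multiple-+ (Multiple-* c₁ h₁) (Multiple-* c₁′ (S₁-multiple h₁))))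
      (Multiple-* (- (κ * κ * (2ℚ * κ))) (Multiple-telescope g 0ℚ g₀ (Null∼0z g-null))))
    where
    g₀ : g 0 ≡ 0ℚ
    g₀ = *-zeroˡ (R.P 0 ²)

S₁-multiple : ∀ k → SumsToMultiple (S₁ (suc k))
S₁-multiple zero    = Base.S₁-multiple
S₁-multiple (suc k) = Step.S₁-multiple k (S₁-multiple k)

S₂-multiple : ∀ k → SumsToMultiple (S₂ (suc k))
S₂-multiple zero    = Base.S₂-multiple
S₂-multiple (suc k) = Step.S₂-multiple k (S₁-multiple k) (S₂-multiple k)

-- Partial fractions of 1/p

multiplicity-here : ∀ r rs → multiplicity r (r ∷ rs) ≡ suc (multiplicity r rs)
multiplicity-here r rs = cong length (filter-accept (r ≟_) refl)

multiplicity-there : ∀ s r rs → multiplicity s rs ℕ.≤ multiplicity s (r ∷ rs)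
multiplicity-there s r rs = cases (s ≟ r)
  where
  cases : Dec (s ≡ r) → multiplicity s rs ℕ.≤ multiplicity s (r ∷ rs)
  cases (yes s≡r) = ℕ.≤-trans (ℕ.n≤1+n _) (ℕ.≤-reflexive (sym (cong length (filter-accept (s ≟_) s≡r))))
  cases (no s≢r)  = ℕ.≤-reflexive (sym (cong length (filter-reject (s ≟_) s≢r)))

multiplicity-All : ∀ {P : ℚ → Set} s {rs} → All P rs → 1 ℕ.≤ multiplicity s rs → P s
multiplicity-All s [] ()
multiplicity-All {P} s {r ∷ rs} (p ∷ ps) 1≤ = cases (s ≟ r)
  where
  cases : Dec (s ≡ r) → P s
  cases (yes s≡r) = subst P (sym s≡r) p
  cases (no s≢r)  = multiplicity-All s ps (ℕ.≤-trans 1≤ (ℕ.≤-reflexive (cong length (filter-reject (s ≟_) s≢r))))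

-- `agree` asks for equality off the roots only: at a pole the default value of `inv` breaks
-- identities such as `split`.
data PartialFractions (rs : List ℚ) : (ℚ → ℚ) → Set where
  simple  : ∀ r → 1 ℕ.≤ multiplicity r rs → PartialFractions rs λ x → inv (x - r)
  double  : ∀ r → 2 ℕ.≤ multiplicity r rs → PartialFractions rs λ x → inv (x - r) ²
  combine : ∀ {f g} a b → PartialFractions rs f → PartialFractions rs g → PartialFractions rs λ x → a * f x + b * g x
  agree   : ∀ {f g} → (∀ x → All (x ≢_) rs → f x ≡ g x) → PartialFractions rs f → PartialFractions rs g

-≢0 : ∀ {x y} → x ≢ y → x - y ≢ 0ℚ
-≢0 {x} {y} x≢y eq = x≢y (trans (solve 2 (λ x y → x := (x :- y) :+ y) refl x y) (trans (cong (_+ y) eq) (+-identityˡ y)))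

split : ∀ {x r s} → r ≢ s → x ≢ r → x ≢ s → inv (x - r) * inv (x - s) ≡ inv (r - s) * inv (x - r) + - inv (r - s) * inv (x - s)
split {x} {r} {s} r≢s x≢r x≢s = begin
  p * q
    ≡⟨ sym (*-identityˡ (p * q)) ⟩
  1ℚ * (p * q)
    ≡⟨ cong (_* (p * q)) (sym (inv-inverseʳ (-≢0 r≢s))) ⟩
  (r - s) * d * (p * q)
    ≡⟨ solve 6 (λ x r s p q d → (r :- s) :* d :* (p :* q) := d :* p :* ((x :- s) :* q) :+ (:- d) :* q :* ((x :- r) :* p)) refl x r s p q d ⟩
  d * p * ((x - s) * q) + - d * q * ((x - r) * p)
    ≡⟨ cong₂ (λ u v → d * p * u + - d * q * v) (inv-inverseʳ (-≢0 x≢s)) (inv-inverseʳ (-≢0 x≢r)) ⟩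
  d * p * 1ℚ + - d * q * 1ℚ
    ≡⟨ cong₂ _+_ (*-identityʳ (d * p)) (*-identityʳ (- d * q)) ⟩
  d * p + - d * q ∎
  where
  open ≡-Reasoning
  p = inv (x - r)
  q = inv (x - s)
  d = inv (r - s)

-- With p = 1/(x-r), q = 1/(x-s) and d = 1/(r-s), the identity p q = d p - d q gives p q² = d (p q)
-- - d q², so a double pole reduces to the simple case. If r = s, a simple pole becomes double, and
-- a triple pole is excluded by the multiplicities.
multiply : ∀ {r rs f} → (∀ s → multiplicity s (r ∷ rs) ℕ.≤ 2) → PartialFractions rs f →
  PartialFractions (r ∷ rs) λ x → inv (x - r) * f x
multiply {r} {rs} mult≤2 (simple s 1≤) = cases (r ≟ s)
  where
  cases : Dec (r ≡ s) → PartialFractions (r ∷ rs) λ x → inv (x - r) * inv (x - s)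
  cases (yes refl) = double r (subst (2 ℕ.≤_) (sym (multiplicity-here r rs)) (ℕ.s≤s 1≤))
  cases (no r≢s)   = agree (λ { x (x≢r ∷ x≢rs) → sym (split r≢s x≢r (multiplicity-All s x≢rs 1≤)) })
    (combine (inv (r - s)) (- inv (r - s))
      (simple r (subst (1 ℕ.≤_) (sym (multiplicity-here r rs)) (ℕ.s≤s ℕ.z≤n)))
      (simple s (ℕ.≤-trans 1≤ (multiplicity-there s r rs))))
multiply {r} {rs} mult≤2 (double s 2≤) = cases (r ≟ s)
  where
  1≤ = ℕ.≤-trans (ℕ.s≤s ℕ.z≤n) 2≤
  cases : Dec (r ≡ s) → PartialFractions (r ∷ rs) λ x → inv (x - r) * inv (x - s) ²
  cases (yes refl) = contradiction (ℕ.≤-trans (ℕ.s≤s 2≤) (ℕ.≤-trans (ℕ.≤-reflexive (sym (multiplicity-here r rs))) (mult≤2 r))) ℕ.1+n≰n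
  cases (no r≢s)   = agree
    (λ { x (x≢r ∷ x≢rs) → trans
      (solve 3 (λ d u q → d :* u :+ (:- d) :* (q :* q) := d :* u :+ (:- d) :* q :* q) refl (inv (r - s)) (inv (x - r) * inv (x - s)) (inv (x - s)))
      (trans (solve 4 (λ d p q u → d :* u :+ (:- d) :* q :* q := (d :* p :+ (:- d) :* q) :* q :+ d :* (u :- p :* q)) refl (inv (r - s)) (inv (x - r)) (inv (x - s)) (inv (x - r) * inv (x - s)))
      (trans (cong₂ (λ u v → u * inv (x - s) + inv (r - s) * v) (sym (split r≢s x≢r (multiplicity-All s x≢rs 1≤))) (+-inverseʳ (inv (x - r) * inv (x - s))))
      (solve 3 (λ d p q → p :* q :* q :+ d :* con 0ℚ := p :* (q :* q)) refl (inv (r - s)) (inv (x - r)) (inv (x - s))))) })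
    (combine (inv (r - s)) (- inv (r - s)) (multiply mult≤2 (simple s 1≤)) (double s (ℕ.≤-trans 2≤ (multiplicity-there s r rs))))
multiply {r} mult≤2 (combine {f} {g} a b h k) = agree
  (λ x _ → solve 5 (λ p a b f g → a :* (p :* f) :+ b :* (p :* g) := p :* (a :* f :+ b :* g)) refl (inv (x - r)) a b (f x) (g x))
  (combine a b (multiply mult≤2 h) (multiply mult≤2 k))
multiply {r} mult≤2 (agree eq h) = agree (λ { x (_ ∷ x≢rs) → cong (inv (x - r) *_) (eq x x≢rs) }) (multiply mult≤2 h)

reciprocal : List ℚ → ℚ → ℚ
reciprocal rs x = foldr (λ r y → inv (x - r) * y) 1ℚ rs

inv-∏ : ∀ rs x → inv (foldr (λ r y → (x - r) * y) 1ℚ rs) ≡ reciprocal rs x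
inv-∏ []       x = refl
inv-∏ (r ∷ rs) x = trans (inv-* (x - r) (foldr (λ r y → (x - r) * y) 1ℚ rs)) (cong (inv (x - r) *_) (inv-∏ rs x))

partial-fractions : ∀ r rs → (∀ s → multiplicity s (r ∷ rs) ℕ.≤ 2) → PartialFractions (r ∷ rs) (reciprocal (r ∷ rs))
partial-fractions r [] mult≤2 = agree (λ x _ → sym (*-identityʳ (inv (x - r))))
  (simple r (subst (1 ℕ.≤_) (sym (multiplicity-here r [])) (ℕ.s≤s ℕ.z≤n)))
partial-fractions r (s ∷ rs) mult≤2 = multiply mult≤2
  (partial-fractions s rs (λ t → ℕ.≤-trans (multiplicity-there t r (s ∷ rs)) (mult≤2 t)))

-- Admissible roots and the reflection x ↦ -1/2 - x

-- Makes the two kinds of roots alike: r and -1/2-r are -(index+1) and index+1/2 in one order or the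
-- other, and both orders give the same product.
record Reflected (r : ℚ) : Set where
  field
    index : ℕ
    n-r≢0 : ∀ n → fromℕ n - r ≢ 0ℚ
    n+½+r≢0 : ∀ n → fromℕ n + ½ + r ≢ 0ℚ
    product : ∀ n → inv (fromℕ n - r) * inv (fromℕ n + ½ + r) ≡ X (suc index) n

open Reflected

reflected : ∀ {r} → Admissible r → Reflected r
reflected {r} (inj₁ (k , refl)) = record
  { index   = k
  ; n-r≢0   = λ n eq → ≢0 (0<fromℕ+ n (0<fromℕ-suc k)) (trans (cong (fromℕ n +_) (sym (neg-neg (fromℕ (suc k))))) eq)
  ; n+½+r≢0 = λ n → half-integer≢0 n (suc k)
  ; product = λ n → cong (λ t → inv (fromℕ n + t) * inv (fromℕ n + ½ - fromℕ (suc k))) (neg-neg (fromℕ (suc k)))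
  }
  where
  neg-neg : ∀ q → - (- q) ≡ q
  neg-neg = solve 1 (λ q → :- (:- q) := q) refl
reflected {r} (inj₂ (k , r≡)) = record
  { index   = k
  ; n-r≢0   = λ n eq → half-integer≢0 n (suc k) (trans (sym (minus n)) eq)
  ; n+½+r≢0 = λ n eq → ≢0 (0<fromℕ+ n (0<fromℕ-suc k)) (trans (sym (plus n)) eq)
  ; product = λ n → trans (cong₂ (λ s t → inv s * inv t) (minus n) (plus n)) (*-comm _ (inv (fromℕ n + fromℕ (suc k))))
  }
  where
  r≡k+½ : r ≡ fromℕ k + ½
  r≡k+½ = trans r≡ (trans (/-inv (suc (2 ℕ.* k)) 1) (trans (cong (_* ½) (fromℕ-odd k))
    (solve 1 (λ k → (con 2ℚ :* k :+ con 1ℚ) :* con ½ := k :+ con ½) refl (fromℕ k))))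
  minus : ∀ n → fromℕ n - r ≡ fromℕ n + ½ - fromℕ (suc k)
  minus n = trans (cong (λ t → fromℕ n - t) r≡k+½)
    (trans (solve 2 (λ n k → n :- (k :+ con ½) := n :+ con ½ :- (k :+ con 1ℚ)) refl (fromℕ n) (fromℕ k))
      (cong (λ t → fromℕ n + ½ - t) (sym (fromℕ-suc k))))
  plus : ∀ n → fromℕ n + ½ + r ≡ fromℕ n + fromℕ (suc k)
  plus n = trans (cong (λ t → fromℕ n + ½ + t) r≡k+½)
    (trans (solve 2 (λ n k → n :+ con ½ :+ (k :+ con ½) := n :+ (k :+ con 1ℚ)) refl (fromℕ n) (fromℕ k))
      (cong (λ t → fromℕ n + t) (sym (fromℕ-suc k))))

inv-reflection : ∀ n r → inv (-½ - fromℕ n - r) ≡ - inv (fromℕ n + ½ + r)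
inv-reflection n r = trans (cong inv (solve 2 (λ n r → con -½ :- n :- r := con (- 1ℚ) :* (n :+ con ½ :+ r)) refl (fromℕ n) r))
  (trans (inv-* (- 1ℚ) (fromℕ n + ½ + r)) (solve 1 (λ i → con (- 1ℚ) :* i := :- i) refl (inv (fromℕ n + ½ + r))))

reflection-difference : ∀ {r} → Reflected r → ∀ n →
  inv (fromℕ n - r) - inv (fromℕ n + ½ + r) ≡ (2ℚ * r + ½) * (inv (fromℕ n - r) * inv (fromℕ n + ½ + r))
reflection-difference {r} ρ n = begin
  p - q
    ≡⟨ sym (cong₂ _-_ (*-identityʳ p) (*-identityʳ q)) ⟩
  p * 1ℚ - q * 1ℚ
    ≡⟨ sym (cong₂ (λ s t → p * s - q * t) (inv-inverseʳ (n+½+r≢0 ρ n)) (inv-inverseʳ (n-r≢0 ρ n))) ⟩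
  p * ((x + ½ + r) * q) - q * ((x - r) * p)
    ≡⟨ solve 4 (λ x r p q → p :* ((x :+ con ½ :+ r) :* q) :- q :* ((x :- r) :* p) := (con 2ℚ :* r :+ con ½) :* (p :* q)) refl x r p q ⟩
  (2ℚ * r + ½) * (p * q) ∎
  where
  open ≡-Reasoning
  x = fromℕ n
  p = inv (x - r)
  q = inv (x + ½ + r)

symmetrised : (ℚ → ℚ) → ℕ → ℚ
symmetrised f n = E n * w n * (f (fromℕ n) + f (-½ - fromℕ n))

-- Let p = 1/(n-r) and q = 1/(n+1/2+r), so that the value at -1/2-n is -q. With c = 2r + 1/2 and X =
-- pq, a simple pole gives p - q = cX, and a double pole p² + q² = (p-q)² + 2pq = c²X² + 2X.
symmetrised-multiple : ∀ {rs f} → All Admissible rs → PartialFractions rs f → SumsToMultiple (symmetrised f)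
symmetrised-multiple adm (simple r 1≤) = Multiple-ext eq (Multiple-* (2ℚ * r + ½) (S₁-multiple (index ρ)))
  where
  open ≡-Reasoning
  ρ = reflected (multiplicity-All r adm 1≤)
  eq : ∀ n → (2ℚ * r + ½) * S₁ (suc (index ρ)) n ≡ symmetrised (λ x → inv (x - r)) n
  eq n = begin
    (2ℚ * r + ½) * (E n * w n * X (suc (index ρ)) n)
      ≡⟨ solve 3 (λ c e x → c :* (e :* x) := e :* (c :* x)) refl (2ℚ * r + ½) (E n * w n) (X (suc (index ρ)) n) ⟩
    E n * w n * ((2ℚ * r + ½) * X (suc (index ρ)) n)
      ≡⟨ cong (E n * w n *_) (trans (cong ((2ℚ * r + ½) *_) (sym (product ρ n))) (sym (reflection-difference ρ n))) ⟩
    E n * w n * (inv (fromℕ n - r) - inv (fromℕ n + ½ + r))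
      ≡⟨ cong (λ t → E n * w n * (inv (fromℕ n - r) + t)) (sym (inv-reflection n r)) ⟩
    symmetrised (λ x → inv (x - r)) n ∎
symmetrised-multiple adm (double r 2≤) = Multiple-ext eq
  (Multiple-+ (Multiple-* (c ²) (S₂-multiple (index ρ))) (Multiple-* 2ℚ (S₁-multiple (index ρ))))
  where
  open ≡-Reasoning
  ρ = reflected (multiplicity-All r adm (ℕ.≤-trans (ℕ.s≤s ℕ.z≤n) 2≤))
  c = 2ℚ * r + ½
  eq : ∀ n → c ² * S₂ (suc (index ρ)) n + 2ℚ * S₁ (suc (index ρ)) n ≡ symmetrised (λ x → inv (x - r) ²) n
  eq n = begin
    c ² * (E n * w n * X (suc (index ρ)) n ²) + 2ℚ * (E n * w n * X (suc (index ρ)) n)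
      ≡⟨ solve 3 (λ c e x → c :* c :* (e :* (x :* x)) :+ con 2ℚ :* (e :* x) := e :* ((c :* x) :* (c :* x) :+ con 2ℚ :* x)) refl c (E n * w n) (X (suc (index ρ)) n) ⟩
    E n * w n * ((c * X (suc (index ρ)) n) ² + 2ℚ * X (suc (index ρ)) n)
      ≡⟨ cong (λ t → E n * w n * ((c * t) ² + 2ℚ * t)) (sym (product ρ n)) ⟩
    E n * w n * ((c * (p n * q n)) ² + 2ℚ * (p n * q n))
      ≡⟨ cong (λ t → E n * w n * (t ² + 2ℚ * (p n * q n))) (sym (reflection-difference ρ n)) ⟩
    E n * w n * ((p n - q n) ² + 2ℚ * (p n * q n))
      ≡⟨ solve 3 (λ e p q → e :* ((p :- q) :* (p :- q) :+ con 2ℚ :* (p :* q)) := e :* (p :* p :+ (:- q) :* (:- q))) refl (E n * w n) (p n) (q n) ⟩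
    E n * w n * (p n ² + (- q n) ²)
      ≡⟨ cong (λ t → E n * w n * (p n ² + t ²)) (sym (inv-reflection n r)) ⟩
    symmetrised (λ x → inv (x - r) ²) n ∎
    where
    p q : ℕ → ℚ
    p n = inv (fromℕ n - r)
    q n = inv (fromℕ n + ½ + r)
symmetrised-multiple adm (combine {f} {g} a b h k) = Multiple-ext
  (λ n → solve 7 (λ e a b f f′ g g′ → a :* (e :* (f :+ f′)) :+ b :* (e :* (g :+ g′)) := e :* ((a :* f :+ b :* g) :+ (a :* f′ :+ b :* g′)))
    refl (E n * w n) a b (f (fromℕ n)) (f (-½ - fromℕ n)) (g (fromℕ n)) (g (-½ - fromℕ n)))
  (Multiple-+ (Multiple-* a (symmetrised-multiple adm h)) (Multiple-* b (symmetrised-multiple adm k)))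
symmetrised-multiple adm (agree {f} {g} eq h) = Multiple-ext
  (λ n → cong₂ (λ s t → E n * w n * (s + t))
    -- Neither n nor -1/2-n is an admissible number, so agreement off the roots suffices.
    (eq (fromℕ n) (All.map (λ {r} ad n≡r → n-r≢0 (reflected ad) n (trans (cong (_- r) n≡r) (+-inverseʳ r))) adm))
    (eq (-½ - fromℕ n) (All.map (λ {r} ad n≡r → n+½+r≢0 (reflected ad) n (trans (cong (λ t → fromℕ n + ½ + t) (sym n≡r))
      (solve 1 (λ n → n :+ con ½ :+ (con -½ :- n) := con 0ℚ) refl (fromℕ n)))) adm)))
  (symmetrised-multiple adm h)

-- Monic polynomials of positive degree are not constant

quotient : ℚ → Poly → Poly
quotient a []       = []
quotient a (c ∷ cs) = eval cs a ∷ quotient a cs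

eval-quotient : ∀ a p x → eval p x ≡ eval p a + (x - a) * eval (quotient a p) x
eval-quotient a []       x = sym (trans (+-identityˡ ((x - a) * 0ℚ)) (*-zeroʳ (x - a)))
eval-quotient a (c ∷ cs) x = trans (cong (λ t → c + x * t) (eval-quotient a cs x))
  (solve 5 (λ a c x u q → c :+ x :* (u :+ (x :- a) :* q) := (c :+ a :* u) :+ (x :- a) :* (u :+ x :* q))
    refl a c x (eval cs a) (eval (quotient a cs) x))

-- In synthetic division the coefficients of the quotient are the intermediate Horner values at `a`;
-- the leading one can thus be read off from that of `p`.
coeff-quotient : ∀ a p k → coeff (quotient a p) k ≡ eval (drop (suc k) p) a
coeff-quotient a []       k       = refl
coeff-quotient a (c ∷ cs) zero    = refl
coeff-quotient a (c ∷ cs) (suc k) = coeff-quotient a cs k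

coeff-drop : ∀ m p k → coeff (drop m p) k ≡ coeff p (m ℕ.+ k)
coeff-drop zero    p        k = refl
coeff-drop (suc m) []       k = refl
coeff-drop (suc m) (c ∷ cs) k = coeff-drop m cs k

eval-zero : ∀ p x → (∀ k → coeff p k ≡ 0ℚ) → eval p x ≡ 0ℚ
eval-zero []       x h = refl
eval-zero (c ∷ cs) x h = trans (cong₂ (λ s t → s + x * t) (h 0) (eval-zero cs x (λ k → h (suc k))))
  (solve 1 (λ x → con 0ℚ :+ x :* con 0ℚ := con 0ℚ) refl x)

eval-monic₀ : ∀ p x → MonicOfDegree 0 p → eval p x ≡ 1ℚ
eval-monic₀ []       x (() , _)
eval-monic₀ (c ∷ cs) x (c≡1 , h) = trans (cong₂ (λ s t → s + x * t) c≡1 (eval-zero cs x (λ k → h (suc k) (ℕ.s≤s ℕ.z≤n))))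
  (solve 1 (λ x → con 1ℚ :+ x :* con 0ℚ := con 1ℚ) refl x)

quotient-monic : ∀ a d p → MonicOfDegree (suc d) p → MonicOfDegree d (quotient a p)
quotient-monic a d p (lead , h) =
  trans (coeff-quotient a p d) (eval-monic₀ (drop (suc d) p) a
    (trans (coeff-drop (suc d) p 0) (trans (cong (coeff p) (ℕ.+-identityʳ (suc d))) lead) ,
     λ { (suc k) _ → trans (coeff-drop (suc d) p (suc k)) (h (suc d ℕ.+ suc k) (ℕ.m<m+n (suc d) (ℕ.s≤s ℕ.z≤n))) })) ,
  λ k d<k → trans (coeff-quotient a p k) (eval-zero (drop (suc k) p) a
    (λ j → trans (coeff-drop (suc k) p j) (h (suc k ℕ.+ j) (ℕ.≤-trans (ℕ.s≤s d<k) (ℕ.m≤m+n (suc k) j)))))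

-- The quotient by x - N is monic of degree d and vanishes at all n > N. It is thus again constant,
-- now from N + 1 on, and the descent ends with 1 = 0 in degree 0.
monic-nonconstant : ∀ d p c N → MonicOfDegree (suc d) p → (∀ n → N ℕ.≤ n → eval p (fromℕ n) ≡ c) → ⊥
monic-nonconstant d p c N monic const = finish d (quotient-monic (fromℕ N) d p monic)
  where
  q = quotient (fromℕ N) p
  vanishes : ∀ n → suc N ℕ.≤ n → eval q (fromℕ n) ≡ 0ℚ
  vanishes n N<n = *-cancelˡ-≡ (fromℕ n - fromℕ N) (≢0 {fromℕ n - fromℕ N} (<-≤-trans (positive⁻¹ 1ℚ)
      (subst (_≤ fromℕ n - fromℕ N) (trans (cong (_- fromℕ N) (fromℕ-suc N)) (solve 1 (λ x → x :+ con 1ℚ :- x := con 1ℚ) refl (fromℕ N)))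
        (+-monoˡ-≤ (- fromℕ N) (fromℕ-mono-≤ N<n)))))
    (begin
      (fromℕ n - fromℕ N) * eval q (fromℕ n)
        ≡⟨ solve 2 (λ u v → v := (u :+ v) :- u) refl (eval p (fromℕ N)) ((fromℕ n - fromℕ N) * eval q (fromℕ n)) ⟩
      (eval p (fromℕ N) + (fromℕ n - fromℕ N) * eval q (fromℕ n)) - eval p (fromℕ N)
        ≡⟨ cong (_- eval p (fromℕ N)) (sym (eval-quotient (fromℕ N) p (fromℕ n))) ⟩
      eval p (fromℕ n) - eval p (fromℕ N)
        ≡⟨ cong₂ _-_ (const n (ℕ.<⇒≤ N<n)) (const N ℕ.≤-refl) ⟩
      c - c
        ≡⟨ +-inverseʳ c ⟩
      0ℚ
        ≡⟨ sym (*-zeroʳ (fromℕ n - fromℕ N)) ⟩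
      (fromℕ n - fromℕ N) * 0ℚ ∎)
    where open ≡-Reasoning
  finish : ∀ e → MonicOfDegree e q → ⊥
  finish zero    m = 1≢0 (trans (sym (eval-monic₀ q (fromℕ (suc N)) m)) (vanishes (suc N) ℕ.≤-refl))
  finish (suc e) m = monic-nonconstant e q 0ℚ (suc N) m vanishes

-- The sum of the series

HasSum-multiple : ∀ {f} ((sumsTo q _) : SumsToMultiple f) → HasSum f (fromℚ q *ℝ 1/π²)
-- The m-th partial sum is near q z(m), and z(m) is near z(n) by the Cauchy property; `ε′` is the
-- slack in `≤ℝ`.
HasSum-multiple {f} (sumsTo q (asymptotic h)) ε 0<ε = M ℕ.⊔ N , λ m MN≤m ε′ 0<ε′ → N , λ n N≤n → begin
    ∣ ∑< m f - q * z n ∣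
      ≤⟨ triangle (∑< m f) (q * z m) (q * z n) ⟩
    ∣ ∑< m f - q * z m ∣ + ∣ q * z m - q * z n ∣
      ≤⟨ +-mono-≤ (proj₂ near m (ℕ.m⊔n≤o⇒m≤o M N MN≤m)) (proj₂ close m n (ℕ.m⊔n≤o⇒n≤o M N MN≤m) N≤n) ⟩
    ½ * ε + ½ * ε
      ≡⟨ solve 1 (λ e → con ½ :* e :+ con ½ :* e := e) refl ε ⟩
    ε
      ≤⟨ ≤-from-difference {ε} ε′ (<⇒≤ 0<ε′) refl ⟩
    ε + ε′ ∎
  where
  open ≤-Reasoning
  0<½ε = *-pos (positive⁻¹ ½) 0<ε
  near = small h (½ * ε) 0<½ε
  close = cauchy (fromℚ q *ℝ 1/π²) (½ * ε) 0<½ε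
  M = proj₁ near
  N = proj₁ close

corollary2 : (p : Poly) (d : ℕ) (rs : List ℚ) →
    MonicOfDegree d p →
    2 ∣ d →
    0 ℕ.< d →
    HasRoots p rs →
    All Admissible rs →
    (∀ r → multiplicity r rs ℕ.≤ 2) →
    (∀ x → eval p x ≡ eval p (-½ - x)) →
    ∃[ s ] HasSum (summand p) s × IsRationalMultipleOf s 1/π²
-- Without roots p would take the value 1 at every natural number.
corollary2 p (suc d) [] monic _ _ roots _ _ _ = ⊥-elim (monic-nonconstant d p 1ℚ 0 monic (λ n _ → roots (fromℕ n)))
corollary2 p (suc d) (r ∷ rs) monic _ _ roots admissible mult≤2 symmetric =
  -- The sum is given as the multiple itself, so the last component is reflexivity of `≃`.
  fromℚ q *ℝ 1/π² , HasSum-multiple total , q , λ ε 0<ε → 0 , λ n _ →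
    subst (λ t → ∣ t ∣ ≤ ε) (sym (+-inverseʳ (q * z n))) (<⇒≤ 0<ε)
  where
  open ≡-Reasoning
  f = reciprocal (r ∷ rs)
  inv-p : ∀ x → inv (eval p x) ≡ f x
  inv-p x = trans (cong inv (roots x)) (inv-∏ (r ∷ rs) x)
  -- By the symmetry of p, 1/p takes the same value at n and at -1/2-n.
  eq : ∀ n → symmetrised f n ≡ 2ℚ * summand p n
  eq n = begin
    E n * w n * (f (fromℕ n) + f (-½ - fromℕ n))
      ≡⟨ cong₂ (λ s t → E n * w n * (s + t)) (sym (inv-p (fromℕ n)))
           (trans (sym (inv-p (-½ - fromℕ n))) (cong inv (sym (symmetric (fromℕ n))))) ⟩
    E n * w n * (i + i)
      ≡⟨ solve 3 (λ e w i → e :* w :* (i :+ i) := con 2ℚ :* (e :* i :* w)) refl (E n) (w n) i ⟩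
    2ℚ * (E n * i * w n)
      ≡⟨ cong (λ t → 2ℚ * (t * i * w n)) (sym (trans (fromℕ-+ (4 ℕ.* n) 1) (cong (_+ 1ℚ) (fromℕ-* 4 n)))) ⟩
    2ℚ * summand p n ∎
    where i = inv (eval p (fromℕ n))
  total : SumsToMultiple (summand p)
  total = Multiple-÷ 2ℚ (λ ()) eq (symmetrised-multiple admissible (partial-fractions r rs mult≤2))
  q = SumsToMultiple.multiple total
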